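{- The problem $1|er|\max L_j$ (given jobs $J$ with processing times $p_j$ and due dates $d_j$, a subset $J^r\subseteq J$ and a budget $K^r$, find a sequence of $J$ minimizing $\max_{j\in J}L_j$, where $L_j=C_j-d_j$, among all sequences with renting period of length $er\le K^r$) can be solved in $\mathrm{O}(nP)$ time, where $n=|J|$ and $P=\sum_{j\in J}p_j$.
   Context: An instance has a finite set $J$ of $n$ jobs; job $j$ has a non-negative integer processing time $p_j$ and a due date $d_j$. A non-empty subset $J^r\subseteq J$ (the r-jobs) requires an external resource. A sequence is a permutation of $J$; the jobs are processed one at a time on a single machine in this order, non-preemptively, from time $0$ without idle time. $C_j$ is the completion time of job $j$. The resource is rented once, without interruption, from the start of the first r-job to the completion of the last r-job, so $er=\max_{j\in J^r} C_j-\min_{j\in J^r}(C_j-p_j)$. -}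

module Defs where

open import Algebra.Properties.CommutativeMonoid.Sum using (sum)
open import Data.Bool.Base using (if_then_else_)
open import Data.Fin.Base using (Fin; zero; suc; toℕ)
import Data.Fin.Properties as Fin
open import Data.Fin.Permutation using (Permutation′; _⟨$⟩ʳ_; _⟨$⟩ˡ_)
open import Data.Fin.Subset using (Subset; Nonempty; ⊤)
open import Data.Fin.Subset.Properties using (_∈?_; ∈⊤)
open import Data.Integer.Base using (ℤ; +_; -[1+_]; 0ℤ; 1ℤ; _+_; _-_; _≤_)
import Data.Integer.Properties as ℤ
open import Data.List.Base using (List; allFin; filter; map)
open import Data.List.Extrema ℤ.≤-totalOrder using (max; min)
import Data.Nat.Base as ℕ
open ℕ using (ℕ; zero; suc)
import Data.Nat.Properties as ℕ
open import Data.Product.Base using (Σ-syntax; _×_; _,_; proj₁)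
open import Data.Sum.Base using (_⊎_)
open import Relation.Binary.PropositionalEquality.Core using (_≡_)
open import Relation.Nullary using (¬_; does)

Σℕ : ∀ {n} → (Fin n → ℕ) → ℕ
Σℕ = sum ℕ.+-0-commutativeMonoid

values : ∀ {n} → Subset n → (Fin n → ℤ) → List ℤ
values {n} S f = map f (filter (_∈? S) (allFin n))

-- The seed f (proj₁ ne) is itself one of the values, so these are the exact
-- extrema of f over S.
maxOver minOver : ∀ {n} (S : Subset n) → Nonempty S → (Fin n → ℤ) → ℤ
maxOver S ne f = max (f (proj₁ ne)) (values S f)
minOver S ne f = min (f (proj₁ ne)) (values S f)

record Instance : Set where
  field
    n   : ℕ
    p   : Fin n → ℕ
    d   : Fin n → ℤ
    Jʳ  : Subset n
    Jʳ≠∅ : Nonempty Jʳ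
    Kʳ  : ℤ

  P : ℕ
  P = Σℕ p

  -- π ⟨$⟩ʳ k is the job in position k, π ⟨$⟩ˡ j is the position of job j.
  Sequence : Set
  Sequence = Permutation′ n

  C : Sequence → Fin n → ℤ
  C π j = + Σℕ λ i → if does ((π ⟨$⟩ˡ i) Fin.≤? (π ⟨$⟩ˡ j)) then p i else 0

  L : Sequence → Fin n → ℤ
  L π j = C π j - d j

  Lmax : Sequence → ℤ
  Lmax π = maxOver ⊤ (proj₁ Jʳ≠∅ , ∈⊤) (L π)

  er : Sequence → ℤ
  er π = maxOver Jʳ Jʳ≠∅ (C π) - minOver Jʳ Jʳ≠∅ (λ j → C π j - + p j)

  Feasible : Sequence → Set
  Feasible π = er π ≤ Kʳ

  Optimal : Sequence → Set
  Optimal π = Feasible π × (∀ σ → Feasible σ → Lmax π ≤ Lmax σ)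

-- Programs of a unit-cost random access machine on integers.
-- A program mentions only finitely many arrays, each of them unbounded and
-- indexed by ℤ; interleaving these arrays in one memory turns it into an
-- ordinary RAM program that is slower by a constant factor only.  A scalar
-- variable is a fixed cell of some array.  The arithmetic is restricted to
-- addition and subtraction.

Store : Set
Store = (array : ℕ) (index : ℤ) → ℤ

infixl 6 _⊕_ _⊖_
infix  5 _[_]≔_
infixr 4 _⨾_

data Exp : Set where
  lit     : ℤ → Exp
  _[_]    : ℕ → Exp → Exp
  _⊕_ _⊖_ : Exp → Exp → Exp

data Test : Set where
  _≼_ : Exp → Exp → Test

data Prog : Set where
  skip    : Prog
  _[_]≔_  : ℕ → Exp → Exp → Prog
  _⨾_     : Prog → Prog → Prog
  if_th_el_ : Test → Prog → Prog → Prog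
  while_loop_ : Test → Prog → Prog

⟦_⟧ : Exp → Store → ℤ
⟦ lit z ⟧   s = z
⟦ a [ e ] ⟧ s = s a (⟦ e ⟧ s)
⟦ e ⊕ f ⟧   s = ⟦ e ⟧ s + ⟦ f ⟧ s
⟦ e ⊖ f ⟧   s = ⟦ e ⟧ s - ⟦ f ⟧ s

Holds : Test → Store → Set
Holds (e ≼ f) s = ⟦ e ⟧ s ≤ ⟦ f ⟧ s

_[_,_↦_] : Store → ℕ → ℤ → ℤ → Store
(s [ a , i ↦ z ]) b j =
  if does (a ℕ.≟ b) then (if does (i ℤ.≟ j) then z else s b j) else s b j

costᴱ : Exp → ℕ
costᴱ (lit z)   = 1
costᴱ (a [ e ]) = 1 ℕ.+ costᴱ e
costᴱ (e ⊕ f)   = 1 ℕ.+ (costᴱ e ℕ.+ costᴱ f)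
costᴱ (e ⊖ f)   = 1 ℕ.+ (costᴱ e ℕ.+ costᴱ f)

costᵀ : Test → ℕ
costᵀ (e ≼ f) = 1 ℕ.+ (costᴱ e ℕ.+ costᴱ f)

-- ⟨ c , s ⟩⇓[ t ] s′: started in s, the program c halts in s′ after exactly
-- t elementary operations.
data ⟨_,_⟩⇓[_]_ : Prog → Store → ℕ → Store → Set where

  ⇓skip   : ∀ {s} → ⟨ skip , s ⟩⇓[ 1 ] s

  ⇓assign : ∀ {s a e f} →
            ⟨ a [ e ]≔ f , s ⟩⇓[ 1 ℕ.+ (costᴱ e ℕ.+ costᴱ f) ]
              (s [ a , ⟦ e ⟧ s ↦ ⟦ f ⟧ s ])

  ⇓seq    : ∀ {s s′ s″ b c t u} →
            ⟨ b , s ⟩⇓[ t ] s′ → ⟨ c , s′ ⟩⇓[ u ] s″ →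
            ⟨ b ⨾ c , s ⟩⇓[ t ℕ.+ u ] s″

  ⇓then   : ∀ {s s′ q b c t} → Holds q s →
            ⟨ b , s ⟩⇓[ t ] s′ →
            ⟨ if q th b el c , s ⟩⇓[ costᵀ q ℕ.+ t ] s′

  ⇓else   : ∀ {s s′ q b c t} → ¬ Holds q s →
            ⟨ c , s ⟩⇓[ t ] s′ →
            ⟨ if q th b el c , s ⟩⇓[ costᵀ q ℕ.+ t ] s′

  ⇓stop   : ∀ {s q b} → ¬ Holds q s →
            ⟨ while q loop b , s ⟩⇓[ costᵀ q ] s

  ⇓loop   : ∀ {s s′ s″ q b t u} → Holds q s →
            ⟨ b , s ⟩⇓[ t ] s′ → ⟨ while q loop b , s′ ⟩⇓[ u ] s″ →
            ⟨ while q loop b , s ⟩⇓[ costᵀ q ℕ.+ (t ℕ.+ u) ] s″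

cells : ∀ {n} → (Fin n → ℤ) → ℤ → ℤ
cells {zero}  f i           = 0ℤ
cells {suc n} f -[1+ i ]    = 0ℤ
cells {suc n} f (+ zero)    = f zero
cells {suc n} f (+ (suc i)) = cells (λ j → f (suc j)) (+ i)

-- Arrays 0 to 4 hold n, Kʳ, p, d and the indicator function of Jʳ, starting
-- at index 0; every other cell is 0.
input : Instance → Store
input I = arrays
  where
  open Instance I
  arrays : Store
  arrays 0 = cells {1} (λ _ → + n)
  arrays 1 = cells {1} (λ _ → Kʳ)
  arrays 2 = cells (λ j → + p j)
  arrays 3 = cells d
  arrays 4 = cells (λ j → if does (j ∈? Jʳ) then 1ℤ else 0ℤ)
  arrays _ = λ _ → 0ℤ

-- Cell 0 of array 5 tells whether a feasible sequence exists; if so, array 6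
-- lists the jobs in the order of an optimal one.
Solves : Instance → Store → Set
Solves I s =
    (s 5 0ℤ ≡ 1ℤ ×
     Σ[ π ∈ Sequence ] Optimal π × (∀ k → s 6 (+ toℕ k) ≡ + toℕ (π ⟨$⟩ʳ k)))
  ⊎ (s 5 0ℤ ≡ 0ℤ × (∀ π → ¬ Feasible π))
  where open Instance I

module Submission where

-- The jobs are put in earliest-due-date order, with due dates capped at
-- dmin + P; the cap makes a counting sort possible and is harmless, since every
-- sequence has a maximum lateness of at least − dmin.  For an index k, consider
-- the sequences that run some non-r-jobs below k first, then the rental period
-- with all r-jobs and the remaining non-r-jobs below k (the fillers), and
-- finally the non-r-jobs from k on, each part in due date order.
--
-- In a feasible sequence the last job of a set X completes no earlier than the
-- load of X.  Choosing k as the first non-r-job after the rental period, and as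
-- first part the non-r-jobs below k that precede the period, this observation
-- bounds the lateness of every job of the rearranged sequence, without any
-- exchange argument.  It also bounds the due date order of all jobs, which takes
-- care of the first part.  What remains is to choose the fillers: since the load
-- of the period is R + (fillers) ≤ K, a table indexed by a job and a filler
-- budget b ≤ β = min (K − R) P serves all k at once, because a filler load below
-- β may be shifted upwards to end at β exactly.

open import Defs
open import Algebra.Properties.CommutativeMonoid.Sum using (sum-cong-≗; sum-permute)
open import Data.Bool.Base using (Bool; true; false; T; if_then_else_; not; _∧_; _∨_)
open import Data.Empty using (⊥; ⊥-elim)
open import Data.Fin.Base using (Fin; zero; suc; toℕ; fromℕ<; punchOut)
open import Data.Fin.Permutation using (Permutation′; permutation; _⟨$⟩ʳ_; _⟨$⟩ˡ_; inverseˡ; inverseʳ; _∘ₚ_)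
import Data.Fin.Permutation as Perm
import Data.Fin.Properties as Fin
open import Data.Fin.Subset using (Subset; Nonempty; ⊤; _∈_)
open import Data.Fin.Subset.Properties using (_∈?_; ∈⊤)
open import Data.Integer.Base as ℤ using (ℤ; +_; 0ℤ; 1ℤ; +≤+)
import Data.Integer.Properties as ℤ
open import Data.Integer.Tactic.RingSolver using (solve-∀)
open import Data.List.Base using (allFin)
open import Data.List.Extrema ℤ.≤-totalOrder using (max≤v⁺; v≤min⁺; xs≤max; min≤xs)
import Data.List.Membership.Propositional as List
open import Data.List.Membership.Propositional.Properties using (∈-map⁺; ∈-map⁻; ∈-filter⁺; ∈-filter⁻; ∈-allFin)
import Data.List.Relation.Unary.All as All
open import Data.Nat.Base
open import Data.Nat.Properties
open import Algebra.Properties.CommutativeSemigroup +-commutativeSemigroup using (interchange)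
open import Data.Nat.Tactic.RingSolver using () renaming (solve-∀ to ℕ-solve-∀)
open import Data.Product.Base using (Σ-syntax; ∃; _×_; _,_; proj₁; proj₂)
open import Data.Sum.Base as Sum using (_⊎_; inj₁; inj₂)
open import Function.Base using (_∘_)
open import Function.Definitions using (Injective)
open import Relation.Binary.Definitions using (tri<; tri≈; tri>)
open import Relation.Binary.PropositionalEquality hiding ([_])
open import Relation.Nullary
open import Relation.Nullary.Decidable using (dec-true; dec-false; _⊎-dec_; _×-dec_)

-- Finite sums and permutations

-- Completion times inside the period depend on its start, hence on the cut k and on all the
-- fillers, which seems to ask for a separate table for every k. But each non-r-job below k either
-- precedes the period or fills it, so with filler load F the period starts at `N k` - F. Letting
-- the filler load end at β removes k from the recursion, and `cut k` restores it by adding `N k` -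
-- β. The r-jobs from k on do not enter `G k`: all their predecessors have smaller indices, so the
-- bound on the due date order covers them as it covers the first part. Hence the value h that the
-- program minimises need not be the maximum lateness of its output. Instead, the output is compared
-- with each feasible σ separately: h and the bound on the due date order are both at most `Lmax σ`.
-- A feasible sequence exists exactly if R ≤ K, which the program tests; so K - R is a natural
-- number whenever the table is built.

∑ : ℕ → (ℕ → ℕ) → ℕ
∑ zero    f = 0
∑ (suc n) f = ∑ n f + f n

∑-cong : ∀ n {f g : ℕ → ℕ} → (∀ i → i < n → f i ≡ g i) → ∑ n f ≡ ∑ n g
∑-cong zero    eq = refl
∑-cong (suc n) eq = cong₂ _+_ (∑-cong n λ i i<n → eq i (m<n⇒m<1+n i<n)) (eq n ≤-refl)

∑-mono-≤ : ∀ n {f g : ℕ → ℕ} → (∀ i → i < n → f i ≤ g i) → ∑ n f ≤ ∑ n g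
∑-mono-≤ zero    le = z≤n
∑-mono-≤ (suc n) le = +-mono-≤ (∑-mono-≤ n λ i i<n → le i (m<n⇒m<1+n i<n)) (le n ≤-refl)

∑-mono-< : ∀ n {f g : ℕ → ℕ} {j} → (∀ i → i < n → f i ≤ g i) → j < n → f j < g j → ∑ n f < ∑ n g
∑-mono-< (suc n) {j = j} le j<1+n lt with j ≟ n
... | yes refl = +-mono-≤-< (∑-mono-≤ n λ i i<n → le i (m<n⇒m<1+n i<n)) lt
... | no  j≢n  = +-mono-<-≤
  (∑-mono-< n (λ i i<n → le i (m<n⇒m<1+n i<n)) (≤∧≢⇒< (s≤s⁻¹ j<1+n) j≢n) lt) (le n ≤-refl)

∑-update : ∀ n {f g : ℕ → ℕ} {j} → (∀ i → i < n → i ≢ j → f i ≡ g i) → j < n → f j ≡ suc (g j) →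
           ∑ n f ≡ suc (∑ n g)
∑-update (suc n) {f} {g} {j} eq j<1+n eqj with j ≟ n
... | yes refl = trans
  (cong₂ _+_ (∑-cong n λ i i<n → eq i (m<n⇒m<1+n i<n) (<⇒≢ i<n)) eqj) (+-suc (∑ n g) (g n))
... | no  j≢n  = cong₂ _+_
  (∑-update n (λ i i<n → eq i (m<n⇒m<1+n i<n)) (≤∧≢⇒< (s≤s⁻¹ j<1+n) j≢n) eqj)
  (eq n ≤-refl (j≢n ∘ sym))

∑-+ : ∀ n (f g : ℕ → ℕ) → ∑ n (λ i → f i + g i) ≡ ∑ n f + ∑ n g
∑-+ zero    f g = refl
∑-+ (suc n) f g = trans (cong (_+ (f n + g n)) (∑-+ n f g)) (interchange (∑ n f) (∑ n g) (f n) (g n))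

∑-0 : ∀ n → ∑ n (λ _ → 0) ≡ 0
∑-0 zero    = refl
∑-0 (suc n) = trans (+-identityʳ _) (∑-0 n)

∑-1 : ∀ n → ∑ n (λ _ → 1) ≡ n
∑-1 zero    = refl
∑-1 (suc n) = trans (+-comm _ 1) (cong suc (∑-1 n))

∑-∘suc : ∀ n (f : ℕ → ℕ) → ∑ (suc n) f ≡ f 0 + ∑ n (f ∘ suc)
∑-∘suc zero    f = +-comm 0 (f 0)
∑-∘suc (suc n) f = trans (cong (_+ f (suc n)) (∑-∘suc n f)) (+-assoc (f 0) _ _)

ι : Bool → ℕ
ι b = if b then 1 else 0

ι≤1 : ∀ b → ι b ≤ 1
ι≤1 true  = ≤-refl
ι≤1 false = z≤n

ι-true : ∀ {p} {A : Set p} (a? : Dec A) → A → ι (does a?) ≡ 1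
ι-true (yes _)  a = refl
ι-true (no ¬a)  a = ⊥-elim (¬a a)

ι-false : ∀ {p} {A : Set p} (a? : Dec A) → ¬ A → ι (does a?) ≡ 0
ι-false (yes a) ¬a = ⊥-elim (¬a a)
ι-false (no _)  ¬a = refl

ι-mono : ∀ {p q} {A : Set p} {B : Set q} (a? : Dec A) (b? : Dec B) → (A → B) → ι (does a?) ≤ ι (does b?)
ι-mono (yes a) b? f = ≤-reflexive (sym (ι-true b? (f a)))
ι-mono (no _)  b? f = z≤n

∑-single : ∀ n (x : ℕ → ℕ) {j} → j < n → ∑ n (λ i → ι (i ≡ᵇ j) * x i) ≡ x j
∑-single (suc n) x {j} j<1+n with j ≟ n
... | yes refl = trans (cong₂ _+_ (trans (∑-cong n λ i i<n → cong (λ z → ι z * x i) (dec-false (i ≟ n) (<⇒≢ i<n))) (∑-0 n))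
                                  (cong (λ z → ι z * x n) (dec-true (n ≟ n) refl))) (+-identityʳ (x n))
... | no  j≢n  = trans (cong₂ _+_ (∑-single n x (≤∧≢⇒< (s≤s⁻¹ j<1+n) j≢n))
                                  (cong (λ z → ι z * x n) (dec-false (n ≟ j) (j≢n ∘ sym)))) (+-identityʳ _)

∑-prefix : ∀ {k n} (f : ℕ → ℕ) → k ≤ n → ∑ k f ≡ ∑ n (λ i → ι (i <ᵇ k) * f i)
∑-prefix {k} {zero}  f z≤n = refl
∑-prefix {k} {suc n} f k≤1+n with k ≟ suc n
... | yes refl = ∑-cong (suc n) λ i i<k →
        sym (trans (cong (λ z → ι z * f i) (dec-true (i <? suc n) i<k)) (+-identityʳ (f i)))
... | no  k≢ = trans (∑-prefix f k≤n) (sym (trans (cong (λ z → ∑ n (λ i → ι (i <ᵇ k) * f i) + z)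
        (cong (λ z → ι z * f n) (dec-false (n <? k) (≤⇒≯ k≤n)))) (+-identityʳ _)))
  where k≤n = s≤s⁻¹ (≤∧≢⇒< k≤1+n k≢)

Σℕ-toℕ : ∀ n (f : ℕ → ℕ) → Σℕ {n} (f ∘ toℕ) ≡ ∑ n f
Σℕ-toℕ zero    f = refl
Σℕ-toℕ (suc n) f = trans (cong (λ z → f 0 + z) (Σℕ-toℕ n (f ∘ suc))) (sym (∑-∘suc n f))

-- Jobs become natural numbers, so that prefixes and recursions need no `Fin` arithmetic; the
-- default only fills up the values from n on.
ext : ∀ {n} {A : Set} → A → (Fin n → A) → ℕ → A
ext {zero}  a f i       = a
ext {suc n} a f zero    = f zero
ext {suc n} a f (suc i) = ext a (f ∘ suc) i

ext-toℕ : ∀ {n} {A : Set} (a : A) (f : Fin n → A) i → ext a f (toℕ i) ≡ f i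
ext-toℕ a f zero    = refl
ext-toℕ a f (suc i) = ext-toℕ a (f ∘ suc) i

∀-toℕ : ∀ {n} (Q : ℕ → Set) → (∀ (i : Fin n) → Q (toℕ i)) → ∀ i → i < n → Q i
∀-toℕ Q q i i<n = subst Q (Fin.toℕ-fromℕ< i<n) (q (fromℕ< i<n))

-- If k were missed, `punchOut` at k would make f an injection into a set with one element less.
injective⇒surjective : ∀ {n} (f : Fin n → Fin n) → Injective _≡_ _≡_ f → ∀ k → ∃ λ i → f i ≡ k
injective⇒surjective {suc n} f inj k with Fin.any? (λ i → f i Fin.≟ k)
... | yes hit = hit
... | no miss = ⊥-elim (1+n≰n (Fin.injective⇒≤ {f = λ i → punchOut {i = k} (avoid i)}
        λ {i} {j} eq → inj (Fin.punchOut-injective (avoid i) (avoid j) eq)))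
  where
  avoid : ∀ i → k ≢ f i
  avoid i k≡fi = miss (i , sym k≡fi)

-- f becomes the direction from jobs to positions, because a rank is the position of a job.
injective⇒permutation : ∀ {n} (f : Fin n → Fin n) → Injective _≡_ _≡_ f →
                        Σ[ π ∈ Permutation′ n ] (∀ i → π ⟨$⟩ˡ i ≡ f i)
injective⇒permutation f inj = permutation (proj₁ ∘ sur) f (λ i → inj (proj₂ (sur (f i)))) (λ k → proj₂ (sur k)) , λ _ → refl
  where sur = injective⇒surjective f inj

split : ∀ b → b ≡ true ⊎ b ≡ false
split true  = inj₁ refl
split false = inj₂ refl

-- One search for a maximal element serves for the first and the last r-job and, in `load≤`, for the
-- last job of a prefix.
extremal : (_⊑_ : ℕ → ℕ → Set) → (∀ i j → i ⊑ j ⊎ j ⊑ i) → (∀ {i j k} → i ⊑ j → j ⊑ k → i ⊑ k) →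
           ∀ (U : ℕ → Bool) n → (∀ i → i < n → U i ≡ false) ⊎
           (∃ λ j → j < n × U j ≡ true × (∀ i → i < n → U i ≡ true → i ⊑ j))
extremal _⊑_ total ⊑-trans U = go
  where
  ⊑-refl : ∀ i → i ⊑ i
  ⊑-refl i with total i i
  ... | inj₁ le = le
  ... | inj₂ le = le

  extend : ∀ {n} {Q : ℕ → Set} → (∀ i → i < n → Q i) → Q n → ∀ i → i < suc n → Q i
  extend {n} q qn i i<1+n with i ≟ n
  ... | yes refl = qn
  ... | no  i≢n  = q i (≤∧≢⇒< (s≤s⁻¹ i<1+n) i≢n)

  go : ∀ n → (∀ i → i < n → U i ≡ false) ⊎
       (∃ λ j → j < n × U j ≡ true × (∀ i → i < n → U i ≡ true → i ⊑ j))
  go zero = inj₁ λ _ ()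
  go (suc n) with go n | split (U n)
  ... | inj₁ none | inj₂ Un = inj₁ (extend none Un)
  ... | inj₁ none | inj₁ Un = inj₂ (n , ≤-refl , Un ,
          extend (λ i i<n Ui → contradiction (trans (sym Ui) (none i i<n)) λ ()) λ _ → ⊑-refl n)
  ... | inj₂ (j , j<n , Uj , max) | inj₂ Un = inj₂ (j , m<n⇒m<1+n j<n , Uj ,
          extend max λ Un′ → contradiction (trans (sym Un′) Un) λ ())
  ... | inj₂ (j , j<n , Uj , max) | inj₁ Un with total j n
  ...   | inj₁ j⊑n = inj₂ (n , ≤-refl , Un , extend (λ i i<n Ui → ⊑-trans (max i i<n Ui) j⊑n) λ _ → ⊑-refl n)
  ...   | inj₂ n⊑j = inj₂ (j , m<n⇒m<1+n j<n , Uj , extend max λ _ → n⊑j)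

-- Schedules of jobs numbered in due date order

-- Reduces an inequality between linear expressions to a ring identity: the slack of a known
-- inequality equals the slack of the wanted one, which `solve-∀` can check.
≤-diff : ∀ {x y a b : ℤ} → x ℤ.≤ y → y ℤ.- x ≡ b ℤ.- a → a ℤ.≤ b
≤-diff x≤y eq = ℤ.0≤i-j⇒j≤i (subst (0ℤ ℤ.≤_) eq (ℤ.i≤j⇒0≤j-i x≤y))

true≢false : true ≢ false
true≢false ()

module Renting (n : ℕ) (p : ℕ → ℕ) (d : ℕ → ℤ) (r : ℕ → Bool) (dmin : ℤ) (β : ℕ) where

  -- Sets of jobs are given by indicator functions with values in ℕ. Unions with multiplicity are
  -- then sums, and an inequality between loads follows from one inequality per job.
  load : (ℕ → ℕ) → ℕ → ℕ
  load c k = ∑ k λ j → c j * p j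

  load-skip : ∀ (c : ℕ → ℕ) {k} → c k ≡ 0 → load c (suc k) ≡ load c k
  load-skip c {k} eq = trans (cong (λ z → load c k + z * p k) eq) (+-identityʳ _)

  load-take : ∀ (c : ℕ → ℕ) {k} → c k ≡ 1 → load c (suc k) ≡ load c k + p k
  load-take c {k} eq = cong (λ z → load c k + z) (trans (cong (_* p k) eq) (*-identityˡ (p k)))

  load-mono : ∀ {c c′ : ℕ → ℕ} k → (∀ j → j < k → c j ≤ c′ j) → load c k ≤ load c′ k
  load-mono k le = ∑-mono-≤ k λ j j<k → *-monoˡ-≤ (p j) (le j j<k)

  load-+ : ∀ (c c′ : ℕ → ℕ) k → load (λ j → c j + c′ j) k ≡ load c k + load c′ k
  load-+ c c′ k = trans (∑-cong k λ j _ → *-distribʳ-+ (p j) (c j) (c′ j)) (∑-+ k _ _)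

  load-prefix : ∀ (c : ℕ → ℕ) {k} → k ≤ n → load c k ≡ load (λ j → ι (j <ᵇ k) * c j) n
  load-prefix c {k} k≤n = trans (∑-prefix _ k≤n) (∑-cong n λ j _ → sym (*-assoc (ι (j <ᵇ k)) (c j) (p j)))

  load-single : ∀ {j} → j < n → load (λ i → ι (i ≡ᵇ j)) n ≡ p j
  load-single = ∑-single n p

  P : ℕ
  P = load (λ _ → 1) n

  R N : ℕ → ℕ
  R = load (ι ∘ r)
  N = load (ι ∘ not ∘ r)

  -- Subtracting P compensates the term `N k` of `cut k`: an empty maximum contributes at most -
  -- dmin, a lower bound on every maximum lateness.
  floor : ℤ
  floor = 0ℤ ℤ.- dmin ℤ.- + P

  -- Lateness of i in the period, with time counted from the start of the period, if the fillers up
  -- to i have load b.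
  late : ℕ → ℕ → ℤ
  late i b = + R (suc i) ℤ.- d i ℤ.+ + b

  step : Bool → Bool → ℤ → ℤ → ℤ → ℤ
  step true  _     g _  l = g ℤ.⊔ l
  step false true  g g′ l = g ℤ.⊓ (g′ ℤ.⊔ l)
  step false false g _  _ = g

  -- G i b is the least value, over all choices of fillers below i, of the maximum
  -- of late j bⱼ over the r-jobs and fillers j < i.  Here bⱼ is the load of the
  -- fillers up to j, shifted by a constant so that it ends at b; the floor stands
  -- for the empty maximum and is low enough never to matter.
  G : ℕ → ℕ → ℤ
  G zero    b = floor
  G (suc i) b = step (r i) (p i ≤ᵇ b) (G i b) (G i (b ∸ p i)) (late i b)

  G-rental : ∀ i b → r i ≡ true → G (suc i) b ≡ G i b ℤ.⊔ late i b
  G-rental i b eq rewrite eq = refl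

  G-fits : ∀ i b → r i ≡ false → p i ≤ b → G (suc i) b ≡ G i b ℤ.⊓ (G i (b ∸ p i) ℤ.⊔ late i b)
  G-fits i b eq le rewrite eq | dec-true (p i ≤? b) le = refl

  G-tight : ∀ i b → r i ≡ false → ¬ p i ≤ b → G (suc i) b ≡ G i b
  G-tight i b eq ≰ rewrite eq | dec-false (p i ≤? b) ≰ = refl

  G-skip : ∀ i b → r i ≡ false → G (suc i) b ℤ.≤ G i b
  G-skip i b eq with p i ≤? b
  ... | yes le = subst (ℤ._≤ G i b) (sym (G-fits i b eq le)) (ℤ.i⊓j≤i _ _)
  ... | no  ≰  = ℤ.≤-reflexive (G-tight i b eq ≰)

  module _ (α : ℕ → Bool) where

    inside : ℕ → ℕ
    inside = load λ j → ι (not (r j) ∧ not (α j))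

    -- The non-r-jobs outside α are the fillers. Following this choice through the recursion
    -- exhibits one candidate of the minimum; b₀ is its shift.
    G-lower : ∀ b₀ {θ} → floor ℤ.≤ θ → ∀ k →
              (∀ i → i < k → r i ∨ not (α i) ≡ true → late i (b₀ + inside (suc i)) ℤ.≤ θ) →
              G k (b₀ + inside k) ℤ.≤ θ
    G-lower b₀ floor≤θ zero    lates = floor≤θ
    G-lower b₀ {θ} floor≤θ (suc k) lates with split (r k) | split (α k)
    ... | inj₁ rk | _ = subst (λ z → G (suc k) (b₀ + z) ℤ.≤ θ) (sym same)
            (subst (ℤ._≤ θ) (sym (G-rental k _ rk)) (ℤ.⊔-lub ih
              (subst (λ z → late k (b₀ + z) ℤ.≤ θ) same (lates k ≤-refl (cong (_∨ not (α k)) rk)))))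
      where
      ih   = G-lower b₀ floor≤θ k λ i i<k → lates i (m<n⇒m<1+n i<k)
      same = load-skip (λ j → ι (not (r j) ∧ not (α j))) {k} (cong (λ z → ι (not z ∧ not (α k))) rk)
    ... | inj₂ rk | inj₁ αk = subst (λ z → G (suc k) (b₀ + z) ℤ.≤ θ) (sym same) (ℤ.≤-trans (G-skip k _ rk) ih)
      where
      ih   = G-lower b₀ floor≤θ k λ i i<k → lates i (m<n⇒m<1+n i<k)
      same = load-skip (λ j → ι (not (r j) ∧ not (α j))) {k} (cong₂ (λ y z → ι (not y ∧ not z)) rk αk)
    ... | inj₂ rk | inj₂ αk = subst (λ z → G (suc k) z ℤ.≤ θ) (sym more)
            (subst (ℤ._≤ θ) (sym (G-fits k _ rk (m≤n+m _ _))) (ℤ.i≤j⇒k⊓i≤j _ (ℤ.⊔-lub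
              (subst (λ z → G k z ℤ.≤ θ) (sym (m+n∸n≡m _ (p k))) ih)
              (subst (λ z → late k z ℤ.≤ θ) more
                (lates k ≤-refl (cong₂ (λ y z → y ∨ not z) rk αk))))))
      where
      ih   = G-lower b₀ floor≤θ k λ i i<k → lates i (m<n⇒m<1+n i<k)
      more = trans (cong (λ z → b₀ + z) (load-take (λ j → ι (not (r j) ∧ not (α j))) {k}
               (cong₂ (λ y z → ι (not y ∧ not z)) rk αk))) (sym (+-assoc b₀ _ _))

  -- Class 0 precedes the rental period, class 1 falls into it, class 2 follows it.
  -- In Plan k θ κ i b the number b is the filler budget left for the jobs below i.
  data Plan (k : ℕ) (θ : ℤ) (κ : ℕ → ℕ) : ℕ → ℕ → Set where
    done   : ∀ {b} → Plan k θ κ 0 b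
    rental : ∀ {i b} → r i ≡ true → κ i ≡ 1 → (i < k → late i b ℤ.≤ θ) →
             Plan k θ κ i b → Plan k θ κ (suc i) b
    after  : ∀ {i b} → r i ≡ false → k ≤ i → κ i ≡ 2 →
             Plan k θ κ i b → Plan k θ κ (suc i) b
    before : ∀ {i b} → r i ≡ false → i < k → κ i ≡ 0 →
             Plan k θ κ i b → Plan k θ κ (suc i) b
    within : ∀ {i b} → r i ≡ false → i < k → κ i ≡ 1 → late i b ℤ.≤ θ → p i ≤ b →
             Plan k θ κ i (b ∸ p i) → Plan k θ κ (suc i) b

  -- What is left of a plan at a single job when budgets and lateness bounds are forgotten.
  data Kind (k : ℕ) (κ : ℕ → ℕ) (i : ℕ) : Set where
    rental : r i ≡ true  → κ i ≡ 1 → Kind k κ i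
    after  : r i ≡ false → k ≤ i → κ i ≡ 2 → Kind k κ i
    before : r i ≡ false → i < k → κ i ≡ 0 → Kind k κ i
    within : r i ≡ false → i < k → κ i ≡ 1 → Kind k κ i

  kind : ∀ {k θ κ m b} → Plan k θ κ m b → ∀ i → i < m → Kind k κ i
  kind {m = suc m} plan i i<1+m with i ≟ m
  kind (rental x y _ _)     i i<1+m | yes refl = rental x y
  kind (after x y z _)      i i<1+m | yes refl = after x y z
  kind (before x y z _)     i i<1+m | yes refl = before x y z
  kind (within x y z _ _ _) i i<1+m | yes refl = within x y z
  kind (rental _ _ _ plan)     i i<1+m | no i≢m = kind plan i (≤∧≢⇒< (s≤s⁻¹ i<1+m) i≢m)
  kind (after _ _ _ plan)      i i<1+m | no i≢m = kind plan i (≤∧≢⇒< (s≤s⁻¹ i<1+m) i≢m)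
  kind (before _ _ _ plan)     i i<1+m | no i≢m = kind plan i (≤∧≢⇒< (s≤s⁻¹ i<1+m) i≢m)
  kind (within _ _ _ _ _ plan) i i<1+m | no i≢m = kind plan i (≤∧≢⇒< (s≤s⁻¹ i<1+m) i≢m)

  module _ (k : ℕ) (θ : ℤ) (κ : ℕ → ℕ) where

    fillerCount : ℕ → ℕ
    fillerCount j = ι (not (r j) ∧ (κ j ≡ᵇ 1))

    filler : ℕ → ℕ
    filler = load fillerCount

    -- Only a `within` step changes the filler load. The other three steps look alike once all that
    -- is kept of them is the lateness bound for a job of class 1 below k.
    filler-suc : ∀ {m b} → Plan k θ κ (suc m) b →
      (filler (suc m) ≡ filler m × Plan k θ κ m b × (κ m ≡ 1 → m < k → late m b ℤ.≤ θ)) ⊎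
      (filler (suc m) ≡ filler m + p m × p m ≤ b × Plan k θ κ m (b ∸ p m) × late m b ℤ.≤ θ)
    filler-suc {m} (rental x y l plan) = inj₁
      (load-skip fillerCount (cong (λ z → ι (not z ∧ (κ m ≡ᵇ 1))) x) , plan , λ _ → l)
    filler-suc {m} (after x y z plan) = inj₁
      (load-skip fillerCount (cong₂ (λ u v → ι (not u ∧ (v ≡ᵇ 1))) x z) , plan , λ _ m<k → ⊥-elim (≤⇒≯ y m<k))
    filler-suc {m} (before x y z plan) = inj₁
      (load-skip fillerCount (cong₂ (λ u v → ι (not u ∧ (v ≡ᵇ 1))) x z) , plan , λ κ≡1 → contradiction (trans (sym z) κ≡1) λ ())
    filler-suc {m} (within x y z l le plan) = inj₂
      (load-take fillerCount (cong₂ (λ u v → ι (not u ∧ (v ≡ᵇ 1))) x z) , le , plan , l)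

    filler-≤ : ∀ m {b} → Plan k θ κ m b → filler m ≤ b
    filler-≤ zero    plan = z≤n
    filler-≤ (suc m) {b} plan with filler-suc plan
    ... | inj₁ (eq , plan′ , _)      = subst (_≤ b) (sym eq) (filler-≤ m plan′)
    ... | inj₂ (eq , le , plan′ , _) = subst (_≤ b) (sym eq) (≤-trans (+-monoˡ-≤ (p m) (filler-≤ m plan′))
                                                                      (≤-reflexive (m∸n+n≡m le)))

    -- At i the remaining budget is b minus the load of the fillers above i and below m, that is b +
    -- `filler (suc i)` - `filler m`. Since `late` is affine in the budget, the last term can be
    -- moved to the right, which avoids truncated subtraction.
    filler-late : ∀ m {b} → Plan k θ κ m b → ∀ i → i < m → i < k → κ i ≡ 1 →
                  late i (b + filler (suc i)) ℤ.≤ θ ℤ.+ + filler m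
    filler-late (suc m) {b} plan i i<1+m i<k κi with i ≟ m | filler-suc plan
    ... | yes refl | inj₁ (_ , _ , l)     = add-filler (filler (suc i)) (l κi i<k)
      where
      rearrange : ∀ x b f θ → θ ℤ.- (x ℤ.+ b) ≡ (θ ℤ.+ f) ℤ.- (x ℤ.+ (b ℤ.+ f))
      rearrange = solve-∀
      add-filler : ∀ f → late i b ℤ.≤ θ → late i (b + f) ℤ.≤ θ ℤ.+ + f
      add-filler f h = ≤-diff h (rearrange (+ R (suc i) ℤ.- d i) (+ b) (+ f) θ)
    ... | yes refl | inj₂ (_ , _ , _ , l) = ≤-diff l (rearrange (+ R (suc i) ℤ.- d i) (+ b) (+ filler (suc i)) θ)
      where
      rearrange : ∀ x b f θ → θ ℤ.- (x ℤ.+ b) ≡ (θ ℤ.+ f) ℤ.- (x ℤ.+ (b ℤ.+ f))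
      rearrange = solve-∀
    ... | no i≢m | inj₁ (eq , plan′ , _)      = subst (λ z → late i (b + filler (suc i)) ℤ.≤ θ ℤ.+ + z) (sym eq)
            (filler-late m plan′ i (≤∧≢⇒< (s≤s⁻¹ i<1+m) i≢m) i<k κi)
    ... | no i≢m | inj₂ (eq , le , plan′ , _) = subst (λ z → late i (b + filler (suc i)) ℤ.≤ θ ℤ.+ + z) (sym eq)
            (≤-diff (filler-late m plan′ i (≤∧≢⇒< (s≤s⁻¹ i<1+m) i≢m) i<k κi)
              (trans (cong (λ z → θ ℤ.+ + filler m ℤ.- (x ℤ.+ (z ℤ.+ + filler (suc i)))) b∸p)
                     (rearrange x (+ b) (+ p m) (+ filler (suc i)) θ (+ filler m))))
      where
      x = + R (suc i) ℤ.- d i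
      b∸p : + (b ∸ p m) ≡ + b ℤ.- + p m
      b∸p = trans (sym (ℤ.⊖-≥ le)) (sym (ℤ.m-n≡m⊖n b (p m)))
      rearrange : ∀ x b p f θ g → θ ℤ.+ g ℤ.- (x ℤ.+ (b ℤ.- p ℤ.+ f)) ≡ (θ ℤ.+ (g ℤ.+ p)) ℤ.- (x ℤ.+ (b ℤ.+ f))
      rearrange = solve-∀

  -- For the cut k, a job i ≥ k outside Jʳ has lateness tail i, and the lateness
  -- of the jobs in the rental period is at most cut k, where N k − β turns the
  -- shifted filler load into the load of the first part.
  tail : ℕ → ℤ
  tail i = + (R n + N (suc i)) ℤ.- d i

  cut : ℕ → ℤ
  cut k = G k β ℤ.+ + N k ℤ.- + β

  C : (ℕ → ℕ) → ℕ → ℕ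
  C pos i = load (λ j → ι (pos j ≤ᵇ pos i)) n

  suc-n*1 : ∀ b → ι b * 1 ≡ ι b
  suc-n*1 true  = refl
  suc-n*1 false = refl

  -- Lateness and rental period of the planned sequence

  module Upper (k : ℕ) (k≤n : k ≤ n) (θ : ℤ) (κ : ℕ → ℕ) (plan : Plan k θ κ n β) (pos : ℕ → ℕ)
    (ordered : ∀ i j → i < n → j < n → pos i ≤ pos j → κ i < κ j ⊎ (κ i ≡ κ j × i ≤ j))
    where

    private
      F  = fillerCount k θ κ
      ⟨_≼_⟩ : ℕ → ℕ → ℕ
      ⟨ j ≼ i ⟩ = ι (pos j ≤ᵇ pos i)
      ⟨_<_⟩ : ℕ → ℕ → ℕ
      ⟨ j < i ⟩ = ι (j <ᵇ i)

      ordered-κ : ∀ {x y} i j → i < n → j < n → κ i ≡ x → κ j ≡ y → pos i ≤ pos j → x < y ⊎ (x ≡ y × i ≤ j)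
      ordered-κ i j i<n j<n refl refl = ordered i j i<n j<n

    module Late (Λ : ℤ) (cut≤Λ : θ ℤ.+ + N k ℤ.- + β ℤ.≤ Λ)
      (tail≤Λ : ∀ i → k ≤ i → i < n → r i ≡ false → tail i ℤ.≤ Λ)
      (edd≤Λ : ∀ i → i < n → + load (λ _ → 1) (suc i) ℤ.≤ Λ ℤ.+ d i) where

      private
        -- All jobs up to the position of i have indices at most i, so i completes no later than in
        -- the due date order.
        via-edd : ∀ i → i < n → (∀ j → j < n → pos j ≤ pos i → j ≤ i) → + C pos i ℤ.≤ Λ ℤ.+ d i
        via-edd i i<n earlier = ℤ.≤-trans
          (+≤+ (subst (C pos i ≤_) (sym (load-prefix (λ _ → 1) i<n))
            (load-mono n λ j j<n → subst (⟨ j ≼ i ⟩ ≤_) (sym (suc-n*1 (j <ᵇ suc i)))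
              (ι-mono (pos j ≤? pos i) (j <? suc i) λ le → s≤s (earlier j j<n le)))))
          (edd≤Λ i i<n)

        -- Adding the load of all fillers to the completion time merges the first part and the
        -- fillers into the non-r-jobs below k, of load `N k`. What else runs up to i are the r-jobs
        -- and fillers of index at most i.
        via-cut : ∀ i → i < n → i < k → κ i ≡ 1 → + C pos i ℤ.≤ Λ ℤ.+ d i
        via-cut i i<n i<k κi = ≤-diff
          (ℤ.+-mono-≤ (ℤ.+-mono-≤ (filler-late k θ κ n plan i i<n i<k κi) cut≤Λ) (+≤+ loads))
          (rearrange (+ R (suc i)) (d i) (+ β) (+ filler k θ κ (suc i)) θ (+ filler k θ κ n) (+ N k) Λ (+ C pos i))
          where
          rearrange : ∀ R d β f θ F N Λ C → (θ ℤ.+ F ℤ.+ Λ ℤ.+ (R ℤ.+ f ℤ.+ N)) ℤ.-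
            (R ℤ.- d ℤ.+ (β ℤ.+ f) ℤ.+ (θ ℤ.+ N ℤ.- β) ℤ.+ (C ℤ.+ F)) ≡ Λ ℤ.+ d ℤ.- C
          rearrange = solve-∀
          count : ∀ j → j < n → ⟨ j ≼ i ⟩ + F j ≤ ⟨ j < suc i ⟩ * ι (r j) + ⟨ j < suc i ⟩ * F j + ⟨ j < k ⟩ * ι (not (r j))
          count j j<n with kind plan j j<n
          ... | rental x y rewrite x = ≤-trans (≤-reflexive (+-identityʳ _)) (≤-trans
                  (ι-mono (pos j ≤? pos i) (j <? suc i) earlier)
                  (≤-trans (≤-reflexive (sym (suc-n*1 _))) (≤-trans (m≤m+n _ _) (m≤m+n _ _))))
                where
                earlier : pos j ≤ pos i → j < suc i
                earlier le with ordered-κ j i j<n i<n y κi le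
                ... | inj₁ (s≤s ())
                ... | inj₂ (_ , j≤i) = s≤s j≤i
          ... | after x y z rewrite x | z = ≤-trans (≤-reflexive (trans (+-identityʳ _)
                  (ι-false (pos j ≤? pos i) never))) z≤n
                where
                never : ¬ pos j ≤ pos i
                never le with ordered-κ j i j<n i<n z κi le
                ... | inj₁ (s≤s ())
                ... | inj₂ (() , _)
          ... | before x y z rewrite x | z | dec-true (j <? k) y = ≤-trans (≤-reflexive (+-identityʳ _))
                  (≤-trans (ι≤1 _) (m≤n+m _ _))
          ... | within x y z rewrite x | z | dec-true (j <? k) y = +-monoˡ-≤ 1 (≤-trans
                  (ι-mono (pos j ≤? pos i) (j <? suc i) earlier)
                  (≤-trans (≤-reflexive (sym (suc-n*1 _))) (m≤n+m _ _)))
                where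
                earlier : pos j ≤ pos i → j < suc i
                earlier le with ordered-κ j i j<n i<n z κi le
                ... | inj₁ (s≤s ())
                ... | inj₂ (_ , j≤i) = s≤s j≤i
          loads : C pos i + filler k θ κ n ≤ R (suc i) + filler k θ κ (suc i) + N k
          loads = begin
            C pos i + filler k θ κ n ≡⟨ load-+ (λ j → ⟨ j ≼ i ⟩) F n ⟨
            load (λ j → ⟨ j ≼ i ⟩ + F j) n ≤⟨ load-mono n count ⟩
            load (λ j → ⟨ j < suc i ⟩ * ι (r j) + ⟨ j < suc i ⟩ * F j + ⟨ j < k ⟩ * ι (not (r j))) n
              ≡⟨ load-+ (λ j → ⟨ j < suc i ⟩ * ι (r j) + ⟨ j < suc i ⟩ * F j) (λ j → ⟨ j < k ⟩ * ι (not (r j))) n ⟩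
            load (λ j → ⟨ j < suc i ⟩ * ι (r j) + ⟨ j < suc i ⟩ * F j) n + load (λ j → ⟨ j < k ⟩ * ι (not (r j))) n
              ≡⟨ cong (λ z → z + load (λ j → ⟨ j < k ⟩ * ι (not (r j))) n) (load-+ (λ j → ⟨ j < suc i ⟩ * ι (r j)) (λ j → ⟨ j < suc i ⟩ * F j) n) ⟩
            load (λ j → ⟨ j < suc i ⟩ * ι (r j)) n + load (λ j → ⟨ j < suc i ⟩ * F j) n + load (λ j → ⟨ j < k ⟩ * ι (not (r j))) n
              ≡⟨ cong₂ _+_ (cong₂ _+_ (load-prefix (ι ∘ r) i<n) (load-prefix F i<n)) (load-prefix (ι ∘ not ∘ r) k≤n) ⟨
            R (suc i) + filler k θ κ (suc i) + N k ∎
            where open ≤-Reasoning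

        -- Besides r-jobs, only non-r-jobs of index at most i run up to i: the first part and the
        -- fillers lie below k ≤ i.
        via-tail : ∀ i → i < n → k ≤ i → r i ≡ false → κ i ≡ 2 → + C pos i ℤ.≤ Λ ℤ.+ d i
        via-tail i i<n k≤i ri κi = ℤ.≤-trans (+≤+ loads)
          (≤-diff (tail≤Λ i k≤i i<n ri) (rearrange (+ (R n + N (suc i))) (d i) Λ))
          where
          rearrange : ∀ x d Λ → Λ ℤ.- (x ℤ.- d) ≡ Λ ℤ.+ d ℤ.- x
          rearrange = solve-∀
          count : ∀ j → j < n → ⟨ j ≼ i ⟩ ≤ ι (r j) + ⟨ j < suc i ⟩ * ι (not (r j))
          count j j<n with kind plan j j<n
          ... | rental x y rewrite x = ≤-trans (ι≤1 _) (m≤m+n 1 _)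
          ... | before x y z rewrite x | dec-true (j <? suc i) (m<n⇒m<1+n (<-≤-trans y k≤i)) = ι≤1 _
          ... | within x y z rewrite x | dec-true (j <? suc i) (m<n⇒m<1+n (<-≤-trans y k≤i)) = ι≤1 _
          ... | after x y z rewrite x = ≤-trans (ι-mono (pos j ≤? pos i) (j <? suc i) earlier)
                  (≤-reflexive (sym (suc-n*1 _)))
                where
                earlier : pos j ≤ pos i → j < suc i
                earlier le with ordered-κ j i j<n i<n z κi le
                ... | inj₁ (s≤s (s≤s ()))
                ... | inj₂ (_ , j≤i) = s≤s j≤i
          loads : C pos i ≤ R n + N (suc i)
          loads = begin
            C pos i ≤⟨ load-mono n count ⟩
            load (λ j → ι (r j) + ⟨ j < suc i ⟩ * ι (not (r j))) n
              ≡⟨ load-+ (ι ∘ r) (λ j → ⟨ j < suc i ⟩ * ι (not (r j))) n ⟩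
            R n + load (λ j → ⟨ j < suc i ⟩ * ι (not (r j))) n
              ≡⟨ cong (λ z → R n + z) (load-prefix (ι ∘ not ∘ r) i<n) ⟨
            R n + N (suc i) ∎
            where open ≤-Reasoning

      onTime : ∀ i → i < n → + C pos i ℤ.≤ Λ ℤ.+ d i
      onTime i i<n with kind plan i i<n
      ... | after x y z = via-tail i i<n y x z
      ... | within x y z = via-cut i i<n y z
      ... | before x y z = via-edd i i<n λ j j<n le → earlier j (ordered-κ j i j<n i<n refl z le)
        where
        earlier : ∀ j → κ j < 0 ⊎ (κ j ≡ 0 × j ≤ i) → j ≤ i
        earlier j (inj₂ (_ , j≤i)) = j≤i
      ... | rental x y with i <? k
      ... | yes i<k = via-cut i i<n i<k y
      ... | no  i≮k = via-edd i i<n earlier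
        where
        k≤i = ≮⇒≥ i≮k
        earlier : ∀ j → j < n → pos j ≤ pos i → j ≤ i
        earlier j j<n le with kind plan j j<n
        ... | before _ j<k _ = <⇒≤ (<-≤-trans j<k k≤i)
        ... | within _ j<k _ = <⇒≤ (<-≤-trans j<k k≤i)
        ... | rental _ z with ordered-κ j i j<n i<n z y le
        ...   | inj₁ (s≤s ())
        ...   | inj₂ (_ , j≤i) = j≤i
        earlier j j<n le | after _ _ z with ordered-κ j i j<n i<n z y le
        ...   | inj₁ (s≤s ())
        ...   | inj₂ (() , _)

    -- Stated for all pairs of r-jobs, so that neither end of the period has to be identified. Job
    -- by job, a member of the first part counts at most once on the left and once on the right, a
    -- job of class 2 does not count on the left, and j counts at most twice on the left and twice
    -- on the right.
    period : ∀ i j → i < n → j < n → r i ≡ true → r j ≡ true → C pos i + p j ≤ R n + β + C pos j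
    period i j i<n j<n ri rj = begin
      C pos i + p j ≡⟨ cong (λ z → C pos i + z) (load-single j<n) ⟨
      C pos i + load (λ q → ι (q ≡ᵇ j)) n ≡⟨ load-+ (λ q → ⟨ q ≼ i ⟩) (λ q → ι (q ≡ᵇ j)) n ⟨
      load (λ q → ⟨ q ≼ i ⟩ + ι (q ≡ᵇ j)) n ≤⟨ load-mono n count ⟩
      load (λ q → ι (r q) + F q + ⟨ q ≼ j ⟩) n ≡⟨ load-+ (λ q → ι (r q) + F q) (λ q → ⟨ q ≼ j ⟩) n ⟩
      load (λ q → ι (r q) + F q) n + C pos j ≡⟨ cong (λ z → z + C pos j) (load-+ (ι ∘ r) F n) ⟩
      R n + filler k θ κ n + C pos j ≤⟨ +-monoˡ-≤ (C pos j) (+-monoʳ-≤ (R n) (filler-≤ k θ κ n plan)) ⟩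
      R n + β + C pos j ∎
      where
      open ≤-Reasoning
      κ-rental : ∀ q → q < n → r q ≡ true → κ q ≡ 1
      κ-rental q q<n rq with kind plan q q<n
      ... | rental _ z   = z
      ... | after x _ _  = ⊥-elim (true≢false (trans (sym rq) x))
      ... | before x _ _ = ⊥-elim (true≢false (trans (sym rq) x))
      ... | within x _ _ = ⊥-elim (true≢false (trans (sym rq) x))
      κi = κ-rental i i<n ri
      κj = κ-rental j j<n rj
      own : ∀ q → ⟨ q ≼ i ⟩ + ι (q ≡ᵇ j) ≤ 1 + ⟨ q ≼ j ⟩
      own q = +-mono-≤ (ι≤1 _) (ι-mono (q ≟ j) (pos q ≤? pos j) λ q≡j → ≤-reflexive (cong pos q≡j))
      count : ∀ q → q < n → ⟨ q ≼ i ⟩ + ι (q ≡ᵇ j) ≤ ι (r q) + F q + ⟨ q ≼ j ⟩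
      count q q<n with kind plan q q<n
      ... | rental x y rewrite x = own q
      ... | within x y z rewrite x | z = own q
      ... | before x y z rewrite x | z | ι-false (q ≟ j) (λ { refl → contradiction (trans (sym z) κj) λ () }) =
              ≤-trans (≤-reflexive (+-identityʳ _)) (≤-trans (ι≤1 _) (≤-reflexive (sym (ι-true (pos q ≤? pos j) first))))
        where
        first : pos q ≤ pos j
        first with ≤-total (pos q) (pos j)
        ... | inj₁ le = le
        ... | inj₂ ge with ordered-κ j q j<n q<n κj z ge
        ...   | inj₁ ()
        ...   | inj₂ (() , _)
      ... | after x y z rewrite x | z | ι-false (q ≟ j) (λ { refl → contradiction (trans (sym z) κj) λ () }) =
              ≤-trans (≤-reflexive (trans (+-identityʳ _) (ι-false (pos q ≤? pos i) never))) z≤n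
        where
        never : ¬ pos q ≤ pos i
        never le with ordered-κ q i q<n i<n z κi le
        ... | inj₁ (s≤s ())
        ... | inj₂ (() , _)

  -- Bounds extracted from an arbitrary sequence

  module Lower (pos : ℕ → ℕ) (pos-injective : ∀ i j → i < n → j < n → pos i ≡ pos j → i ≡ j) where

    private
      ⟨_≼_⟩ : ℕ → ℕ → ℕ
      ⟨ j ≼ i ⟩ = ι (pos j ≤ᵇ pos i)

    -- A job of X that runs up to the position of f can only be f itself, and the term `p f` pays
    -- for this double count.
    window : ∀ (X : ℕ → Bool) {f l} → f < n → pos f ≤ pos l →
             (∀ j → j < n → X j ≡ true → pos f ≤ pos j × pos j ≤ pos l) →
             load (ι ∘ X) n + C pos f ≤ C pos l + p f
    window X {f} {l} f<n f≤l X⊆ = begin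
      load (ι ∘ X) n + C pos f ≡⟨ load-+ (ι ∘ X) (λ j → ⟨ j ≼ f ⟩) n ⟨
      load (λ j → ι (X j) + ⟨ j ≼ f ⟩) n ≤⟨ load-mono n count ⟩
      load (λ j → ⟨ j ≼ l ⟩ + ι (j ≡ᵇ f)) n ≡⟨ load-+ (λ j → ⟨ j ≼ l ⟩) (λ j → ι (j ≡ᵇ f)) n ⟩
      C pos l + load (λ j → ι (j ≡ᵇ f)) n ≡⟨ cong (λ z → C pos l + z) (load-single f<n) ⟩
      C pos l + p f ∎
      where
      open ≤-Reasoning
      count : ∀ j → j < n → ι (X j) + ⟨ j ≼ f ⟩ ≤ ⟨ j ≼ l ⟩ + ι (j ≡ᵇ f)
      count j j<n with split (X j)
      ... | inj₂ Xj rewrite Xj = ≤-trans (ι-mono (pos j ≤? pos f) (pos j ≤? pos l) (λ le → ≤-trans le f≤l)) (m≤m+n _ _)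
      ... | inj₁ Xj rewrite Xj | ι-true (pos j ≤? pos l) (proj₂ (X⊆ j j<n Xj)) =
              s≤s (ι-mono (pos j ≤? pos f) (j ≟ f) λ le →
                pos-injective j f j<n f<n (≤-antisym le (proj₁ (X⊆ j j<n Xj))))

    module _ (sorted : ∀ i j → i ≤ j → j < n → d i ℤ.≤ d j ⊎ dmin ℤ.+ + P ℤ.≤ d j)
             (attained : ∃ λ j → j < n × d j ≡ dmin)
             (Λ : ℤ) (onTime : ∀ i → i < n → + C pos i ℤ.≤ Λ ℤ.+ d i) where

      0≤Λ+dmin : 0ℤ ℤ.≤ Λ ℤ.+ dmin
      0≤Λ+dmin = ℤ.≤-trans (+≤+ z≤n)
        (subst (λ z → + C pos (proj₁ attained) ℤ.≤ Λ ℤ.+ z) (proj₂ (proj₂ attained))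
          (onTime (proj₁ attained) (proj₁ (proj₂ attained))))

      -- Some job of index at most i completes no earlier than all of X.
      load≤ : ∀ i → i < n → (X : ℕ → Bool) →
              (∀ j → j < n → X j ≡ true → ∃ λ y → y ≤ i × pos j ≤ pos y) →
              + load (ι ∘ X) n ℤ.≤ Λ ℤ.+ d i
      load≤ i i<n X X≼ with extremal (λ y z → pos y ≤ pos z) (λ y z → ≤-total (pos y) (pos z)) ≤-trans (λ _ → true) (suc i)
      ... | inj₁ none = ⊥-elim (true≢false (none i ≤-refl))
      ... | inj₂ (last , s≤s last≤i , _ , isLast) = conclude (sorted last i last≤i i<n)
        where
        count : ∀ j → j < n → ι (X j) ≤ ⟨ j ≼ last ⟩
        count j j<n with split (X j)
        ... | inj₂ Xj rewrite Xj = z≤n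
        ... | inj₁ Xj rewrite Xj with y , y≤i , j≼y ← X≼ j j<n Xj =
                ≤-reflexive (sym (ι-true (pos j ≤? pos last) (≤-trans j≼y (isLast y (s≤s y≤i) refl))))
        conclude : d last ℤ.≤ d i ⊎ dmin ℤ.+ + P ℤ.≤ d i → + load (ι ∘ X) n ℤ.≤ Λ ℤ.+ d i
        conclude (inj₁ le) = ℤ.≤-trans (+≤+ (load-mono n count))
          (ℤ.≤-trans (onTime last (≤-<-trans last≤i i<n)) (ℤ.+-monoʳ-≤ Λ le))
        -- Beyond the cap the due dates need not be in order, but there the due date is so late that
        -- even the load P of all jobs is on time.
        conclude (inj₂ le) = ℤ.≤-trans (+≤+ (load-mono n λ j _ → ι≤1 (X j)))
          (≤-diff (ℤ.+-mono-≤ 0≤Λ+dmin le) (rearrange Λ dmin (+ P) (d i)))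
          where
          rearrange : ∀ Λ m P d → (Λ ℤ.+ m ℤ.+ d) ℤ.- (0ℤ ℤ.+ (m ℤ.+ P)) ≡ Λ ℤ.+ d ℤ.- P
          rearrange = solve-∀

      -- Each index up to i is its own witness in `load≤`. This is the optimality of the due date
      -- order without the renting constraint.
      edd≤ : ∀ i → i < n → + load (λ _ → 1) (suc i) ℤ.≤ Λ ℤ.+ d i
      edd≤ i i<n = subst (λ z → + z ℤ.≤ Λ ℤ.+ d i) (sym loads) (load≤ i i<n (_<ᵇ suc i) λ j j<n lt →
          j , s≤s⁻¹ (<ᵇ⇒< j (suc i) (subst T (sym lt) _)) , ≤-refl)
        where
        loads : load (λ _ → 1) (suc i) ≡ load (λ j → ι (j <ᵇ suc i)) n
        loads = trans (load-prefix (λ _ → 1) i<n) (∑-cong n λ j _ → cong (_* p j) (suc-n*1 (j <ᵇ suc i)))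

      module _ (κ : ℕ) (β-max : ∀ b → R n + b ≤ κ → b ≤ P → b ≤ β) (f l : ℕ) (f<n : f < n) (rf : r f ≡ true)
               (first : ∀ j → j < n → r j ≡ true → pos f ≤ pos j)
               (last  : ∀ j → j < n → r j ≡ true → pos j ≤ pos l)
               (feasible : C pos l + p f ≤ κ + C pos f) where

        private
          α : ℕ → Bool
          α j = pos j <ᵇ pos f

          isTail : ℕ → Bool
          isTail j = not (r j) ∧ (pos l <ᵇ pos j)

        -- A search without success returns m; as a cut, this means that no non-r-job follows the
        -- period.
        least : ∀ (U : ℕ → Bool) m → ∃ λ k → k ≤ m × (∀ i → i < k → U i ≡ false) × (k < m → U k ≡ true)
        least U zero = 0 , z≤n , (λ _ ()) , λ ()
        least U (suc m) with least U m
        ... | k , k≤m , below , at with k ≟ m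
        ...   | no k≢m = k , m≤n⇒m≤1+n k≤m , below , λ _ → at (≤∧≢⇒< k≤m k≢m)
        ...   | yes refl with split (U m)
        ...     | inj₁ Um = m , n≤1+n m , below , λ _ → Um
        ...     | inj₂ Um = suc m , ≤-refl , below′ , λ lt → ⊥-elim (<-irrefl refl lt)
          where
          below′ : ∀ i → i < suc m → U i ≡ false
          below′ i i<1+m with i ≟ m
          ... | yes refl = Um
          ... | no  i≢m  = below i (≤∧≢⇒< (s≤s⁻¹ i<1+m) i≢m)

        good-cut : ∃ λ k → k ≤ n × (∀ i → k ≤ i → i < n → r i ≡ false → tail i ℤ.≤ Λ) × cut k ℤ.≤ Λ
        good-cut with k , k≤n , below , at ← least isTail n = k , k≤n , tails , cut≤
          where
          ∧-true : ∀ a b → a ∧ b ≡ true → a ≡ true × b ≡ true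
          ∧-true true true eq = refl , refl

          <ᵇ-true : ∀ a b → (a <ᵇ b) ≡ true → a < b
          <ᵇ-true a b eq = <ᵇ⇒< a b (subst T (sym eq) _)

          f≤l : pos f ≤ pos l
          f≤l = last f f<n rf

          tails : ∀ i → k ≤ i → i < n → r i ≡ false → tail i ℤ.≤ Λ
          tails i k≤i i<n ri = ≤-diff (ℤ.≤-trans (ℤ.≤-reflexive (cong +_ loads)) (load≤ i i<n X X≼))
            (rearrange (+ (R n + N (suc i))) (d i) Λ)
            where
            rearrange : ∀ x d Λ → Λ ℤ.+ d ℤ.- x ≡ Λ ℤ.- (x ℤ.- d)
            rearrange = solve-∀
            X : ℕ → Bool
            X j = r j ∨ (j <ᵇ suc i)
            -- As k ≤ i < n, the search was successful and k is a job after the period. Its index is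
            -- at most i, which makes it the witness for all r-jobs in `load≤`.
            l<k : pos l < pos k
            l<k = <ᵇ-true _ _ (proj₂ (∧-true (not (r k)) _ (at (≤-<-trans k≤i i<n))))
            X≼ : ∀ j → j < n → X j ≡ true → ∃ λ y → y ≤ i × pos j ≤ pos y
            X≼ j j<n Xj with split (r j)
            ... | inj₁ rj = k , k≤i , ≤-trans (last j j<n rj) (<⇒≤ l<k)
            ... | inj₂ rj = j , s≤s⁻¹ (<ᵇ-true _ _ (trans (sym (cong (_∨ (j <ᵇ suc i)) rj)) Xj)) , ≤-refl
            point : ∀ j → ι (r j) + ι (j <ᵇ suc i) * ι (not (r j)) ≡ ι (X j)
            point j with r j | j <ᵇ suc i
            ... | true  | true  = refl
            ... | true  | false = refl
            ... | false | true  = refl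
            ... | false | false = refl
            loads : R n + N (suc i) ≡ load (ι ∘ X) n
            loads = trans (cong (λ z → R n + z) (load-prefix (ι ∘ not ∘ r) i<n))
              (trans (sym (load-+ (ι ∘ r) (λ j → ι (j <ᵇ suc i) * ι (not (r j))) n))
                     (∑-cong n λ j _ → cong (_* p j) (point j)))

          -- The filler load of the rearranged sequence. Below k no non-r-job follows the period, so
          -- the non-r-jobs counted here run within it.
          moved : ℕ
          moved = inside α k

          period-jobs : ℕ → Bool
          period-jobs j = r j ∨ ((j <ᵇ k) ∧ not (α j))

          period-load : R n + moved ≡ load (ι ∘ period-jobs) n
          period-load = trans (cong (λ z → R n + z) (load-prefix (λ j → ι (not (r j) ∧ not (α j))) k≤n))
            (trans (sym (load-+ (ι ∘ r) (λ j → ι (j <ᵇ k) * ι (not (r j) ∧ not (α j))) n))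
                   (∑-cong n λ j _ → cong (_* p j) (point j)))
            where
            point : ∀ j → ι (r j) + ι (j <ᵇ k) * ι (not (r j) ∧ not (α j)) ≡ ι (period-jobs j)
            point j with r j | j <ᵇ k | α j
            ... | true  | true  | _     = refl
            ... | true  | false | _     = refl
            ... | false | true  | true  = refl
            ... | false | true  | false = refl
            ... | false | false | _     = refl

          period⊆ : ∀ j → j < n → period-jobs j ≡ true → pos f ≤ pos j × pos j ≤ pos l
          period⊆ j j<n Xj with split (r j)
          ... | inj₁ rj = first j j<n rj , last j j<n rj
          ... | inj₂ rj with j<k , ¬αj ← ∧-true (j <ᵇ k) _ (trans (sym (cong (_∨ ((j <ᵇ k) ∧ not (α j))) rj)) Xj) =
                  ≮⇒≥ (λ lt → true≢false (trans (sym ¬αj) (cong not (dec-true (pos j <? pos f) lt)))) ,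
                  ≮⇒≥ (λ lt → true≢false (trans (sym (cong₂ (λ a b → not a ∧ b) rj (dec-true (pos l <? pos j) lt)))
                                                (below j (<ᵇ-true _ _ j<k))))

          R+moved≤κ : R n + moved ≤ κ
          R+moved≤κ = +-cancelʳ-≤ (C pos f) _ _ (≤-trans
            (subst (λ z → z + C pos f ≤ C pos l + p f) (sym period-load) (window period-jobs f<n f≤l period⊆)) feasible)

          moved≤P : moved ≤ P
          moved≤P = ≤-trans (≤-reflexive (load-prefix (λ j → ι (not (r j) ∧ not (α j))) k≤n))
            (load-mono n λ j _ → *-mono-≤ (ι≤1 (j <ᵇ k)) (ι≤1 _))

          moved≤β : moved ≤ β
          moved≤β = β-max moved R+moved≤κ moved≤P

          -- The desired inequality `cut k` ≤ Λ, solved for `G k β`.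
          θ : ℤ
          θ = Λ ℤ.- + N k ℤ.+ + β

          N≤P : N k ≤ P
          N≤P = ≤-trans (≤-reflexive (load-prefix (ι ∘ not ∘ r) k≤n))
            (load-mono n λ j _ → *-mono-≤ (ι≤1 (j <ᵇ k)) (ι≤1 _))

          floor≤θ : floor ℤ.≤ θ
          floor≤θ = ≤-diff (ℤ.+-mono-≤ (ℤ.+-mono-≤ 0≤Λ+dmin (+≤+ N≤P)) (+≤+ (z≤n {β})))
            (rearrange Λ dmin (+ P) (+ N k) (+ β))
            where
            rearrange : ∀ Λ m P N β → (Λ ℤ.+ m ℤ.+ P ℤ.+ β) ℤ.- (0ℤ ℤ.+ N ℤ.+ 0ℤ) ≡ Λ ℤ.- N ℤ.+ β ℤ.- (0ℤ ℤ.- m ℤ.- P)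
            rearrange = solve-∀

          -- X consists of the indices up to i and the non-r-jobs of the first part. The latter run
          -- before f, and i does not, so all of X precedes a job of index at most i and `load≤`
          -- applies. The load of the first part appears as `N k` - `moved`.
          lates : ∀ i → i < k → r i ∨ not (α i) ≡ true →
                  late i (β ∸ moved + inside α (suc i)) ℤ.≤ θ
          lates i i<k Bi = ≤-diff (ℤ.+-mono-≤ (+≤+ loads) (load≤ i i<n X X≼))
              (trans (rearrange (+ R (suc i)) (+ inside α (suc i)) (+ N k) (+ moved) (+ load (ι ∘ X) n) (d i) Λ (+ β))
                     (cong (λ z → Λ ℤ.- + N k ℤ.+ + β ℤ.- (+ R (suc i) ℤ.- d i ℤ.+ (z ℤ.+ + inside α (suc i))))
                       (trans (ℤ.m-n≡m⊖n β moved) (ℤ.⊖-≥ moved≤β))))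
            where
            i<n = <-≤-trans i<k k≤n
            rearrange : ∀ R I N F L d Λ β → L ℤ.+ F ℤ.+ (Λ ℤ.+ d) ℤ.- (R ℤ.+ I ℤ.+ N ℤ.+ L) ≡
                        Λ ℤ.- N ℤ.+ β ℤ.- (R ℤ.- d ℤ.+ (β ℤ.- F ℤ.+ I))
            rearrange = solve-∀
            X : ℕ → Bool
            X j = (j <ᵇ suc i) ∨ ((j <ᵇ k) ∧ (not (r j) ∧ α j))
            X≼ : ∀ j → j < n → X j ≡ true → ∃ λ y → y ≤ i × pos j ≤ pos y
            X≼ j j<n Xj with split (j <ᵇ suc i)
            ... | inj₁ j≤i = j , s≤s⁻¹ (<ᵇ-true _ _ j≤i) , ≤-refl
            ... | inj₂ j>i = i , ≤-refl , ≤-trans (<⇒≤ (<ᵇ-true _ _ αj)) f≼i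
              where
              αj : α j ≡ true
              αj = proj₂ (∧-true (not (r j)) _ (proj₂ (∧-true (j <ᵇ k) _ (trans (sym (cong (_∨ ((j <ᵇ k) ∧ (not (r j) ∧ α j))) j>i)) Xj))))
              f≼i : pos f ≤ pos i
              f≼i with split (r i)
              ... | inj₁ ri = first i i<n ri
              ... | inj₂ ri = ≮⇒≥ λ lt → true≢false (trans (sym Bi)
                      (cong₂ (λ a b → a ∨ not b) ri (dec-true (pos i <? pos f) lt)))
            loads : R (suc i) + inside α (suc i) + N k ≤ load (ι ∘ X) n + moved
            loads = begin
              R (suc i) + inside α (suc i) + N k
                ≡⟨ cong₂ _+_ (cong₂ _+_ (load-prefix (ι ∘ r) i<n) (load-prefix I i<n)) (load-prefix (ι ∘ not ∘ r) k≤n) ⟩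
              load (λ j → ι (j <ᵇ suc i) * ι (r j)) n + load (λ j → ι (j <ᵇ suc i) * I j) n + load (λ j → ι (j <ᵇ k) * ι (not (r j))) n
                ≡⟨ cong (λ z → z + load (λ j → ι (j <ᵇ k) * ι (not (r j))) n)
                     (load-+ (λ j → ι (j <ᵇ suc i) * ι (r j)) (λ j → ι (j <ᵇ suc i) * I j) n) ⟨
              load (λ j → ι (j <ᵇ suc i) * ι (r j) + ι (j <ᵇ suc i) * I j) n + load (λ j → ι (j <ᵇ k) * ι (not (r j))) n
                ≡⟨ load-+ (λ j → ι (j <ᵇ suc i) * ι (r j) + ι (j <ᵇ suc i) * I j) (λ j → ι (j <ᵇ k) * ι (not (r j))) n ⟨
              load (λ j → ι (j <ᵇ suc i) * ι (r j) + ι (j <ᵇ suc i) * I j + ι (j <ᵇ k) * ι (not (r j))) n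
                ≤⟨ load-mono n (λ j _ → count j) ⟩
              load (λ j → ι (X j) + ι (j <ᵇ k) * I j) n ≡⟨ load-+ (ι ∘ X) (λ j → ι (j <ᵇ k) * I j) n ⟩
              load (ι ∘ X) n + load (λ j → ι (j <ᵇ k) * I j) n ≡⟨ cong (λ z → load (ι ∘ X) n + z) (load-prefix I k≤n) ⟨
              load (ι ∘ X) n + moved ∎
              where
              open ≤-Reasoning
              I : ℕ → ℕ
              I j = ι (not (r j) ∧ not (α j))
              count : ∀ j → ι (j <ᵇ suc i) * ι (r j) + ι (j <ᵇ suc i) * I j + ι (j <ᵇ k) * ι (not (r j)) ≤ ι (X j) + ι (j <ᵇ k) * I j
              count j with r j | α j | j <ᵇ k | j <ᵇ suc i
              ... | true  | _     | true  | true  = s≤s z≤n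
              ... | true  | _     | true  | false = z≤n
              ... | true  | _     | false | true  = s≤s z≤n
              ... | true  | _     | false | false = z≤n
              ... | false | true  | true  | true  = s≤s z≤n
              ... | false | true  | true  | false = s≤s z≤n
              ... | false | true  | false | true  = z≤n
              ... | false | true  | false | false = z≤n
              ... | false | false | true  | true  = s≤s (s≤s z≤n)
              ... | false | false | true  | false = s≤s z≤n
              ... | false | false | false | true  = s≤s z≤n
              ... | false | false | false | false = z≤n

          cut≤ : cut k ℤ.≤ Λ
          cut≤ = ≤-diff (subst (λ z → G k z ℤ.≤ θ) (m∸n+n≡m moved≤β)
              (G-lower α (β ∸ moved) floor≤θ k lates)) (rearrange (G k β) (+ N k) (+ β) Λ)
            where
            rearrange : ∀ g N β Λ → Λ ℤ.- N ℤ.+ β ℤ.- g ≡ Λ ℤ.- (g ℤ.+ N ℤ.- β)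
            rearrange = solve-∀

  -- h is the minimum, over the cuts k′ ≤ m, of the maximum of `cut k′` and the tails from k′ on
  -- below m, and k attains it. A further non-r-job m enters all these maxima with the same
  -- `tail m`, an r-job enters none, and either way one new cut appears. Taking the maximum with a
  -- fixed number commutes with the minimum, so a single candidate has to be kept and each job costs
  -- constant time.
  record Best (m : ℕ) (h : ℤ) (k : ℕ) : Set where
    field
      k≤m   : k ≤ m
      cut≤  : cut k ℤ.≤ h
      tail≤ : ∀ i → k ≤ i → i < m → r i ≡ false → tail i ℤ.≤ h
      least : ∀ Λ k′ → k′ ≤ m → (∀ i → k′ ≤ i → i < m → r i ≡ false → tail i ℤ.≤ Λ) →
              cut k′ ℤ.≤ Λ → h ℤ.≤ Λ

  best-init : Best 0 (cut 0) 0
  best-init = record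
    { k≤m = z≤n ; cut≤ = ℤ.≤-refl ; tail≤ = λ _ _ ()
    ; least = λ { Λ zero z≤n _ cut≤Λ → cut≤Λ } }

  Extended : ℕ → ℤ → ℤ → Set
  Extended m h h′ = (r m ≡ true × h′ ≡ h) ⊎ (r m ≡ false × h′ ≡ h ℤ.⊔ tail m)

  extended-≥ : ∀ {m h h′} → Extended m h h′ → h ℤ.≤ h′
  extended-≥ (inj₁ (_ , refl))             = ℤ.≤-refl
  extended-≥ {m} {h} (inj₂ (_ , refl)) = ℤ.i≤i⊔j h (tail m)

  extended-tail : ∀ {m h h′} → Extended m h h′ → r m ≡ false → tail m ℤ.≤ h′
  extended-tail (inj₁ (rm′ , _)) rm          = contradiction (trans (sym rm′) rm) λ ()
  extended-tail {m} {h} (inj₂ (_ , refl)) rm = ℤ.i≤j⊔i h (tail m)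

  extended-≤ : ∀ {m h h′ Λ} → Extended m h h′ → h ℤ.≤ Λ → (r m ≡ false → tail m ℤ.≤ Λ) → h′ ℤ.≤ Λ
  extended-≤ (inj₁ (_ , refl))  h≤Λ tail≤Λ = h≤Λ
  extended-≤ (inj₂ (rm , refl)) h≤Λ tail≤Λ = ℤ.⊔-lub h≤Λ (tail≤Λ rm)

  module _ {m h k h′} (best : Best m h k) (extended : Extended m h h′) where
    private
      open module B = Best best

      h′≤ : ∀ Λ k′ → k′ ≤ m → (∀ i → k′ ≤ i → i < suc m → r i ≡ false → tail i ℤ.≤ Λ) →
            cut k′ ℤ.≤ Λ → h′ ℤ.≤ Λ
      h′≤ Λ k′ k′≤m tails cut≤Λ = extended-≤ extended
        (least Λ k′ k′≤m (λ i k≤i i<m → tails i k≤i (m<n⇒m<1+n i<m)) cut≤Λ) (tails m k′≤m ≤-refl)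

    best-new : cut (suc m) ℤ.≤ h′ → Best (suc m) (cut (suc m)) (suc m)
    best-new new≤ = record
      { k≤m = ≤-refl ; cut≤ = ℤ.≤-refl
      ; tail≤ = λ i m<i i<1+m → contradiction m<i (≤⇒≯ (s≤s⁻¹ i<1+m))
      ; least = least′ }
      where
      least′ : ∀ Λ k′ → k′ ≤ suc m → (∀ i → k′ ≤ i → i < suc m → r i ≡ false → tail i ℤ.≤ Λ) →
               cut k′ ℤ.≤ Λ → cut (suc m) ℤ.≤ Λ
      least′ Λ k′ k′≤1+m tails cut≤Λ with k′ ≟ suc m
      ... | yes refl = cut≤Λ
      ... | no  k′≢  = ℤ.≤-trans new≤ (h′≤ Λ k′ (s≤s⁻¹ (≤∧≢⇒< k′≤1+m k′≢)) tails cut≤Λ)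

    best-keep : ¬ cut (suc m) ℤ.≤ h′ → Best (suc m) h′ k
    best-keep new≰ = record
      { k≤m = m≤n⇒m≤1+n k≤m ; cut≤ = ℤ.≤-trans cut≤ (extended-≥ extended) ; tail≤ = tail≤′ ; least = least′ }
      where
      tail≤′ : ∀ i → k ≤ i → i < suc m → r i ≡ false → tail i ℤ.≤ h′
      tail≤′ i k≤i i<1+m ri with i ≟ m
      ... | yes refl = extended-tail extended ri
      ... | no  i≢m  = ℤ.≤-trans (tail≤ i k≤i (≤∧≢⇒< (s≤s⁻¹ i<1+m) i≢m) ri) (extended-≥ extended)
      least′ : ∀ Λ k′ → k′ ≤ suc m → (∀ i → k′ ≤ i → i < suc m → r i ≡ false → tail i ℤ.≤ Λ) →
               cut k′ ℤ.≤ Λ → h′ ℤ.≤ Λ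
      least′ Λ k′ k′≤1+m tails cut≤Λ with k′ ≟ suc m
      ... | yes refl = ℤ.≤-trans (ℤ.<⇒≤ (ℤ.≰⇒> new≰)) cut≤Λ
      ... | no  k′≢  = h′≤ Λ k′ (s≤s⁻¹ (≤∧≢⇒< k′≤1+m k′≢)) tails cut≤Λ

-- Reasoning about programs

-- Computed from the program text, so that for a concrete program and array the frame condition is
-- proved by `refl`. It tracks whole arrays, which is why every scalar has an array of its own.
writes : ℕ → Prog → Bool
writes a skip              = false
writes a (b [ e ]≔ f)      = does (b ≟ a)
writes a (b ⨾ c)           = writes a b ∨ writes a c
writes a (if q th b el c)  = writes a b ∨ writes a c
writes a (while q loop b)  = writes a b

∨-false : ∀ a {b} → a ∨ b ≡ false → a ≡ false × b ≡ false
∨-false false {false} _ = refl , refl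

Unchanged : Prog → Store → Store → Set
Unchanged c s s′ = ∀ a → writes a c ≡ false → ∀ j → s′ a j ≡ s a j

set-other : ∀ (s : Store) a b i z → does (a ≟ b) ≡ false → ∀ j → (s [ a , i ↦ z ]) b j ≡ s b j
set-other s a b i z eq j rewrite eq = refl

set-same : ∀ (s : Store) a i z → (s [ a , i ↦ z ]) a i ≡ z
set-same s a i z rewrite dec-true (a ≟ a) refl | dec-true (i ℤ.≟ i) refl = refl

unchanged : ∀ {c s t s′} → ⟨ c , s ⟩⇓[ t ] s′ → Unchanged c s s′
unchanged ⇓skip a w j = refl
unchanged (⇓assign {s = s} {b} {e} {f}) a w j = set-other s b a (⟦ e ⟧ s) (⟦ f ⟧ s) w j
unchanged (⇓seq {b = b} x y) a w j with w₁ , w₂ ← ∨-false (writes a b) w = trans (unchanged y a w₂ j) (unchanged x a w₁ j)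
unchanged (⇓then {b = b} _ x) a w j = unchanged x a (proj₁ (∨-false (writes a b) w)) j
unchanged (⇓else {b = b} _ x) a w j = unchanged x a (proj₂ (∨-false (writes a b) w)) j
unchanged (⇓stop _) a w j = refl
unchanged (⇓loop _ x y) a w j = trans (unchanged y a w j) (unchanged x a w j)

unchanged-⨾ : ∀ b c {s s₁ s₂} → Unchanged b s s₁ → Unchanged c s₁ s₂ → Unchanged (b ⨾ c) s s₂
unchanged-⨾ b c u u′ a w j with w₁ , w₂ ← ∨-false (writes a b) w = trans (u′ a w₂ j) (u a w₁ j)

record Run (c : Prog) (s : Store) (Q : Store → Set) (B : ℕ) : Set where
  constructor run
  field
    {time}  : ℕ
    {final} : Store
    exec    : ⟨ c , s ⟩⇓[ time ] final
    post    : Q final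
    time≤   : time ≤ B

run-≤ : ∀ {c s Q B B′} → B ≤ B′ → Run c s Q B → Run c s Q B′
run-≤ le (run e q t) = run e q (≤-trans t le)

run-map : ∀ {c s Q Q′ B} → (∀ s′ → Q s′ → Q′ s′) → Run c s Q B → Run c s Q′ B
run-map f (run e q t) = run e (f _ q) t

run-seq : ∀ {b c s Q Q′ B B′} → Run b s Q B →
          (∀ s′ → Unchanged b s s′ → Q s′ → Run c s′ Q′ B′) → Run (b ⨾ c) s Q′ (B + B′)
run-seq (run e q t) k with run e′ q′ t′ ← k _ (unchanged e) q = run (⇓seq e e′) q′ (+-mono-≤ t t′)

holds? : ∀ q s → Dec (Holds q s)
holds? (e ≼ f) s = ⟦ e ⟧ s ℤ.≤? ⟦ f ⟧ s

wp : Prog → (Store → Set) → Store → Set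
wp skip              Q s = Q s
wp (a [ e ]≔ f)      Q s = Q (s [ a , ⟦ e ⟧ s ↦ ⟦ f ⟧ s ])
wp (b ⨾ c)           Q s = wp b (wp c Q) s
wp (if q th b el c)  Q s = (Holds q s → wp b Q s) × (¬ Holds q s → wp c Q s)
wp (while q loop b)  Q s = ⊥

-- An upper bound: both branches of a conditional are charged. The value 0 for loops is harmless,
-- since their `wp` is empty and `straight` never applies to them.
cost : Prog → ℕ
cost skip             = 1
cost (a [ e ]≔ f)     = 1 + (costᴱ e + costᴱ f)
cost (b ⨾ c)          = cost b + cost c
cost (if q th b el c) = costᵀ q + (cost b + cost c)
cost (while q loop b) = 0

straight : ∀ c {s Q} → wp c Q s → Run c s Q (cost c)
straight skip         w = run ⇓skip w ≤-refl
straight (a [ e ]≔ f) w = run ⇓assign w ≤-refl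
straight (b ⨾ c)      w = run-seq (straight b w) λ _ _ → straight c
straight (if q th b el c) {s} (wᵗ , wᶠ) with holds? q s
... | yes h with run e q′ t ← straight b (wᵗ h) = run (⇓then h e) q′ (+-monoʳ-≤ (costᵀ q) (≤-trans t (m≤m+n _ _)))
... | no ¬h with run e q′ t ← straight c (wᶠ ¬h) = run (⇓else ¬h e) q′ (+-monoʳ-≤ (costᵀ q) (≤-trans t (m≤n+m _ _)))

run-if : ∀ {q b c s Q B} → (Holds q s → Run b s Q B) → (¬ Holds q s → Run c s Q B) →
         Run (if q th b el c) s Q (costᵀ q + B)
run-if {q} {s = s} kᵗ kᶠ with holds? q s
... | yes h with run e q′ t ← kᵗ h  = run (⇓then h e) q′ (+-monoʳ-≤ (costᵀ q) t)
... | no ¬h with run e q′ t ← kᶠ ¬h = run (⇓else ¬h e) q′ (+-monoʳ-≤ (costᵀ q) t)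

var : ℕ → Exp
var a = a [ lit 0ℤ ]

infix 5 _:=_
_:=_ : ℕ → Exp → Prog
a := e = a [ lit 0ℤ ]≔ e

forLoop : ℕ → ℕ → Prog → Prog
forLoop i b body = (i := lit 0ℤ) ⨾ (while (var i ⊕ lit 1ℤ) ≼ var b loop (body ⨾ (i := var i ⊕ lit 1ℤ)))

-- A pass costs 13 besides the body (7 for the test, 6 for the increment); the
-- initialisation and the last test, 3 + 7, are charged to the passes as well.
run-for : ∀ i b body m (I : ℕ → Store → Set) B s₀ → s₀ b 0ℤ ≡ + m →
          writes b (forLoop i b body) ≡ false → writes i body ≡ false →
          (∀ k s z → I k s → I k (s [ i , 0ℤ ↦ z ])) → I 0 s₀ → 1 ≤ m →
          (∀ k s → k < m → s i 0ℤ ≡ + k → Unchanged (forLoop i b body) s₀ s → I k s → Run body s (I (suc k)) B) →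
          Run (forLoop i b body) s₀ (I m) (m * (23 + B))
run-for i b body m I B s₀ bound wb wi stable init 1≤m step =
  run-≤ total (run-seq (straight (i := lit 0ℤ) {s = s₀} {Q = λ s → I 0 s × s i 0ℤ ≡ + 0}
                          (stable 0 s₀ (+ 0) init , set-same s₀ i 0ℤ (+ 0)))
    λ s u (inv , si) → iterate m 0 (+-identityʳ m) s si (λ a w j → u a (proj₁ (∨-false (does (i ≟ a)) w)) j) inv)
  where
  -- Adding 1 expresses the strict comparison, since tests offer only ≤.
  guard = (var i ⊕ lit 1ℤ) ≼ var b
  loop  = while guard loop (body ⨾ (i := var i ⊕ lit 1ℤ))

  iterate : ∀ r k → r + k ≡ m → ∀ s → s i 0ℤ ≡ + k → Unchanged (forLoop i b body) s₀ s → I k s →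
            Run loop s (I m) (7 + r * (7 + (B + 6)))
  iterate zero k refl s si u inv = run (⇓stop λ h → <-irrefl refl
      (ℤ.drop‿+≤+ (subst₂ ℤ._≤_ (trans (cong (ℤ._+ 1ℤ) si) (cong +_ (+-comm k 1))) (trans (u b wb 0ℤ) bound) h)))
    inv ≤-refl
  iterate (suc r) k eq s si u inv
    with run {final = s′} e inv′ t ← step k s (≤-trans (s≤s (m≤n+m k r)) (≤-reflexive eq)) si u inv
    with run e′ inv″ t′ ← iterate r (suc k) (trans (+-suc r k) eq) _
           (trans (set-same s′ i 0ℤ _) (trans (cong (ℤ._+ 1ℤ) (trans (unchanged e i wi 0ℤ) si)) (cong +_ (+-comm k 1))))
           (λ a w j → trans (set-other s′ i a 0ℤ _ (proj₁ (∨-false (does (i ≟ a)) w)) j)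
                        (trans (unchanged e a (proj₁ (∨-false (writes a body) (proj₂ (∨-false (does (i ≟ a)) w)))) j) (u a w j)))
           (stable (suc k) _ _ inv′) =
    run (⇓loop (subst₂ ℤ._≤_ (sym (trans (cong (ℤ._+ 1ℤ) si) (cong +_ (+-comm k 1)))) (sym (trans (u b wb 0ℤ) bound))
                  (+≤+ (≤-trans (s≤s (m≤n+m k r)) (≤-reflexive eq))))
           (⇓seq e ⇓assign) e′)
        inv″
        (≤-trans (+-monoʳ-≤ 7 (+-mono-≤ (+-monoˡ-≤ 6 t) t′)) (≤-reflexive (rearrange B r)))
    where
    rearrange : ∀ B r → 7 + (B + 6 + (7 + r * (7 + (B + 6)))) ≡ 7 + (suc r * (7 + (B + 6)))
    rearrange = ℕ-solve-∀

  total : 3 + (7 + m * (7 + (B + 6))) ≤ m * (23 + B)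
  total = ≤-trans (+-monoˡ-≤ (m * (7 + (B + 6))) (*-monoˡ-≤ 10 1≤m)) (≤-reflexive (rearrange m B))
    where
    rearrange : ∀ m B → m * 10 + m * (7 + (B + 6)) ≡ m * (23 + B)
    rearrange = ℕ-solve-∀

-- Counting sort

if-≡ : ∀ {A : Set} {x y : ℤ} {u v : A} → x ≡ y → (if does (x ℤ.≟ y) then u else v) ≡ u
if-≡ {x = x} {y} eq rewrite dec-true (x ℤ.≟ y) eq = refl

if-≢ : ∀ {A : Set} {x y : ℤ} {u v : A} → x ≢ y → (if does (x ℤ.≟ y) then u else v) ≡ v
if-≢ {x = x} {y} neq rewrite dec-false (x ℤ.≟ y) neq = refl

indicator-true : ∀ b {z} → z ≡ (if b then 1ℤ else 0ℤ) → 1ℤ ℤ.≤ z → b ≡ true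
indicator-true true  _    _ = refl
indicator-true false refl (+≤+ ())

indicator-false : ∀ b {z} → z ≡ (if b then 1ℤ else 0ℤ) → ¬ 1ℤ ℤ.≤ z → b ≡ false
indicator-false false _    _  = refl
indicator-false true  refl 1≰ = ⊥-elim (1≰ ℤ.≤-refl)

module Rank (n : ℕ) (key : ℕ → ℕ) where

  -- The jobs that have been output when the scan for value v arrives at index i.
  Before : ℕ → ℕ → ℕ → Set
  Before v i j = key j < v ⊎ (key j ≡ v × j < i)

  before? : ∀ v i j → Dec (Before v i j)
  before? v i j = (key j <? v) ⊎-dec ((key j ≟ v) ×-dec (j <? i))

  #before : ℕ → ℕ → ℕ
  #before v i = ∑ n λ j → ι (does (before? v i j))

  -- The value of the output pointer at the moment when j is met in the scan for its own key, hence
  -- the final position of j.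
  rank : ℕ → ℕ
  rank j = #before (key j) j

  ¬before-self : ∀ j → ¬ Before (key j) j j
  ¬before-self j (inj₁ lt)       = <-irrefl refl lt
  ¬before-self j (inj₂ (_ , lt)) = <-irrefl refl lt

  rank<n : ∀ j → j < n → rank j < n
  rank<n j j<n = subst (rank j <_) (∑-1 n) (∑-mono-< n
    (λ i _ → ι≤1 (does (before? (key j) j i))) j<n
    (≤-reflexive (cong suc (ι-false (before? (key j) j j) (¬before-self j)))))

  rank-mono : ∀ i j → i < n → Before (key j) j i → rank i < rank j
  rank-mono i j i<n i≺j = ∑-mono-< n
    (λ q _ → ι-mono (before? (key i) i q) (before? (key j) j q) (λ q≺i → trans-before q≺i i≺j)) i<n
    (subst₂ _<_ (sym (ι-false (before? (key i) i i) (¬before-self i)))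
                (sym (ι-true (before? (key j) j i) i≺j)) ≤-refl)
    where
    trans-before : ∀ {q} → Before (key i) i q → Before (key j) j i → Before (key j) j q
    trans-before (inj₁ x)         (inj₁ y)         = inj₁ (<-trans x y)
    trans-before (inj₁ x)         (inj₂ (y , _))   = inj₁ (<-≤-trans x (≤-reflexive y))
    trans-before (inj₂ (x , _))   (inj₁ y)         = inj₁ (≤-<-trans (≤-reflexive x) y)
    trans-before (inj₂ (x , x<))  (inj₂ (y , y<))  = inj₂ (trans x y , <-trans x< y<)

  before-total : ∀ i j → i ≢ j → Before (key j) j i ⊎ Before (key i) i j
  before-total i j i≢j with <-cmp (key i) (key j) | <-cmp i j
  ... | tri< lt _ _ | _            = inj₁ (inj₁ lt)
  ... | tri> _ _ gt | _            = inj₂ (inj₁ gt)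
  ... | tri≈ _ eq _ | tri< lt _ _  = inj₁ (inj₂ (eq , lt))
  ... | tri≈ _ eq _ | tri≈ _ i≡j _ = ⊥-elim (i≢j i≡j)
  ... | tri≈ _ eq _ | tri> _ _ gt  = inj₂ (inj₂ (sym eq , gt))

  rank-≢ : ∀ i j → i < n → j < n → i ≢ j → rank i ≢ rank j
  rank-≢ i j i<n j<n i≢j eq with before-total i j i≢j
  ... | inj₁ i≺j = <⇒≢ (rank-mono i j i<n i≺j) eq
  ... | inj₂ j≺i = <⇒≢ (rank-mono j i j<n j≺i) (sym eq)

  #before-0 : #before 0 0 ≡ 0
  #before-0 = trans (∑-cong n λ j _ → ι-false (before? 0 0 j) none) (∑-0 n)
    where
    none : ∀ {j} → ¬ Before 0 0 j
    none (inj₁ ())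
    none (inj₂ (_ , ()))

  Before-≡ : ∀ {v i j} → key i ≡ v → Before v (suc i) j → Before v i j ⊎ j ≡ i
  Before-≡ eq (inj₁ lt) = inj₁ (inj₁ lt)
  Before-≡ {i = i} {j} eq (inj₂ (k , j<1+i)) with j ≟ i
  ... | yes j≡i = inj₂ j≡i
  ... | no  j≢i = inj₁ (inj₂ (k , ≤∧≢⇒< (s≤s⁻¹ j<1+i) j≢i))

  Before-≢ : ∀ {v i j} → key i ≢ v → Before v (suc i) j → Before v i j
  Before-≢ neq (inj₁ lt) = inj₁ lt
  Before-≢ {i = i} {j} neq (inj₂ (k , j<1+i)) = inj₂ (k , ≤∧≢⇒< (s≤s⁻¹ j<1+i) λ { refl → neq k })

  Before-suc : ∀ {v i j} → Before v i j → Before v (suc i) j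
  Before-suc (inj₁ lt)       = inj₁ lt
  Before-suc (inj₂ (k , lt)) = inj₂ (k , m<n⇒m<1+n lt)

  Before-row : ∀ {v j} → Before (suc v) 0 j → j < n → Before v n j
  Before-row {v} {j} (inj₁ lt) j<n with key j ≟ v
  ... | yes eq = inj₂ (eq , j<n)
  ... | no neq = inj₁ (≤∧≢⇒< (s≤s⁻¹ lt) neq)

  Before-row⁻¹ : ∀ {v j} → Before v n j → Before (suc v) 0 j
  Before-row⁻¹ (inj₁ lt)      = inj₁ (m<n⇒m<1+n lt)
  Before-row⁻¹ (inj₂ (k , _)) = inj₁ (s≤s (≤-reflexive k))

  ι-⇔ : ∀ {A B : Set} (a? : Dec A) (b? : Dec B) → (A → B) → (B → A) → ι (does a?) ≡ ι (does b?)
  ι-⇔ a? b? f g = ≤-antisym (ι-mono a? b? f) (ι-mono b? a? g)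

  #before-row : ∀ v → #before v n ≡ #before (suc v) 0
  #before-row v = ∑-cong n λ j j<n →
    ι-⇔ (before? v n j) (before? (suc v) 0 j) Before-row⁻¹ λ b → Before-row b j<n

  #before-≢ : ∀ {v i} → key i ≢ v → #before v (suc i) ≡ #before v i
  #before-≢ {v} {i} neq = ∑-cong n λ j _ →
    ι-⇔ (before? v (suc i) j) (before? v i j) (Before-≢ neq) Before-suc

  #before-≡ : ∀ {v i} → i < n → key i ≡ v → #before v (suc i) ≡ suc (#before v i)
  #before-≡ {v} {i} i<n refl = ∑-update n
    (λ j _ j≢i → ι-⇔ (before? v (suc i) j) (before? v i j)
      (λ b → Sum.[ (λ z → z) , (λ j≡i → ⊥-elim (j≢i j≡i)) ] (Before-≡ refl b)) Before-suc)
    i<n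
    (trans (ι-true (before? v (suc i) i) (inj₂ (refl , ≤-refl)))
           (cong suc (sym (ι-false (before? v i i) (¬before-self i)))))

  ranking : Σ[ π ∈ Permutation′ n ] (∀ i → toℕ (π ⟨$⟩ˡ i) ≡ rank (toℕ i))
  ranking = proj₁ perm , λ i → trans (cong toℕ (proj₂ perm i)) (Fin.toℕ-fromℕ< _)
    where
    injective : ∀ (i j : Fin n) → rank (toℕ i) ≡ rank (toℕ j) → i ≡ j
    injective i j eq with toℕ i ≟ toℕ j
    ... | yes i≡j = Fin.toℕ-injective i≡j
    ... | no  i≢j = ⊥-elim (rank-≢ _ _ (Fin.toℕ<n i) (Fin.toℕ<n j) i≢j eq)
    perm : Σ[ π ∈ Permutation′ n ] (∀ i → π ⟨$⟩ˡ i ≡ fromℕ< (rank<n (toℕ i) (Fin.toℕ<n i)))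
    perm = injective⇒permutation (λ i → fromℕ< (rank<n (toℕ i) (Fin.toℕ<n i))) λ {i} {j} eq → injective i j (Fin.fromℕ<-injective _ _ _ _ eq)

-- Arrays besides those of the input and the output:
--   7 P, 8 load of Jʳ, 9 dmin, 10 sort keys, later the classes, 11 sort input,
--   13 and 14 loop counters, 15 output position, 16 number of sort keys,
--   17 β + 1, 18 β, 19 floor, 20 the table with G q b in cell q (β + 1) + b,
--   21 position in the table, 22 R, 23 N, 24 best value, 25 best cut,
--   26 current job, 27 its p, 28 its d, 29 its Jʳ-indicator, 30 table shift,
--   32 constant part of late, 31 and 33 to 35 temporaries,
--   36 remaining filler budget, 37 backtracking index.
-- Array 6 holds the due date order until the final sort overwrites it.
sortBody sortRow sort : Prog
sortBody = if (10 [ var 14 ]) ≼ var 13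
           th (if var 13 ≼ (10 [ var 14 ])
               th ((6 [ var 15 ]≔ 11 [ var 14 ]) ⨾ (15 := var 15 ⊕ lit 1ℤ))
               el skip)
           el skip
sortRow  = forLoop 14 0 sortBody
sort     = (15 := lit 0ℤ) ⨾ forLoop 13 16 sortRow

module Sorting (n : ℕ) (key : ℕ → ℕ) (V : ℕ) (1≤n : 1 ≤ n) (key≤V : ∀ j → j < n → key j ≤ V) (s₀ : Store)
  (s₀-n : s₀ 0 0ℤ ≡ + n) (s₀-V : s₀ 16 0ℤ ≡ + suc V) (s₀-key : ∀ j → j < n → s₀ 10 (+ j) ≡ + key j) where

  open Rank n key

  Placed : ℕ → ℕ → Store → Set
  Placed v i s = s 15 0ℤ ≡ + #before v i ×
                 (∀ j → j < n → Before v i j → s 6 (+ rank j) ≡ s₀ 11 (+ j))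

  sortBody-correct : ∀ {v i s} → i < n → s 14 0ℤ ≡ + i → s 13 0ℤ ≡ + v →
    (∀ j → s 10 j ≡ s₀ 10 j) → (∀ j → s 11 j ≡ s₀ 11 j) → Placed v i s →
    Run sortBody s (Placed v (suc i)) (cost sortBody)
  sortBody-correct {v} {i} {s} i<n si sv s10 s11 (ptr , placed) = straight sortBody
    ( (λ le → (λ ge → let v≡ = ≤-antisym (ℤ.drop‿+≤+ (subst₂ ℤ._≤_ ki sv le)) (ℤ.drop‿+≤+ (subst₂ ℤ._≤_ sv ki ge)) in
          trans (cong (ℤ._+ 1ℤ) ptr) (trans (cong +_ (+-comm _ 1)) (cong +_ (sym (#before-≡ i<n v≡))))
        , λ j j<n b → place j j<n v≡ (Before-≡ v≡ b))
      , (λ ≱ → skipped λ eq → ≱ (subst₂ ℤ._≤_ (sym sv) (sym ki) (ℤ.≤-reflexive (cong +_ (sym eq))))))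
    , (λ ≰ → skipped λ eq → ≰ (subst₂ ℤ._≤_ (sym ki) (sym sv) (ℤ.≤-reflexive (cong +_ eq)))) )
    where
    ki : s 10 (s 14 0ℤ) ≡ + key i
    ki = trans (cong (s 10) si) (trans (s10 _) (s₀-key i i<n))
    skipped : key i ≢ v → Placed v (suc i) s
    skipped neq = trans ptr (cong +_ (sym (#before-≢ neq))) , λ j j<n b → placed j j<n (Before-≢ neq b)
    place : ∀ j → j < n → key i ≡ v → Before v i j ⊎ j ≡ i →
            (s [ 6 , s 15 0ℤ ↦ s 11 (s 14 0ℤ) ]) 6 (+ rank j) ≡ s₀ 11 (+ j)
    place j j<n refl (inj₂ refl) = trans (if-≡ ptr) (trans (cong (s 11) si) (s11 _))
    -- For v = `key i` the pointer `#before v i` is `rank i`, so the write misses the ranks of all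
    -- jobs placed earlier.
    place j j<n refl (inj₁ b) = trans
      (if-≢ λ eq → rank-≢ j i j<n i<n (λ { refl → ¬before-self j b }) (ℤ.+-injective (trans (sym eq) ptr)))
      (placed j j<n b)

  Sorted : Store → Set
  Sorted s = Σ[ π ∈ Permutation′ n ]
    (∀ k → s 6 (+ toℕ k) ≡ s₀ 11 (+ toℕ (π ⟨$⟩ʳ k))) ×
    (∀ i j → Before (key (toℕ j)) (toℕ j) (toℕ i) → toℕ (π ⟨$⟩ˡ i) < toℕ (π ⟨$⟩ˡ j))

  -- There is one scan over all jobs per key value and no buckets; the n (V + 1) passes are
  -- affordable even for V = P. Equal keys keep their index order. In the second use, where the
  -- classes are the keys, this stability preserves the due date order within each class.
  sort-correct : Run sort s₀ Sorted (3 + suc V * (23 + n * (23 + cost sortBody)))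
  sort-correct = run-seq
    (straight (15 := lit 0ℤ) {s = s₀} {Q = Placed 0 0}
      (cong +_ (sym #before-0) , λ { j j<n (inj₁ ()) ; j j<n (inj₂ (_ , ())) }))
    λ s₁ u₁ placed₀ → run-map arrange (run-for 13 16 sortRow (suc V) (λ v → Placed v 0) _ s₁
      (trans (u₁ 16 refl 0ℤ) s₀-V) refl refl (λ _ _ _ x → x) placed₀ (s≤s z≤n)
      λ v s₂ v<V sv u₂ placed → advance v (run-for 14 0 sortBody n (λ i → Placed v i) _ s₂
        (trans (u₂ 0 refl 0ℤ) (trans (u₁ 0 refl 0ℤ) s₀-n)) refl refl (λ _ _ _ x → x) placed 1≤n
        λ i s₃ i<n si u₃ → sortBody-correct i<n si (trans (u₃ 13 refl 0ℤ) sv)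
          (λ j → trans (u₃ 10 refl j) (trans (u₂ 10 refl j) (u₁ 10 refl j)))
          (λ j → trans (u₃ 11 refl j) (trans (u₂ 11 refl j) (u₁ 11 refl j)))))
    where
    advance : ∀ v {s B} → Run sortRow s (Placed v n) B → Run sortRow s (Placed (suc v) 0) B
    advance v (run e (ptr , placed) t) =
      run e (trans ptr (cong +_ (#before-row v)) , λ j j<n b → placed j j<n (Before-row b j<n)) t
    arrange : ∀ s → Placed (suc V) 0 s → Sorted s
    arrange s (_ , placed) with π , π≡ ← ranking = π ,
      (λ k → trans (cong (λ z → s 6 (+ z)) (trans (cong toℕ (sym (inverseˡ π {k}))) (π≡ (π ⟨$⟩ʳ k))))
                   (placed (toℕ (π ⟨$⟩ʳ k)) (Fin.toℕ<n (π ⟨$⟩ʳ k))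
                           (inj₁ (s≤s (key≤V (toℕ (π ⟨$⟩ʳ k)) (Fin.toℕ<n (π ⟨$⟩ʳ k))))))) ,
      λ i j b → subst₂ _<_ (sym (π≡ i)) (sym (π≡ j)) (rank-mono (toℕ i) (toℕ j) (Fin.toℕ<n i) b)

-- The table

∸-pos : ∀ {m n} → n ≤ m → + m ℤ.- + n ≡ + (m ∸ n)
∸-pos {m} {n} le = trans (ℤ.m-n≡m⊖n m n) (ℤ.⊖-≥ le)

-- One piece of code serves both kinds of job: an r-job has shift 0 and must take the candidate, a
-- non-r-job takes it only if it is no worse than the cell above. The pointer in array 21 advances
-- cell by cell, so the row above lies `var 17` cells back and no multiplication occurs.
maximise choose candidate cellValue cellBody : Prog
maximise  = if var 35 ≼ (var 32 ⊕ var 14) th (35 := var 32 ⊕ var 14) el skip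
choose    = if lit 1ℤ ≼ var 29 th (34 := var 35) el (if var 35 ≼ var 34 th (34 := var 35) el skip)
candidate = (35 := 20 [ (var 21 ⊖ var 17) ⊖ var 30 ]) ⨾ maximise ⨾ choose
cellValue = (34 := 20 [ var 21 ⊖ var 17 ]) ⨾ (if var 30 ≼ var 14 th candidate el skip)
cellBody  = cellValue ⨾ (20 [ var 21 ]≔ var 34) ⨾ (21 := var 21 ⊕ lit 1ℤ)

-- `loadJob` also copies the due date order to array 11, the input of the final sort, which
-- overwrites array 6. `record-cut` reads the last cell of the row just completed, where the budget
-- is β. The summand 0 in `dpInit` is `N 0`, so that the initial best value is `cut 0`.
loadJob account prepare record-cut rowBody dpBase dpInit dp : Prog
loadJob = (26 := 6 [ var 13 ]) ⨾ (11 [ var 13 ]≔ var 26) ⨾ (27 := 2 [ var 26 ]) ⨾ (28 := 3 [ var 26 ]) ⨾ (29 := 4 [ var 26 ])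
account = if lit 1ℤ ≼ var 29
          th ((22 := var 22 ⊕ var 27) ⨾ (30 := lit 0ℤ))
          el ((23 := var 23 ⊕ var 27) ⨾ (30 := var 27) ⨾ (31 := (var 8 ⊕ var 23) ⊖ var 28) ⨾
              (if var 24 ≼ var 31 th (24 := var 31) el skip))
prepare = loadJob ⨾ account ⨾ (32 := var 22 ⊖ var 28)
record-cut = (33 := ((20 [ var 21 ⊖ lit 1ℤ ]) ⊕ var 23) ⊖ var 18) ⨾
             (if var 33 ≼ var 24 th ((24 := var 33) ⨾ (25 := var 13 ⊕ lit 1ℤ)) el skip)
rowBody = prepare ⨾ forLoop 14 17 cellBody ⨾ record-cut
dpInit  = (21 := var 17) ⨾ (22 := lit 0ℤ) ⨾ (23 := lit 0ℤ) ⨾ (24 := (var 19 ⊕ lit 0ℤ) ⊖ var 18) ⨾ (25 := lit 0ℤ)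
dpBase  = forLoop 14 17 (20 [ var 14 ]≔ var 19)
dp      = dpBase ⨾ dpInit ⨾ forLoop 13 0 rowBody

module Table (n : ℕ) (p : ℕ → ℕ) (d : ℕ → ℤ) (r : ℕ → Bool) (dmin : ℤ) (β : ℕ) where

  open Renting n p d r dmin β

  W : ℕ
  W = suc β

  isRental : ℕ → ℤ
  isRental q = if r q then 1ℤ else 0ℤ

  shift : ℕ → ℕ
  shift q = if r q then 0 else p q

  Cell : Store → ℕ → ℕ → Set
  Cell s q b = s 20 (+ (q * W + b)) ≡ G q b

  Filled : ℕ → Store → Set
  Filled q s = ∀ q′ b → q′ ≤ q → b ≤ β → Cell s q′ b

  module Row (q : ℕ) (s₁ : Store) (hW : s₁ 17 0ℤ ≡ + W) (hr : s₁ 29 0ℤ ≡ isRental q)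
    (hshift : s₁ 30 0ℤ ≡ + shift q) (hlate : s₁ 32 0ℤ ≡ + R (suc q) ℤ.- d q)
    (hptr : s₁ 21 0ℤ ≡ + (suc q * W)) (filled : Filled q s₁) where

    Partial : ℕ → Store → Set
    Partial b s = s 21 0ℤ ≡ + (suc q * W + b) × Filled q s × (∀ b′ → b′ < b → Cell s (suc q) b′)

    module _ (b : ℕ) (b≤β : b ≤ β) (s : Store) (hb : s 14 0ℤ ≡ + b)
             (same : ∀ a → writes a (forLoop 14 17 cellBody) ≡ false → s a 0ℤ ≡ s₁ a 0ℤ)
             (partial : Partial b s) where

      private
        ptr = proj₁ partial
        sW  = trans (same 17 refl) hW
        sr  = trans (same 29 refl) hr
        se  = trans (same 30 refl) hshift
        sl  : s 32 0ℤ ℤ.+ s 14 0ℤ ≡ late q b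
        sl  = cong₂ ℤ._+_ (trans (same 32 refl) hlate) hb

        above : s 21 0ℤ ℤ.- s 17 0ℤ ≡ + (q * W + b)
        above = trans (cong₂ ℤ._-_ ptr sW) (rearrange (+ W) (+ (q * W)) (+ b))
          where
          rearrange : ∀ w x b → w ℤ.+ x ℤ.+ b ℤ.- w ≡ x ℤ.+ b
          rearrange = solve-∀

        above-left : shift q ≤ b → s 21 0ℤ ℤ.- s 17 0ℤ ℤ.- s 30 0ℤ ≡ + (q * W + (b ∸ shift q))
        above-left le = trans (cong₂ ℤ._-_ above se) (trans (rearrange (+ (q * W)) (+ b) (+ shift q))
          (cong (λ z → + (q * W) ℤ.+ z) (∸-pos le)))
          where
          rearrange : ∀ x b e → x ℤ.+ b ℤ.- e ≡ x ℤ.+ (b ℤ.- e)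
          rearrange = solve-∀

      Value : Store → Set
      Value s = s 34 0ℤ ≡ G (suc q) b

      maximise-correct : ∀ s′ → s′ 32 0ℤ ℤ.+ s′ 14 0ℤ ≡ late q b → ∀ {g} → s′ 35 0ℤ ≡ g →
        Run maximise s′ (λ s″ → s″ 35 0ℤ ≡ g ℤ.⊔ late q b) (cost maximise)
      maximise-correct s′ hl {g} refl = straight maximise
        ( (λ le → trans hl (sym (ℤ.i≤j⇒i⊔j≡j (subst (g ℤ.≤_) hl le))))
        , (λ ≰ → sym (ℤ.i≥j⇒i⊔j≡i (ℤ.<⇒≤ (subst (ℤ._< g) hl (ℤ.≰⇒> ≰))))))

      choose-correct : shift q ≤ b → ∀ s′ → s′ 29 0ℤ ≡ isRental q → s′ 34 0ℤ ≡ G q b →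
        s′ 35 0ℤ ≡ G q (b ∸ shift q) ℤ.⊔ late q b → Run choose s′ Value (cost choose)
      choose-correct e≤b s′ hr′ hv hu = straight choose
        ( (λ 1≤ → trans hu (forced (indicator-true (r q) hr′ 1≤)))
        , (λ 1≰ → (λ le → trans hu (trans
                      (sym (ℤ.i≥j⇒i⊓j≡j (subst₂ ℤ._≤_ hu hv le))) (free (indicator-false (r q) hr′ 1≰))))
                , (λ ≰ → trans hv (trans
                      (sym (ℤ.i≤j⇒i⊓j≡i (ℤ.<⇒≤ (subst₂ ℤ._<_ hv hu (ℤ.≰⇒> ≰))))) (free (indicator-false (r q) hr′ 1≰))))))
        where
        forced : r q ≡ true → G q (b ∸ shift q) ℤ.⊔ late q b ≡ G (suc q) b
        forced rq = trans (cong (λ z → G q (b ∸ (if z then 0 else p q)) ℤ.⊔ late q b) rq) (sym (G-rental q b rq))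
        free : r q ≡ false → G q b ℤ.⊓ (G q (b ∸ shift q) ℤ.⊔ late q b) ≡ G (suc q) b
        free rq = trans (cong (λ z → G q b ℤ.⊓ (G q (b ∸ (if z then 0 else p q)) ℤ.⊔ late q b)) rq)
          (sym (G-fits q b rq (subst (λ z → (if z then 0 else p q) ≤ b) rq e≤b)))

      candidate-correct : shift q ≤ b → ∀ s′ → Unchanged (34 := 20 [ var 21 ⊖ var 17 ]) s s′ → s′ 34 0ℤ ≡ G q b →
        Run candidate s′ Value (cost candidate)
      candidate-correct e≤b s′ u hv = run-seq
        (straight (35 := 20 [ (var 21 ⊖ var 17) ⊖ var 30 ]) {s = s′} {Q = λ s″ → s″ 35 0ℤ ≡ G q (b ∸ shift q)} (trans (u 20 refl _)
          (trans (cong (s 20) (trans (cong₂ ℤ._-_ (cong₂ ℤ._-_ (u 21 refl _) (u 17 refl _)) (u 30 refl _)) (above-left e≤b)))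
                 (proj₁ (proj₂ partial) q (b ∸ shift q) ≤-refl (≤-trans (m∸n≤m b (shift q)) b≤β)))))
        λ s₂ u₂ h₂ → run-seq
          (maximise-correct s₂ (trans (cong₂ ℤ._+_ (trans (u₂ 32 refl _) (u 32 refl _)) (trans (u₂ 14 refl _) (u 14 refl _))) sl) h₂)
        λ s₃ u₃ h₃ → choose-correct e≤b s₃ (trans (u₃ 29 refl _) (trans (u₂ 29 refl _) (trans (u 29 refl _) sr)))
          (trans (u₃ 34 refl _) (trans (u₂ 34 refl _) hv)) h₃

      cellValue-correct : Run cellValue s Value (cost cellValue)
      cellValue-correct = run-seq
        (straight (34 := 20 [ var 21 ⊖ var 17 ]) {s = s} {Q = λ s′ → s′ 34 0ℤ ≡ G q b}
          (trans (cong (s 20) above) (proj₁ (proj₂ partial) q b ≤-refl b≤β)))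
        λ s′ u hv → run-≤ (≤ᵇ⇒≤ _ _ _) (run-if
          (λ le → candidate-correct (ℤ.drop‿+≤+ (subst₂ ℤ._≤_ (trans (u 30 refl _) se) (trans (u 14 refl _) hb) le)) s′ u hv)
          (λ ≰ → run-≤ (≤ᵇ⇒≤ _ _ _) (straight skip (trans hv (skipped λ le →
             ≰ (subst₂ ℤ._≤_ (sym (trans (u 30 refl _) se)) (sym (trans (u 14 refl _) hb)) (+≤+ le)))))))
        where
        -- Only a non-r-job can fail to fit, as the shift of an r-job is 0; then the recursion
        -- copies the cell above.
        skipped : ¬ shift q ≤ b → G q b ≡ G (suc q) b
        skipped ≰ with split (r q)
        ... | inj₁ rq = ⊥-elim (≰ (subst (λ z → (if z then 0 else p q) ≤ b) (sym rq) z≤n))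
        ... | inj₂ rq = sym (G-tight q b rq λ le → ≰ (subst (λ z → (if z then 0 else p q) ≤ b) (sym rq) le))

      -- Since b′ < W, addresses are ordered lexicographically by row and column; a new cell
      -- therefore never overwrites an earlier row.
      earlier-row : ∀ {q′ b′} → q′ ≤ q → b′ ≤ β → q′ * W + b′ < suc q * W + b
      earlier-row {q′} {b′} q′≤q b′≤β = begin-strict
        q′ * W + b′ <⟨ +-monoʳ-< (q′ * W) (s≤s b′≤β) ⟩
        q′ * W + W  ≡⟨ +-comm (q′ * W) W ⟩
        suc q′ * W  ≤⟨ *-monoˡ-≤ W (s≤s q′≤q) ⟩
        suc q * W   ≤⟨ m≤m+n _ b ⟩
        suc q * W + b ∎
        where open ≤-Reasoning

      cell-correct : Run cellBody s (Partial (suc b)) (cost cellBody)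
      cell-correct = run-seq cellValue-correct λ s′ u hv →
        let ptr′ = trans (u 21 refl 0ℤ) ptr
            keep : ∀ q′ b′ → q′ * W + b′ < suc q * W + b → Cell s q′ b′ →
                   (s′ [ 20 , s′ 21 0ℤ ↦ s′ 34 0ℤ ]) 20 (+ (q′ * W + b′)) ≡ G q′ b′
            keep q′ b′ lt c = trans (if-≢ λ eq → <⇒≢ lt (ℤ.+-injective (trans (sym eq) ptr′))) (trans (u 20 refl _) c)
        in straight ((20 [ var 21 ]≔ var 34) ⨾ (21 := var 21 ⊕ lit 1ℤ))
          ( trans (cong (ℤ._+ 1ℤ) ptr′) (cong +_ (trans (+-assoc (suc q * W) b 1) (cong (λ z → suc q * W + z) (+-comm b 1))))
          , (λ q′ b′ q′≤q b′≤β → keep q′ b′ (earlier-row q′≤q b′≤β) (proj₁ (proj₂ partial) q′ b′ q′≤q b′≤β))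
          , λ b′ b′<1+b → new s′ ptr′ hv keep b′ b′<1+b (b′ ≟ b))
        where
        new : ∀ s′ → s′ 21 0ℤ ≡ + (suc q * W + b) → Value s′ →
              (∀ q′ b′ → q′ * W + b′ < suc q * W + b → Cell s q′ b′ →
                (s′ [ 20 , s′ 21 0ℤ ↦ s′ 34 0ℤ ]) 20 (+ (q′ * W + b′)) ≡ G q′ b′) →
              ∀ b′ → b′ < suc b → Dec (b′ ≡ b) →
              (s′ [ 20 , s′ 21 0ℤ ↦ s′ 34 0ℤ ]) 20 (+ (suc q * W + b′)) ≡ G (suc q) b′
        new s′ ptr′ hv keep b′ b′<1+b (yes refl) = trans (if-≡ ptr′) hv
        new s′ ptr′ hv keep b′ b′<1+b (no b′≢b)  = keep (suc q) b′ (+-monoʳ-< (suc q * W) b′<b) (proj₂ (proj₂ partial) b′ b′<b)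
          where b′<b = ≤∧≢⇒< (s≤s⁻¹ b′<1+b) b′≢b

    row-correct : Run (forLoop 14 17 cellBody) s₁
      (λ s → s 21 0ℤ ≡ + (suc (suc q) * W) × Filled (suc q) s) (W * (23 + cost cellBody))
    row-correct = run-map (λ s (ptr , filled , new) →
        trans ptr (cong +_ (+-comm (suc q * W) W)) , λ q′ b q′≤1+q b≤β → extend s filled new q′ b q′≤1+q b≤β (q′ ≟ suc q))
      (run-for 14 17 cellBody W Partial (cost cellBody) s₁ hW refl refl (λ _ _ _ x → x)
        (trans hptr (cong +_ (sym (+-identityʳ (suc q * W)))) , filled , λ _ ()) (s≤s z≤n)
        λ b s b<W hb u partial → cell-correct b (s≤s⁻¹ b<W) s hb (λ a w → u a w 0ℤ) partial)
      where
      extend : ∀ s → Filled q s → (∀ b → b < W → Cell s (suc q) b) →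
               ∀ q′ b → q′ ≤ suc q → b ≤ β → Dec (q′ ≡ suc q) → Cell s q′ b
      extend s filled new q′ b q′≤ b≤β (yes refl) = new b (s≤s b≤β)
      extend s filled new q′ b q′≤ b≤β (no q′≢)   = filled q′ b (s≤s⁻¹ (≤∧≢⇒< q′≤ q′≢)) b≤β

  module Filling (1≤n : 1 ≤ n) (s₀ : Store) (hn : s₀ 0 0ℤ ≡ + n)
    (hp : ∀ q → q < n → s₀ 2 (s₀ 6 (+ q)) ≡ + p q) (hd : ∀ q → q < n → s₀ 3 (s₀ 6 (+ q)) ≡ d q)
    (hr : ∀ q → q < n → s₀ 4 (s₀ 6 (+ q)) ≡ isRental q) (hR : s₀ 8 0ℤ ≡ + R n)
    (hW : s₀ 17 0ℤ ≡ + W) (hβ : s₀ 18 0ℤ ≡ + β) (hfloor : s₀ 19 0ℤ ≡ floor) where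

    Chosen : ℕ → Store → Set
    Chosen q s = ∃ λ k → s 25 0ℤ ≡ + k × Best q (s 24 0ℤ) k

    Copied : ℕ → Store → Set
    Copied q s = ∀ q′ → q′ < q → s 11 (+ q′) ≡ s₀ 6 (+ q′)

    Inv : ℕ → Store → Set
    Inv q s = s 21 0ℤ ≡ + (suc q * W) × s 22 0ℤ ≡ + R q × s 23 0ℤ ≡ + N q × Filled q s × Chosen q s × Copied q s

    module Step (q : ℕ) (q<n : q < n) (s : Store) (hq : s 13 0ℤ ≡ + q)
      (same : Unchanged dp s₀ s) (inv : Inv q s) where

      Loaded : Store → Set
      Loaded s′ = s′ 27 0ℤ ≡ + p q × s′ 28 0ℤ ≡ d q × s′ 29 0ℤ ≡ isRental q × Copied (suc q) s′

      load-correct : Run loadJob s Loaded (cost loadJob)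
      load-correct = straight loadJob
        ( trans (cong (s 2) s6) (trans (same 2 refl _) (hp q q<n))
        , trans (cong (s 3) s6) (trans (same 3 refl _) (hd q q<n))
        , trans (cong (s 4) s6) (trans (same 4 refl _) (hr q q<n))
        , λ q′ q′<1+q → copied q′ q′<1+q (q′ ≟ q))
        where
        s6 : s 6 (s 13 0ℤ) ≡ s₀ 6 (+ q)
        s6 = trans (cong (s 6) hq) (same 6 refl _)
        copied : ∀ q′ → q′ < suc q → Dec (q′ ≡ q) →
                 (s [ 11 , s 13 0ℤ ↦ s 6 (s 13 0ℤ) ]) 11 (+ q′) ≡ s₀ 6 (+ q′)
        copied q′ q′<1+q (yes refl) = trans (if-≡ hq) s6
        copied q′ q′<1+q (no q′≢q)  = trans (if-≢ λ eq → q′≢q (ℤ.+-injective (trans (sym eq) hq)))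
          (proj₂ (proj₂ (proj₂ (proj₂ (proj₂ inv)))) q′ (≤∧≢⇒< (s≤s⁻¹ q′<1+q) q′≢q))

      Accounted : Store → Set
      Accounted s′ = s′ 22 0ℤ ≡ + R (suc q) × s′ 23 0ℤ ≡ + N (suc q) × s′ 30 0ℤ ≡ + shift q ×
                     Extended q (s 24 0ℤ) (s′ 24 0ℤ)

      account-correct : ∀ s′ → Unchanged loadJob s s′ → Loaded s′ → Run account s′ Accounted (cost account)
      account-correct s′ u (hp′ , hd′ , hr′ , _) = straight account
        ( (λ 1≤ → let rq = indicator-true (r q) hr′ 1≤ in
             trans (cong₂ ℤ._+_ h22 hp′) (cong +_ (sym (load-take (ι ∘ r) (cong ι rq))))
           , trans h23 (cong +_ (sym (load-skip (ι ∘ not ∘ r) (cong (ι ∘ not) rq))))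
           , cong (λ z → + (if z then 0 else p q)) (sym rq)
           , inj₁ (rq , u 24 refl 0ℤ))
        , (λ 1≰ → let rq  = indicator-false (r q) hr′ 1≰
                      hN  = trans (cong₂ ℤ._+_ h23 hp′) (cong +_ (sym (load-take (ι ∘ not ∘ r) (cong (ι ∘ not) rq))))
                      hR′ = trans h22 (cong +_ (sym (load-skip (ι ∘ r) (cong ι rq))))
                      he  = trans hp′ (cong (λ z → + (if z then 0 else p q)) (sym rq))
                      ht  = cong₂ ℤ._-_ (cong₂ ℤ._+_ (trans (u 8 refl 0ℤ) (trans (same 8 refl 0ℤ) hR)) hN) hd′
                      h24 = u 24 refl 0ℤ
                  in (λ le → hR′ , hN , he , inj₂ (rq , trans ht (sym (ℤ.i≤j⇒i⊔j≡j (subst₂ ℤ._≤_ h24 ht le)))))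
                   , (λ ≰ → hR′ , hN , he , inj₂ (rq , trans h24 (sym (ℤ.i≥j⇒i⊔j≡i (ℤ.<⇒≤ (subst₂ ℤ._<_ ht h24 (ℤ.≰⇒> ≰)))))))))
        where
        h22 = trans (u 22 refl 0ℤ) (proj₁ (proj₂ inv))
        h23 = trans (u 23 refl 0ℤ) (proj₁ (proj₂ (proj₂ inv)))

      record-correct : ∀ s′ → s′ 13 0ℤ ≡ + q → s′ 18 0ℤ ≡ + β → s′ 21 0ℤ ≡ + (suc (suc q) * W) →
        s′ 22 0ℤ ≡ + R (suc q) → s′ 23 0ℤ ≡ + N (suc q) →
        Filled (suc q) s′ → Extended q (s 24 0ℤ) (s′ 24 0ℤ) → s′ 25 0ℤ ≡ s 25 0ℤ → Copied (suc q) s′ →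
        Chosen q s → Run record-cut s′ (Inv (suc q)) (cost record-cut)
      record-correct s′ hq′ hβ′ hptr hR′ hN filled extended h25 copied (k , hk , best) = straight record-cut
        ( (λ le → hptr , hR′ , hN , filled , (suc q , trans (cong (ℤ._+ 1ℤ) hq′) (cong +_ (+-comm q 1)) ,
             subst (λ z → Best (suc q) z (suc q)) (sym hcut) (best-new best extended (subst (ℤ._≤ _) hcut le))) , copied)
        , (λ ≰ → hptr , hR′ , hN , filled , (k , trans h25 hk ,
             best-keep best extended (λ le → ≰ (subst (ℤ._≤ _) (sym hcut) le))) , copied))
        where
        last : s′ 21 0ℤ ℤ.- 1ℤ ≡ + (suc q * W + β)
        last = trans (cong (ℤ._- 1ℤ) hptr) (trans (∸-pos {suc (suc q) * W} {1} (s≤s z≤n)) (cong +_ (+-comm β (suc q * W))))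
        hcut : s′ 20 (s′ 21 0ℤ ℤ.- 1ℤ) ℤ.+ s′ 23 0ℤ ℤ.- s′ 18 0ℤ ≡ cut (suc q)
        hcut = cong₂ ℤ._-_ (cong₂ ℤ._+_ (trans (cong (s′ 20) last) (filled (suc q) β ≤-refl ≤-refl)) hN) hβ′

      Prepared : Store → Set
      Prepared s′ = Accounted s′ × s′ 29 0ℤ ≡ isRental q × Copied (suc q) s′ × s′ 32 0ℤ ≡ + R (suc q) ℤ.- d q

      prepare-correct : Run prepare s Prepared (cost prepare)
      prepare-correct = run-seq load-correct λ s₁ u₁ loaded → run-seq (account-correct s₁ u₁ loaded) λ s₂ u₂ accounted →
        straight (32 := var 22 ⊖ var 28)
          ( accounted
          , trans (u₂ 29 refl _) (proj₁ (proj₂ (proj₂ loaded)))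
          , (λ q′ lt → trans (u₂ 11 refl _) (proj₂ (proj₂ (proj₂ loaded)) q′ lt))
          , cong₂ ℤ._-_ (proj₁ accounted) (trans (u₂ 28 refl _) (proj₁ (proj₂ loaded))) )

      rowBody-correct : Run rowBody s (Inv (suc q)) (cost prepare + (W * (23 + cost cellBody) + cost record-cut))
      rowBody-correct = run-seq prepare-correct λ s₁ u₁ ((hR′ , hN , he , extended) , hr′ , copied , hl) → run-seq
        (Row.row-correct q s₁ (trans (u₁ 17 refl _) (trans (same 17 refl _) hW)) hr′ he hl
          (trans (u₁ 21 refl _) (proj₁ inv))
          (λ q′ b q′≤ b≤ → trans (u₁ 20 refl _) (proj₁ (proj₂ (proj₂ (proj₂ inv))) q′ b q′≤ b≤)))
        λ s₂ u₂ (hptr , filled) → record-correct s₂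
          (trans (u₂ 13 refl _) (trans (u₁ 13 refl _) hq))
          (trans (u₂ 18 refl _) (trans (u₁ 18 refl _) (trans (same 18 refl _) hβ)))
          hptr (trans (u₂ 22 refl _) hR′) (trans (u₂ 23 refl _) hN) filled
          (subst (Extended q (s 24 0ℤ)) (sym (u₂ 24 refl _)) extended)
          (trans (u₂ 25 refl _) (u₁ 25 refl _))
          (λ q′ lt → trans (u₂ 11 refl _) (copied q′ lt))
          (proj₁ (proj₂ (proj₂ (proj₂ (proj₂ inv)))))

    dp-correct : Run dp s₀ (Inv n) (W * (23 + 5) + (cost dpInit + n * (23 + (cost prepare + (W * (23 + cost cellBody) + cost record-cut)))))
    dp-correct = run-seq
      (run-for 14 17 (20 [ var 14 ]≔ var 19) W (λ b s → ∀ b′ → b′ < b → s 20 (+ b′) ≡ floor) 5 s₀ hW refl refl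
        (λ _ _ _ x → x) (λ _ ()) (s≤s z≤n)
        λ b s b<W hb u row → straight (20 [ var 14 ]≔ var 19)
          λ b′ b′<1+b → fill s hb (trans (u 19 refl _) hfloor) row b′ b′<1+b (b′ ≟ b))
      λ s₁ u₁ row → run-seq
        (straight dpInit {s = s₁} {Q = Inv 0}
          ( trans (u₁ 17 refl _) (trans hW (cong +_ (sym (+-identityʳ W))))
          , refl , refl
          , (λ { zero b z≤n b≤β → row b (s≤s b≤β) })
          , (0 , refl , subst (λ z → Best 0 z 0) (sym (cong₂ ℤ._-_ (cong (ℤ._+ 0ℤ) (trans (u₁ 19 refl _) hfloor)) (trans (u₁ 18 refl _) hβ))) best-init)
          , λ _ ()))
      λ s₂ u₂ inv → run-for 13 0 rowBody n Inv _ s₂ (trans (u₂ 0 refl _) (trans (u₁ 0 refl _) hn)) refl refl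
        (λ _ _ _ x → x) inv 1≤n
        λ q s q<n hq u inv → Step.rowBody-correct q q<n s hq
          (unchanged-⨾ dpBase (dpInit ⨾ forLoop 13 0 rowBody) u₁ (unchanged-⨾ dpInit (forLoop 13 0 rowBody) u₂ u)) inv
      where
      fill : ∀ s {b} → s 14 0ℤ ≡ + b → s 19 0ℤ ≡ floor → (∀ b′ → b′ < b → s 20 (+ b′) ≡ floor) →
             ∀ b′ → b′ < suc b → Dec (b′ ≡ b) → (s [ 20 , s 14 0ℤ ↦ s 19 0ℤ ]) 20 (+ b′) ≡ floor
      fill s hb h19 row b′ b′<1+b (yes refl) = trans (if-≡ hb) h19
      fill s hb h19 row b′ b′<1+b (no b′≢b) = trans (if-≢ λ eq → b′≢b (ℤ.+-injective (trans (sym eq) hb)))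
        (row b′ (≤∧≢⇒< (s≤s⁻¹ b′<1+b) b′≢b))

-- Backtracking

-- No decisions are stored with the table. For a non-r-job i below the cut, if `G i b` is at most
-- `G (suc i) b`, then leaving i out attains the value; otherwise only taking i as a filler can. The
-- table leaves the pointer one row beyond the last, which `backInit` corrects.
stepBack classify backBody backInit back : Prog
stepBack = (37 := var 37 ⊖ lit 1ℤ) ⨾ (21 := var 21 ⊖ var 17)
classify =
  if lit 1ℤ ≼ (4 [ 6 [ var 37 ] ])
  th (10 [ var 37 ]≔ lit 1ℤ)
  el (if var 25 ≼ var 37
      th (10 [ var 37 ]≔ lit (+ 2))
      el (if (20 [ var 21 ⊕ var 36 ]) ≼ (20 [ (var 21 ⊕ var 17) ⊕ var 36 ])
          th (10 [ var 37 ]≔ lit 0ℤ)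
          el ((10 [ var 37 ]≔ lit 1ℤ) ⨾ (36 := var 36 ⊖ (2 [ 6 [ var 37 ] ])))))
backBody = stepBack ⨾ classify
backInit = (36 := var 18) ⨾ (37 := var 0) ⨾ (21 := var 21 ⊖ var 17)
back     = backInit ⨾ forLoop 13 0 backBody

module Backtrack (n : ℕ) (p : ℕ → ℕ) (d : ℕ → ℤ) (r : ℕ → Bool) (dmin : ℤ) (β : ℕ) (1≤n : 1 ≤ n) where

  open Renting n p d r dmin β
  open Table n p d r dmin β

  module _ (s₀ : Store) (hn : s₀ 0 0ℤ ≡ + n)
    (hp : ∀ q → q < n → s₀ 2 (s₀ 6 (+ q)) ≡ + p q) (hr : ∀ q → q < n → s₀ 4 (s₀ 6 (+ q)) ≡ isRental q)
    (hW : s₀ 17 0ℤ ≡ + W) (hβ : s₀ 18 0ℤ ≡ + β) (hptr : s₀ 21 0ℤ ≡ + (suc n * W)) (filled : Filled n s₀)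
    (k : ℕ) (k≤n : k ≤ n) (hk : s₀ 25 0ℤ ≡ + k) where

    θ : ℤ
    θ = G k β

    -- Allows the class function to be read off the integer store by absolute values.
    Natural : ℕ → Store → Set
    Natural i s = ∀ j → i ≤ j → j < n → s 10 (+ j) ≡ + ℤ.∣ s 10 (+ j) ∣

    -- The classes from i on are final: any completion below i gives a full plan.
    Completes : ℕ → ℕ → Store → Set
    Completes i b s = ∀ κ → (∀ j → i ≤ j → j < n → s 10 (+ j) ≡ + κ j) → Plan k θ κ i b → Plan k θ κ n β

    -- From k on no budget is spent, so the table value to be respected stays at row k; below k it
    -- follows the current row. The row index `i ⊓ k` covers both phases.
    At : ℕ → ℕ → Store → Set
    At i b s = s 37 0ℤ ≡ + i × s 21 0ℤ ≡ + (i * W) × s 36 0ℤ ≡ + b × b ≤ β × G (i ⊓ k) b ℤ.≤ θ ×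
               Natural i s × Completes i b s

    Inv : ℕ → Store → Set
    Inv m s = ∃ λ i → i + m ≡ n × ∃ λ b → At i b s

    module Step (i b : ℕ) (i<n : i < n) (s : Store) (same : Unchanged back s₀ s) (b≤β : b ≤ β)
      (G≤θ : G (suc i ⊓ k) b ℤ.≤ θ) (natural : Natural (suc i) s) (completes : Completes (suc i) b s)
      (hi : s 37 0ℤ ≡ + i) (hrow : s 21 0ℤ ≡ + (i * W)) (hb : s 36 0ℤ ≡ + b) where

      h6 : s 6 (s 37 0ℤ) ≡ s₀ 6 (+ i)
      h6 = trans (cong (s 6) hi) (same 6 refl _)
      hr′ : s 4 (s 6 (s 37 0ℤ)) ≡ isRental i
      hr′ = trans (cong (s 4) h6) (trans (same 4 refl _) (hr i i<n))
      hp′ : s 2 (s 6 (s 37 0ℤ)) ≡ + p i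
      hp′ = trans (cong (s 2) h6) (trans (same 2 refl _) (hp i i<n))
      hk′ : s 25 0ℤ ≡ + k
      hk′ = trans (same 25 refl _) hk
      hG : s 20 (s 21 0ℤ ℤ.+ s 36 0ℤ) ≡ G i b
      hG = trans (cong (s 20) (cong₂ ℤ._+_ hrow hb)) (trans (same 20 refl _) (filled i b (<⇒≤ i<n) b≤β))
      hG′ : s 20 (s 21 0ℤ ℤ.+ s 17 0ℤ ℤ.+ s 36 0ℤ) ≡ G (suc i) b
      hG′ = trans (cong (s 20) (trans (cong₂ ℤ._+_ (cong₂ ℤ._+_ hrow (trans (same 17 refl _) hW)) hb)
                  (cong (λ z → + (z + b)) (+-comm (i * W) W))))
                  (trans (same 20 refl _) (filled (suc i) b i<n b≤β))

      finish : ∀ c b′ s′ → s′ 37 0ℤ ≡ s 37 0ℤ → s′ 21 0ℤ ≡ s 21 0ℤ → s′ 36 0ℤ ≡ + b′ →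
               (∀ j → s′ 10 j ≡ (s [ 10 , s 37 0ℤ ↦ + c ]) 10 j) → b′ ≤ β → G (i ⊓ k) b′ ℤ.≤ θ →
               (∀ κ → κ i ≡ c → Plan k θ κ i b′ → Plan k θ κ (suc i) b) → At i b′ s′
      finish c b′ s′ e37 e21 e36 e10 b′≤β G≤θ′ extend =
        trans e37 hi , trans e21 hrow , e36 , b′≤β , G≤θ′ ,
        (λ j i≤j j<n → nat j i≤j j<n (j ≟ i)) ,
        λ κ agree plan → completes κ
          (λ j i<j j<n → trans (sym (trans (e10 _) (if-≢ λ eq → <⇒≢ i<j (ℤ.+-injective (trans (sym hi) eq)))))
                                (agree j (<⇒≤ i<j) j<n))
          (extend κ (ℤ.+-injective (trans (sym (agree i ≤-refl i<n)) (trans (e10 _) (if-≡ hi)))) plan)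
        where
        nat : ∀ j → i ≤ j → j < n → Dec (j ≡ i) → s′ 10 (+ j) ≡ + ℤ.∣ s′ 10 (+ j) ∣
        nat j i≤j j<n (yes refl) = trans eq (cong (λ z → + ℤ.∣ z ∣) (sym eq))
          where eq = trans (e10 _) (if-≡ hi)
        nat j i≤j j<n (no j≢i) = trans eq (trans (natural j (≤∧≢⇒< i≤j (j≢i ∘ sym)) j<n) (cong (λ z → + ℤ.∣ z ∣) (sym eq)))
          where eq = trans (e10 _) (if-≢ λ e → j≢i (ℤ.+-injective (trans (sym e) hi)))

      outer : k ≤ i → G (i ⊓ k) b ℤ.≤ θ
      outer k≤i = subst (λ z → G z b ℤ.≤ θ) (trans (m≥n⇒m⊓n≡n (m≤n⇒m≤1+n k≤i)) (sym (m≥n⇒m⊓n≡n k≤i))) G≤θ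

      inner : i < k → G (suc i) b ℤ.≤ θ
      inner i<k = subst (λ z → G z b ℤ.≤ θ) (m≤n⇒m⊓n≡m i<k) G≤θ

      inner′ : ∀ {b′} → i < k → G i b′ ℤ.≤ θ → G (i ⊓ k) b′ ℤ.≤ θ
      inner′ {b′} i<k = subst (λ z → G z b′ ℤ.≤ θ) (sym (m≤n⇒m⊓n≡m (<⇒≤ i<k)))

      classify-correct : Run classify s (λ s′ → ∃ λ b′ → At i b′ s′) (cost classify)
      classify-correct = straight classify
        ( (λ 1≤ → b , onRental (indicator-true (r i) hr′ 1≤))
        , (λ 1≰ → let ri = indicator-false (r i) hr′ 1≰ in
            (λ k≤ → let k≤i = ℤ.drop‿+≤+ (subst₂ ℤ._≤_ hk′ hi k≤) in
                b , finish 2 b (s [ 10 , s 37 0ℤ ↦ + 2 ]) refl refl hb (λ _ → refl) b≤β (outer k≤i) λ κ κi plan → after ri k≤i κi plan)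
          , (λ k≰ → let i<k = ≰⇒> (λ k≤i → k≰ (subst₂ ℤ._≤_ (sym hk′) (sym hi) (+≤+ k≤i))) in
              (λ le → b , finish 0 b (s [ 10 , s 37 0ℤ ↦ + 0 ]) refl refl hb (λ _ → refl) b≤β
                        (inner′ i<k (ℤ.≤-trans (subst₂ ℤ._≤_ hG hG′ le) (inner i<k)))
                        λ κ κi plan → before ri i<k κi plan)
            , (λ ≰ → onWithin ri i<k (λ le → ≰ (subst₂ ℤ._≤_ (sym hG) (sym hG′) le))))))
        where
        onRental : r i ≡ true → At i b (s [ 10 , s 37 0ℤ ↦ + 1 ])
        onRental ri with i <? k
        ... | yes i<k = finish 1 b (s [ 10 , s 37 0ℤ ↦ + 1 ]) refl refl hb (λ _ → refl) b≤β
                (inner′ i<k (ℤ.≤-trans (ℤ.i≤i⊔j _ _) le)) (λ κ κi plan → rental ri κi (λ _ → ℤ.≤-trans (ℤ.i≤j⊔i _ _) le) plan)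
          where le = subst (ℤ._≤ θ) (G-rental i b ri) (inner i<k)
        ... | no i≮k = finish 1 b (s [ 10 , s 37 0ℤ ↦ + 1 ]) refl refl hb (λ _ → refl) b≤β
                (outer (≮⇒≥ i≮k)) (λ κ κi plan → rental ri κi (λ i<k → ⊥-elim (i≮k i<k)) plan)
        Next : Store
        Next = (s [ 10 , s 37 0ℤ ↦ + 1 ]) [ 36 , 0ℤ ↦ s 36 0ℤ ℤ.- s 2 (s 6 (s 37 0ℤ)) ]
        -- The failed test excludes `p i` > b, where both rows agree, and also excludes `G i b` as
        -- the selected side of the minimum. Hence the other side is at most θ.
        onWithin : r i ≡ false → i < k → ¬ G i b ℤ.≤ G (suc i) b → ∃ λ b′ → At i b′ Next
        onWithin ri i<k G≰ with p i ≤? b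
        ... | no p≰b = ⊥-elim (G≰ (ℤ.≤-reflexive (sym (G-tight i b ri p≰b))))
        ... | yes p≤b = b ∸ p i , finish 1 (b ∸ p i) Next refl refl (trans (cong₂ ℤ._-_ hb hp′) (∸-pos p≤b)) (λ _ → refl)
                (≤-trans (m∸n≤m b (p i)) b≤β) (inner′ i<k (ℤ.≤-trans (ℤ.i≤i⊔j _ _) le))
                λ κ κi plan → within ri i<k κi (ℤ.≤-trans (ℤ.i≤j⊔i _ _) le) p≤b plan
          where
          le : G i (b ∸ p i) ℤ.⊔ late i b ℤ.≤ θ
          le with ℤ.⊓-sel (G i b) (G i (b ∸ p i) ℤ.⊔ late i b)
          ... | inj₁ eq = ⊥-elim (G≰ (ℤ.≤-reflexive (sym (trans (G-fits i b ri p≤b) eq))))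
          ... | inj₂ eq = subst (ℤ._≤ θ) (trans (G-fits i b ri p≤b) eq) (inner i<k)

    body-correct : ∀ m s → m < n → Unchanged back s₀ s → Inv m s → Run backBody s (Inv (suc m)) (cost backBody)
    body-correct m s m<n same (zero , eq , _) = ⊥-elim (<⇒≢ m<n eq)
    body-correct m s m<n same (suc i , eq , b , hi , hrow , hb , b≤β , G≤θ , natural , completes) = run-map
      (λ s′ (b′ , at) → i , trans (+-suc i m) eq , b′ , at)
      (run-seq (straight stepBack {s = s} {Q = λ s′ → s′ 37 0ℤ ≡ + i × s′ 21 0ℤ ≡ + (i * W)}
        (trans (cong (ℤ._- 1ℤ) hi) (∸-pos {suc i} {1} (s≤s z≤n)) ,
         trans (cong₂ ℤ._-_ hrow (trans (same 17 refl _) hW)) (trans (∸-pos {suc i * W} {W} (m≤m+n W (i * W))) (cong +_ (m+n∸m≡n W (i * W))))))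
      λ s′ u (hi′ , hrow′) → Step.classify-correct i b (subst (i <_) eq (s≤s (m≤m+n i m))) s′
        (λ a w j → trans (u a (stepBack-same a w) j) (same a w j)) b≤β G≤θ
        (λ j i≤j j<n → trans (u 10 refl _) (trans (natural j i≤j j<n) (cong (λ z → + ℤ.∣ z ∣) (sym (u 10 refl _)))))
        (λ κ agree plan → completes κ (λ j i≤j j<n → trans (sym (u 10 refl _)) (agree j i≤j j<n)) plan)
        hi′ hrow′ (trans (u 36 refl _) hb))
      where
      stepBack-same : ∀ a → writes a back ≡ false → writes a stepBack ≡ false
      stepBack-same a w = proj₁ (∨-false (writes a stepBack) (proj₁ (∨-false (writes a backBody)
        (proj₂ (∨-false (writes a (13 := lit 0ℤ)) (proj₂ (∨-false (writes a backInit) w)))))))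

    Planned : Store → Set
    Planned s = Σ[ κ ∈ (ℕ → ℕ) ] (∀ j → j < n → s 10 (+ j) ≡ + κ j) × Plan k θ κ n β

    back-correct : Run back s₀ Planned (cost backInit + n * (23 + cost backBody))
    back-correct = run-map planned (run-seq
      (straight backInit {s = s₀} {Q = Inv 0} (n , +-identityʳ n , β , hn ,
        trans (cong₂ ℤ._-_ hptr hW) (trans (∸-pos {suc n * W} {W} (m≤m+n W (n * W))) (cong +_ (m+n∸m≡n W (n * W)))) ,
        hβ , ≤-refl , subst (λ z → G z β ℤ.≤ θ) (sym (m≥n⇒m⊓n≡n k≤n)) ℤ.≤-refl ,
        (λ j n≤j j<n → contradiction n≤j (<⇒≱ j<n)) , λ _ _ plan → plan))
      λ s₁ u₁ inv → run-for 13 0 backBody n Inv (cost backBody) s₁ (trans (u₁ 0 refl _) hn) refl refl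
        (λ _ _ _ x → x) inv 1≤n
        λ m s m<n _ u inv′ → body-correct m s m<n (unchanged-⨾ backInit (forLoop 13 0 backBody) u₁ u) inv′)
      where
      planned : ∀ s → Inv n s → Planned s
      planned s (suc i , eq , _) = contradiction (m≤n+m n i) (<⇒≱ (≤-reflexive eq))
      planned s (zero , _ , b , _ , _ , _ , _ , _ , natural , completes) =
        (λ j → ℤ.∣ s 10 (+ j) ∣) , (λ j j<n → natural j z≤n j<n) , completes _ (λ j _ j<n → natural j z≤n j<n) done

-- Sort keys

-- The sums start from the zeros that arrays 7 and 8 hold initially; a minimum has no such neutral
-- start and begins with the due date of job 0. `keyBody` stores the identity in array 11, so that
-- sorting lists job numbers.
totals minimise prepBody prep setup keyBody : Prog
totals   = (7 := var 7 ⊕ (2 [ var 14 ])) ⨾ (if lit 1ℤ ≼ (4 [ var 14 ]) th (8 := var 8 ⊕ (2 [ var 14 ])) el skip)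
minimise = if (3 [ var 14 ]) ≼ var 9 th (9 := 3 [ var 14 ]) el skip
prepBody = totals ⨾ minimise
prep     = (9 := 3 [ lit 0ℤ ]) ⨾ forLoop 14 0 prepBody
setup    = (18 := var 1 ⊖ var 8) ⨾ (if var 7 ≼ var 18 th (18 := var 7) el skip) ⨾
           (16 := var 7 ⊕ lit 1ℤ) ⨾ (17 := var 18 ⊕ lit 1ℤ) ⨾ (19 := (lit 0ℤ ⊖ var 9) ⊖ var 7)
keyBody  = (11 [ var 14 ]≔ var 14) ⨾ (10 [ var 14 ]≔ (3 [ var 14 ]) ⊖ var 9) ⨾
           (if var 7 ≼ (10 [ var 14 ]) th (10 [ var 14 ]≔ var 7) el skip)

module Preparation (n : ℕ) (p : ℕ → ℕ) (d : ℕ → ℤ) (r : ℕ → Bool) (1≤n : 1 ≤ n) where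

  module _ (s₀ : Store) (hn : s₀ 0 0ℤ ≡ + n) (h2 : ∀ j → j < n → s₀ 2 (+ j) ≡ + p j)
    (h3 : ∀ j → j < n → s₀ 3 (+ j) ≡ d j) (h4 : ∀ j → j < n → s₀ 4 (+ j) ≡ (if r j then 1ℤ else 0ℤ))
    (h7 : s₀ 7 0ℤ ≡ 0ℤ) (h8 : s₀ 8 0ℤ ≡ 0ℤ) where

    Totals : ℕ → Store → Set
    Totals i s = s 7 0ℤ ≡ + ∑ i p × s 8 0ℤ ≡ + ∑ i (λ j → ι (r j) * p j)

    Minimum : ℕ → Store → Set
    Minimum i s = (∀ j → j < i → s 9 0ℤ ℤ.≤ d j) × ∃ λ j → j < n × d j ≡ s 9 0ℤ

    totals-correct : ∀ i s → i < n → s 14 0ℤ ≡ + i → Unchanged prep s₀ s → Totals i s →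
                     Run totals s (Totals (suc i)) (cost totals)
    totals-correct i s i<n hi same (hP , hR) = straight totals
      ( (λ 1≤ → hP′ , trans (cong₂ ℤ._+_ hR hp) (cong +_ (with-r (indicator-true (r i) hr 1≤))))
      , (λ 1≰ → hP′ , trans hR (cong +_ (with-r′ (indicator-false (r i) hr 1≰)))))
      where
      hp : s 2 (s 14 0ℤ) ≡ + p i
      hp = trans (cong (s 2) hi) (trans (same 2 refl _) (h2 i i<n))
      hP′ = cong₂ ℤ._+_ hP hp
      hr : s 4 (s 14 0ℤ) ≡ (if r i then 1ℤ else 0ℤ)
      hr = trans (cong (s 4) hi) (trans (same 4 refl _) (h4 i i<n))
      with-r : r i ≡ true → ∑ i (λ j → ι (r j) * p j) + p i ≡ ∑ (suc i) (λ j → ι (r j) * p j)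
      with-r eq = cong (λ z → ∑ i (λ j → ι (r j) * p j) + z) (sym (trans (cong (λ b → ι b * p i) eq) (+-identityʳ (p i))))
      with-r′ : r i ≡ false → ∑ i (λ j → ι (r j) * p j) ≡ ∑ (suc i) (λ j → ι (r j) * p j)
      with-r′ eq = sym (trans (cong (λ b → ∑ i (λ j → ι (r j) * p j) + ι b * p i) eq) (+-identityʳ _))

    minimise-correct : ∀ i s → i < n → s 14 0ℤ ≡ + i → s 3 (s 14 0ℤ) ≡ d i → Minimum i s →
                       Run minimise s (Minimum (suc i)) (cost minimise)
    minimise-correct i s i<n hi hd (min≤ , j , j<n , dj) = straight minimise
      ( (λ le → (λ j j<1+i → new le j (j ≟ i) j<1+i) , i , i<n , sym hd)
      , (λ gt → (λ j j<1+i → old gt j (j ≟ i) j<1+i) , j , j<n , dj))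
      where
      new : s 3 (s 14 0ℤ) ℤ.≤ s 9 0ℤ → ∀ j → Dec (j ≡ i) → j < suc i → s 3 (s 14 0ℤ) ℤ.≤ d j
      new le j (yes refl) _   = ℤ.≤-reflexive hd
      new le j (no j≢i) j<1+i = ℤ.≤-trans le (min≤ j (≤∧≢⇒< (s≤s⁻¹ j<1+i) j≢i))
      old : ¬ s 3 (s 14 0ℤ) ℤ.≤ s 9 0ℤ → ∀ j → Dec (j ≡ i) → j < suc i → s 9 0ℤ ℤ.≤ d j
      old gt j (yes refl) _    = ℤ.≤-trans (ℤ.<⇒≤ (ℤ.≰⇒> gt)) (ℤ.≤-reflexive hd)
      old gt j (no j≢i) j<1+i  = min≤ j (≤∧≢⇒< (s≤s⁻¹ j<1+i) j≢i)

    prep-correct : Run prep s₀ (λ s → Totals n s × Minimum n s) (cost (9 := 3 [ lit 0ℤ ]) + n * (23 + cost prepBody))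
    prep-correct = run-seq
      (straight (9 := 3 [ lit 0ℤ ]) {s = s₀} {Q = λ s → Totals 0 s × Minimum 0 s}
        ((h7 , h8) , (λ _ ()) , 0 , 1≤n , sym (h3 0 1≤n)))
      λ s₁ u₁ inv → run-for 14 0 prepBody n (λ i s → Totals i s × Minimum i s) (cost prepBody) s₁
        (trans (u₁ 0 refl _) hn) refl refl (λ _ _ _ x → x) inv 1≤n
        λ i s i<n hi u (tot , min) → run-seq
          (totals-correct i s i<n hi (unchanged-⨾ (9 := 3 [ lit 0ℤ ]) (forLoop 14 0 prepBody) u₁ u) tot)
          λ s₂ u₂ tot′ →
            let hi′ = trans (u₂ 14 refl _) hi
                at  = trans (cong (s₂ 3) hi′) (trans (u₂ 3 refl _) (trans (u 3 refl _) (trans (u₁ 3 refl _) (h3 i i<n)))) in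
            (run-frame s₂ tot′ (minimise-correct i s₂ i<n hi′ at
              ( (λ j j<i → subst (ℤ._≤ d j) (sym (u₂ 9 refl _)) (proj₁ min j j<i))
              , proj₁ (proj₂ min) , proj₁ (proj₂ (proj₂ min)) , trans (proj₂ (proj₂ (proj₂ min))) (sym (u₂ 9 refl _)))))
      where
      run-frame : ∀ {i} s → Totals (suc i) s → Run minimise s (Minimum (suc i)) (cost minimise) →
                  Run minimise s (λ s′ → Totals (suc i) s′ × Minimum (suc i) s′) (cost minimise)
      run-frame s (hP , hR) (run e q t) = run e ((trans (unchanged e 7 refl _) hP , trans (unchanged e 8 refl _) hR) , q) t

  module _ (dmin : ℤ) (P : ℕ) (min≤ : ∀ j → j < n → dmin ℤ.≤ d j) where

    keyℤ : ℕ → ℤ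
    keyℤ j = (d j ℤ.- dmin) ℤ.⊓ + P

    key : ℕ → ℕ
    key j = ℤ.∣ keyℤ j ∣

    +key : ∀ j → j < n → + key j ≡ keyℤ j
    +key j j<n = ℤ.0≤i⇒+∣i∣≡i (ℤ.⊓-glb (ℤ.i≤j⇒0≤j-i (min≤ j j<n)) (+≤+ z≤n))

    key≤P : ∀ j → j < n → key j ≤ P
    key≤P j j<n = ℤ.drop‿+≤+ (subst (ℤ._≤ + P) (sym (+key j j<n)) (ℤ.i⊓j≤j (d j ℤ.- dmin) (+ P)))

    -- If the key of i is not capped, comparing keys compares due dates. If it is, the key of j is
    -- no smaller, so j has reached the cap as well.
    key-sorted : ∀ i j → i < n → j < n → key i ≤ key j → d i ℤ.≤ d j ⊎ dmin ℤ.+ + P ℤ.≤ d j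
    key-sorted i j i<n j<n le with ℤ.⊓-sel (d i ℤ.- dmin) (+ P) | subst₂ ℤ._≤_ (+key i i<n) (+key j j<n) (+≤+ le)
    ... | inj₁ eq | ≤ℤ = inj₁ (≤-diff (ℤ.≤-trans (subst (ℤ._≤ keyℤ j) eq ≤ℤ) (ℤ.i⊓j≤i _ _)) (rearrange (d i) (d j) dmin))
      where
      rearrange : ∀ x y m → y ℤ.- m ℤ.- (x ℤ.- m) ≡ y ℤ.- x
      rearrange = solve-∀
    ... | inj₂ eq | ≤ℤ = inj₂ (≤-diff (ℤ.≤-trans (subst (ℤ._≤ keyℤ j) eq ≤ℤ) (ℤ.i⊓j≤i _ _)) (rearrange (+ P) (d j) dmin))
      where
      rearrange : ∀ x y m → y ℤ.- m ℤ.- x ≡ y ℤ.- (m ℤ.+ x)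
      rearrange = solve-∀

    Keyed : ℕ → Store → Set
    Keyed i s = ∀ j → j < i → s 11 (+ j) ≡ + j × s 10 (+ j) ≡ + key j

    module _ (R κ : ℕ) (R≤κ : R ≤ κ)
      (s₀ : Store) (hn : s₀ 0 0ℤ ≡ + n) (hK : s₀ 1 0ℤ ≡ + κ) (h3 : ∀ j → j < n → s₀ 3 (+ j) ≡ d j)
      (h7 : s₀ 7 0ℤ ≡ + P) (h8 : s₀ 8 0ℤ ≡ + R) (h9 : s₀ 9 0ℤ ≡ dmin) where

      -- No filler load exceeds P, so capping the budget loses nothing and limits the table to P + 1
      -- columns.
      β : ℕ
      β = (κ ∸ R) ⊓ P

      Setup : Store → Set
      Setup s = s 18 0ℤ ≡ + β × s 16 0ℤ ≡ + suc P × s 17 0ℤ ≡ + suc β × s 19 0ℤ ≡ 0ℤ ℤ.- dmin ℤ.- + P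

      setup-correct : Run setup s₀ Setup (cost setup)
      setup-correct = straight setup
        ( (λ le → let β≡ = trans h7 (cong +_ (sym (m≥n⇒m⊓n≡n (ℤ.drop‿+≤+ (subst₂ ℤ._≤_ h7 hβ le))))) in
            β≡ , trans (cong (ℤ._+ 1ℤ) h7) (cong +_ (+-comm P 1)) , trans (cong (ℤ._+ 1ℤ) β≡) (cong +_ (+-comm β 1)) , hfloor)
        , (λ ≰ → let β≡ = trans hβ (cong +_ (sym (m≤n⇒m⊓n≡m (<⇒≤ (ℤ.drop‿+<+ (subst₂ ℤ._<_ hβ h7 (ℤ.≰⇒> ≰))))))) in
            β≡ , trans (cong (ℤ._+ 1ℤ) h7) (cong +_ (+-comm P 1)) , trans (cong (ℤ._+ 1ℤ) β≡) (cong +_ (+-comm β 1)) , hfloor))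
        where
        hβ : s₀ 1 0ℤ ℤ.- s₀ 8 0ℤ ≡ + (κ ∸ R)
        hβ = trans (cong₂ ℤ._-_ hK h8) (∸-pos R≤κ)
        hfloor : 0ℤ ℤ.- s₀ 9 0ℤ ℤ.- s₀ 7 0ℤ ≡ 0ℤ ℤ.- dmin ℤ.- + P
        hfloor = cong₂ (λ x y → 0ℤ ℤ.- x ℤ.- y) h9 h7

      keys-correct : ∀ s₁ → Unchanged setup s₀ s₁ → Run (forLoop 14 0 keyBody) s₁ (Keyed n) (n * (23 + cost keyBody))
      keys-correct s₁ u₁ = run-for 14 0 keyBody n Keyed (cost keyBody) s₁ (trans (u₁ 0 refl _) hn) refl refl
        (λ _ _ _ x → x) (λ _ ()) 1≤n λ i s i<n hi u keyed →
          step i s i<n hi keyed (trans (u 9 refl _) (trans (u₁ 9 refl _) h9)) (trans (u 7 refl _) (trans (u₁ 7 refl _) h7))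
            (trans (cong (s 3) hi) (trans (u 3 refl _) (trans (u₁ 3 refl _) (h3 i i<n))))
        where
        module _ (i : ℕ) (s : Store) (i<n : i < n) (hi : s 14 0ℤ ≡ + i) (keyed : Keyed i s) (h9′ : s 9 0ℤ ≡ dmin) (h7′ : s 7 0ℤ ≡ + P)
          (h3′ : s 3 (s 14 0ℤ) ≡ d i) where
          cell : ∀ (s′ : Store) → (∀ j → j < n → j ≢ i → s′ 10 (+ j) ≡ s 10 (+ j)) → s′ 10 (+ i) ≡ keyℤ i →
                 (∀ j → s′ 11 j ≡ (s [ 11 , s 14 0ℤ ↦ s 14 0ℤ ]) 11 j) → Keyed (suc i) s′
          cell s′ e10 eq e11 j j<1+i with j ≟ i
          ... | yes refl = trans (e11 _) (trans (if-≡ hi) hi) , trans eq (sym (+key i i<n))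
          ... | no  j≢i  = trans (e11 _) (trans (if-≢ λ e → j≢i (ℤ.+-injective (trans (sym e) hi))) (proj₁ (keyed j j<i))) ,
                           trans (e10 j (<-trans j<i i<n) j≢i) (proj₂ (keyed j j<i))
            where j<i = ≤∧≢⇒< (s≤s⁻¹ j<1+i) j≢i
          ≢i : ∀ {j} → j ≢ i → s 14 0ℤ ≢ + j
          ≢i j≢i e = j≢i (ℤ.+-injective (trans (sym e) hi))
          once twice : Store
          once  = (s [ 11 , s 14 0ℤ ↦ s 14 0ℤ ]) [ 10 , s 14 0ℤ ↦ s 3 (s 14 0ℤ) ℤ.- s 9 0ℤ ]
          twice = once [ 10 , s 14 0ℤ ↦ s 7 0ℤ ]
          diff : (s [ 10 , s 14 0ℤ ↦ s 3 (s 14 0ℤ) ℤ.- s 9 0ℤ ]) 10 (s 14 0ℤ) ≡ d i ℤ.- dmin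
          diff = trans (if-≡ {x = s 14 0ℤ} refl) (cong₂ ℤ._-_ h3′ h9′)
          step : Run keyBody s (Keyed (suc i)) (cost keyBody)
          step = straight keyBody
            ( (λ le → cell twice (λ j _ j≢i → trans (if-≢ (≢i j≢i)) (if-≢ (≢i j≢i)))
                           (trans (if-≡ hi) (trans h7′ (sym (ℤ.i≥j⇒i⊓j≡j (subst₂ ℤ._≤_ h7′ diff le))))) λ _ → refl)
            , (λ ≰ → cell once (λ j _ j≢i → if-≢ (≢i j≢i))
                          (trans (trans (if-≡ hi) (cong₂ ℤ._-_ h3′ h9′))
                            (sym (ℤ.i≤j⇒i⊓j≡i (ℤ.<⇒≤ (subst₂ ℤ._<_ diff h7′ (ℤ.≰⇒> ≰)))))) λ _ → refl))

-- Instances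

Σℕ-∑ : ∀ {n} {F : Fin n → ℕ} (f : ℕ → ℕ) → (∀ i → f (toℕ i) ≡ F i) → Σℕ F ≡ ∑ n f
Σℕ-∑ {n} f f≡F = trans (sum-cong-≗ +-0-commutativeMonoid (sym ∘ f≡F)) (Σℕ-toℕ n f)

∈-values : ∀ {n} (S : Subset n) (f : Fin n → ℤ) {j} → j ∈ S → f j List.∈ values S f
∈-values S f {j} j∈S = ∈-map⁺ f (∈-filter⁺ (_∈? S) (∈-allFin j) j∈S)

values-∈ : ∀ {n} (S : Subset n) (f : Fin n → ℤ) {z} → z List.∈ values S f → ∃ λ j → j ∈ S × z ≡ f j
values-∈ {n} S f z∈ with j , j∈ , z≡ ← ∈-map⁻ f z∈ = j , proj₂ (∈-filter⁻ (_∈? S) {xs = allFin n} j∈) , z≡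

module _ {n} (S : Subset n) (ne : Nonempty S) (f : Fin n → ℤ) where

  ≤maxOver : ∀ {j} → j ∈ S → f j ℤ.≤ maxOver S ne f
  ≤maxOver j∈S = All.lookup (xs≤max _ _) (∈-values S f j∈S)

  minOver≤ : ∀ {j} → j ∈ S → minOver S ne f ℤ.≤ f j
  minOver≤ j∈S = All.lookup (min≤xs _ _) (∈-values S f j∈S)

  maxOver≤ : ∀ {v} → (∀ j → j ∈ S → f j ℤ.≤ v) → maxOver S ne f ℤ.≤ v
  maxOver≤ {v} f≤v = max≤v⁺ (f≤v _ (proj₂ ne)) (All.tabulate λ z∈ → bound (values-∈ S f z∈))
    where
    bound : ∀ {z} → (∃ λ j → j ∈ S × z ≡ f j) → z ℤ.≤ v
    bound (j , j∈S , refl) = f≤v j j∈S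

  ≤minOver : ∀ {v} → (∀ j → j ∈ S → v ℤ.≤ f j) → v ℤ.≤ minOver S ne f
  ≤minOver {v} v≤f = v≤min⁺ (v≤f _ (proj₂ ne)) (All.tabulate λ z∈ → bound (values-∈ S f z∈))
    where
    bound : ∀ {z} → (∃ λ j → j ∈ S × z ≡ f j) → v ℤ.≤ z
    bound (j , j∈S , refl) = v≤f j j∈S

module _ (I : Instance) (σ : Instance.Sequence I) where
  open Instance I

  -- The budget is handled as one inequality per pair of r-jobs: `period` supplies all of them for
  -- the output, and `good-cut` uses the one for the last and the first r-job.
  feasible⇒ : Feasible σ → ∀ i j → i ∈ Jʳ → j ∈ Jʳ → C σ i ℤ.+ + p j ℤ.≤ Kʳ ℤ.+ C σ j
  feasible⇒ er≤K i j i∈ j∈ = ≤-diff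
    (ℤ.+-mono-≤ (ℤ.+-mono-≤ (≤maxOver Jʳ Jʳ≠∅ (C σ) i∈) (minOver≤ Jʳ Jʳ≠∅ (λ j → C σ j ℤ.- + p j) j∈)) er≤K)
    (rearrange (C σ i) (maxOver Jʳ Jʳ≠∅ (C σ)) (minOver Jʳ Jʳ≠∅ (λ j → C σ j ℤ.- + p j)) (C σ j) (+ p j) Kʳ)
    where
    rearrange : ∀ c M m c′ p K → M ℤ.+ (c′ ℤ.- p) ℤ.+ K ℤ.- (c ℤ.+ m ℤ.+ (M ℤ.- m)) ≡ K ℤ.+ c′ ℤ.- (c ℤ.+ p)
    rearrange = solve-∀

  ⇒feasible : (∀ i j → i ∈ Jʳ → j ∈ Jʳ → C σ i ℤ.+ + p j ℤ.≤ Kʳ ℤ.+ C σ j) → Feasible σ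
  ⇒feasible h = ≤-diff
    (maxOver≤ Jʳ Jʳ≠∅ (C σ) {Kʳ ℤ.+ m} λ i i∈ → ≤-diff
      (≤minOver Jʳ Jʳ≠∅ (λ j → C σ j ℤ.- + p j) {C σ i ℤ.- Kʳ} λ j j∈ →
        ≤-diff (h i j i∈ j∈) (rearrange₁ (C σ i) (+ p j) Kʳ (C σ j)))
      (rearrange₂ (C σ i) Kʳ m))
    (rearrange₃ (maxOver Jʳ Jʳ≠∅ (C σ)) Kʳ m)
    where
    m = minOver Jʳ Jʳ≠∅ (λ j → C σ j ℤ.- + p j)
    rearrange₁ : ∀ c p K c′ → K ℤ.+ c′ ℤ.- (c ℤ.+ p) ≡ c′ ℤ.- p ℤ.- (c ℤ.- K)
    rearrange₁ = solve-∀
    rearrange₂ : ∀ c K m → m ℤ.- (c ℤ.- K) ≡ K ℤ.+ m ℤ.- c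
    rearrange₂ = solve-∀
    rearrange₃ : ∀ M K m → K ℤ.+ m ℤ.- M ≡ K ℤ.- (M ℤ.- m)
    rearrange₃ = solve-∀

  onTime⇒Lmax≤ : ∀ {Λ} → (∀ j → C σ j ℤ.≤ Λ ℤ.+ d j) → Lmax σ ℤ.≤ Λ
  onTime⇒Lmax≤ {Λ} h = maxOver≤ ⊤ (proj₁ Jʳ≠∅ , ∈⊤) (L σ) λ j _ → ≤-diff (h j) (rearrange (C σ j) (d j) Λ)
    where
    rearrange : ∀ c d Λ → Λ ℤ.+ d ℤ.- c ≡ Λ ℤ.- (c ℤ.- d)
    rearrange = solve-∀

  onTime : ∀ j → C σ j ℤ.≤ Lmax σ ℤ.+ d j
  onTime j = ≤-diff (≤maxOver ⊤ (proj₁ Jʳ≠∅ , ∈⊤) (L σ) {j} ∈⊤) (rearrange (C σ j) (d j) (Lmax σ))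
    where
    rearrange : ∀ c d Λ → Λ ℤ.- (c ℤ.- d) ≡ Λ ℤ.+ d ℤ.- c
    rearrange = solve-∀

-- Renumbering the jobs along a permutation

module Relabel (I : Instance) (ρ : Permutation′ (Instance.n I)) where
  open Instance I

  p′ : ℕ → ℕ
  p′ = ext 0 λ q → p (ρ ⟨$⟩ʳ q)
  d′ : ℕ → ℤ
  d′ = ext 0ℤ λ q → d (ρ ⟨$⟩ʳ q)
  r′ : ℕ → Bool
  r′ = ext false λ q → does (ρ ⟨$⟩ʳ q ∈? Jʳ)

  position : Sequence → ℕ → ℕ
  position σ = ext 0 λ q → toℕ (σ ⟨$⟩ˡ (ρ ⟨$⟩ʳ q))

  Σℕ-relabel : ∀ (F : Fin n → ℕ) (f : ℕ → ℕ) → (∀ q → f (toℕ q) ≡ F (ρ ⟨$⟩ʳ q)) → Σℕ F ≡ ∑ n f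
  Σℕ-relabel F f f≡F = trans (sum-permute +-0-commutativeMonoid F ρ) (Σℕ-∑ f f≡F)

  if-ι : ∀ b x → (if b then x else 0) ≡ ι b * x
  if-ι true  x = sym (*-identityˡ x)
  if-ι false x = refl

  module _ (dmin : ℤ) (β : ℕ) where
    open Renting n p′ d′ r′ dmin β using (load; R) renaming (C to C′; P to P′)

    P-relabel : P ≡ P′
    P-relabel = Σℕ-relabel p _ λ q → trans (*-identityˡ _) (ext-toℕ 0 (λ q → p (ρ ⟨$⟩ʳ q)) q)

    R-relabel : Σℕ (λ j → ι (does (j ∈? Jʳ)) * p j) ≡ R n
    R-relabel = Σℕ-relabel (λ j → ι (does (j ∈? Jʳ)) * p j) _ λ q →
      cong₂ (λ b x → ι b * x) (ext-toℕ false (λ q → does (ρ ⟨$⟩ʳ q ∈? Jʳ)) q) (ext-toℕ 0 (λ q → p (ρ ⟨$⟩ʳ q)) q)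

    C-relabel : ∀ σ q → C σ (ρ ⟨$⟩ʳ q) ≡ + C′ (position σ) (toℕ q)
    C-relabel σ q = cong +_ (Σℕ-relabel _ _ λ i → trans
      (cong₂ (λ b x → ι b * x)
        (cong₂ _≤ᵇ_ (ext-toℕ 0 (λ q → toℕ (σ ⟨$⟩ˡ (ρ ⟨$⟩ʳ q))) i) (ext-toℕ 0 (λ q → toℕ (σ ⟨$⟩ˡ (ρ ⟨$⟩ʳ q))) q))
        (ext-toℕ 0 (λ q → p (ρ ⟨$⟩ʳ q)) i))
      (sym (if-ι _ (p (ρ ⟨$⟩ʳ i)))))

  position-injective : ∀ σ i j → i < n → j < n → position σ i ≡ position σ j → i ≡ j
  position-injective σ i j i<n j<n = ∀-toℕ (λ i → position σ i ≡ position σ j → i ≡ j)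
    (λ x → ∀-toℕ (λ j → position σ (toℕ x) ≡ position σ j → toℕ x ≡ j) (λ y eq → cong toℕ (inj x y
      (trans (sym (ext-toℕ 0 (λ q → toℕ (σ ⟨$⟩ˡ (ρ ⟨$⟩ʳ q))) x)) (trans eq (ext-toℕ 0 (λ q → toℕ (σ ⟨$⟩ˡ (ρ ⟨$⟩ʳ q))) y))))) j j<n) i i<n
    where
    inj : ∀ x y → toℕ (σ ⟨$⟩ˡ (ρ ⟨$⟩ʳ x)) ≡ toℕ (σ ⟨$⟩ˡ (ρ ⟨$⟩ʳ y)) → x ≡ y
    inj x y eq = trans (sym (inverseˡ ρ)) (trans (cong (ρ ⟨$⟩ˡ_)
      (trans (sym (inverseʳ σ)) (trans (cong (σ ⟨$⟩ʳ_) (Fin.toℕ-injective eq)) (inverseʳ σ)))) (inverseˡ ρ))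

-- Feasibility and optimality of the output

module Optimality (I : Instance) (ρ : Permutation′ (Instance.n I)) (dmin : ℤ) (β : ℕ) where
  open Instance I
  open Relabel I ρ
  open Renting n p′ d′ r′ dmin β renaming (C to C′; P to P′)

  does-true : ∀ {A : Set} (a? : Dec A) → does a? ≡ true → A
  does-true (yes a) _ = a

  rental⇒∈ : ∀ q → r′ (toℕ q) ≡ true → ρ ⟨$⟩ʳ q ∈ Jʳ
  rental⇒∈ q eq = does-true (ρ ⟨$⟩ʳ q ∈? Jʳ) (trans (sym (ext-toℕ false (λ q → does (ρ ⟨$⟩ʳ q ∈? Jʳ)) q)) eq)

  ∈⇒rental : ∀ j → j ∈ Jʳ → r′ (toℕ (ρ ⟨$⟩ˡ j)) ≡ true
  ∈⇒rental j j∈ = trans (ext-toℕ false (λ q → does (ρ ⟨$⟩ʳ q ∈? Jʳ)) (ρ ⟨$⟩ˡ j))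
    (dec-true (ρ ⟨$⟩ʳ (ρ ⟨$⟩ˡ j) ∈? Jʳ) (subst (_∈ Jʳ) (sym (inverseʳ ρ)) j∈))

  C-sequence : ∀ σ j → C σ j ≡ + C′ (position σ) (toℕ (ρ ⟨$⟩ˡ j))
  C-sequence σ j = trans (cong (C σ) (sym (inverseʳ ρ))) (C-relabel dmin β σ (ρ ⟨$⟩ˡ j))

  p-sequence : ∀ j → p j ≡ p′ (toℕ (ρ ⟨$⟩ˡ j))
  p-sequence j = trans (cong p (sym (inverseʳ ρ))) (sym (ext-toℕ 0 (λ q → p (ρ ⟨$⟩ʳ q)) (ρ ⟨$⟩ˡ j)))

  d-sequence : ∀ j → d j ≡ d′ (toℕ (ρ ⟨$⟩ˡ j))
  d-sequence j = trans (cong d (sym (inverseʳ ρ))) (sym (ext-toℕ 0ℤ (λ q → d (ρ ⟨$⟩ʳ q)) (ρ ⟨$⟩ˡ j)))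

  feasible′ : ∀ σ → Feasible σ → ∀ i j → i < n → j < n → r′ i ≡ true → r′ j ≡ true →
              + (C′ (position σ) i + p′ j) ℤ.≤ Kʳ ℤ.+ + C′ (position σ) j
  feasible′ σ f i j i<n j<n = ∀-toℕ
    (λ i → r′ i ≡ true → r′ j ≡ true → + (C′ (position σ) i + p′ j) ℤ.≤ Kʳ ℤ.+ + C′ (position σ) j)
    (λ x → ∀-toℕ
      (λ j → r′ (toℕ x) ≡ true → r′ j ≡ true → + (C′ (position σ) (toℕ x) + p′ j) ℤ.≤ Kʳ ℤ.+ + C′ (position σ) j)
      (λ y rx ry → subst₂ (λ c z → c ℤ.≤ Kʳ ℤ.+ z)
        (cong₂ ℤ._+_ (C-relabel dmin β σ x) (cong +_ (sym (ext-toℕ 0 (λ q → p (ρ ⟨$⟩ʳ q)) y))))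
        (C-relabel dmin β σ y)
        (feasible⇒ I σ f (ρ ⟨$⟩ʳ x) (ρ ⟨$⟩ʳ y) (rental⇒∈ x rx) (rental⇒∈ y ry)))
      j j<n)
    i i<n

  onTime′ : ∀ σ → ∀ i → i < n → + C′ (position σ) i ℤ.≤ Lmax σ ℤ.+ d′ i
  onTime′ σ = ∀-toℕ (λ i → + C′ (position σ) i ℤ.≤ Lmax σ ℤ.+ d′ i) λ x →
    subst₂ (λ c z → c ℤ.≤ Lmax σ ℤ.+ z) (C-relabel dmin β σ x) (sym (ext-toℕ 0ℤ (λ q → d (ρ ⟨$⟩ʳ q)) x))
      (onTime I σ (ρ ⟨$⟩ʳ x))

  record Period (σ : Sequence) : Set where
    field
      first last : ℕ
      first<n : first < n
      last<n  : last < n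
      r-first : r′ first ≡ true
      r-last  : r′ last ≡ true
      first≤  : ∀ j → j < n → r′ j ≡ true → position σ first ≤ position σ j
      ≤last   : ∀ j → j < n → r′ j ≡ true → position σ j ≤ position σ last

  period-of : ∀ σ → Period σ
  period-of σ with extremal (λ i j → position σ j ≤ position σ i) (λ i j → ≤-total (position σ j) (position σ i)) (λ x y → ≤-trans y x) r′ n
                 | extremal (λ i j → position σ i ≤ position σ j) (λ i j → ≤-total (position σ i) (position σ j)) ≤-trans r′ n
  ... | inj₁ none | _ = ⊥-elim (true≢false (trans (sym (∈⇒rental (proj₁ Jʳ≠∅) (proj₂ Jʳ≠∅))) (none _ (Fin.toℕ<n _))))
  ... | _ | inj₁ none = ⊥-elim (true≢false (trans (sym (∈⇒rental (proj₁ Jʳ≠∅) (proj₂ Jʳ≠∅))) (none _ (Fin.toℕ<n _))))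
  ... | inj₂ (f , f<n , rf , f≤) | inj₂ (l , l<n , rl , ≤l) = record
        { first<n = f<n ; last<n = l<n ; r-first = rf ; r-last = rl ; first≤ = f≤ ; ≤last = ≤l }

  -- All r-jobs lie in the window from the first to the last one, whose length the budget bounds.
  R≤K : ∀ σ → Feasible σ → + R n ℤ.≤ Kʳ
  R≤K σ f = ≤-diff
    (ℤ.+-mono-≤ (+≤+ (Lower.window (position σ) (position-injective σ) r′ first<n (first≤ last last<n r-last)
                       λ j j<n rj → first≤ j j<n rj , ≤last j j<n rj))
                (feasible′ σ f last first last<n first<n r-last r-first))
    (rearrange (+ C′ (position σ) last) (+ p′ first) Kʳ (+ C′ (position σ) first) (+ R n))
    where
    open Period (period-of σ)
    rearrange : ∀ c p K c′ R → c ℤ.+ p ℤ.+ (K ℤ.+ c′) ℤ.- (R ℤ.+ c′ ℤ.+ (c ℤ.+ p)) ≡ K ℤ.- R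
    rearrange = solve-∀

  module _ (sorted : ∀ i j → i ≤ j → j < n → d′ i ℤ.≤ d′ j ⊎ dmin ℤ.+ + P′ ℤ.≤ d′ j)
    (attained : ∃ λ j → j < n × d′ j ≡ dmin)
    (κ : ℕ) (K≡κ : Kʳ ≡ + κ) (R≤κ : R n ≤ κ) (β≡ : β ≡ (κ ∸ R n) ⊓ P′)
    (h : ℤ) (k : ℕ) (best : Best n h k) (c : ℕ → ℕ) (plan : Plan k (G k β) c n β)
    (ρ₂ : Permutation′ n)
    (by-class : ∀ (i j : Fin n) → c (toℕ i) < c (toℕ j) ⊎ (c (toℕ i) ≡ c (toℕ j) × toℕ i < toℕ j) →
                toℕ (ρ₂ ⟨$⟩ˡ i) < toℕ (ρ₂ ⟨$⟩ˡ j)) where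

    open Best best

    -- ρ lists the jobs by due date, and ρ₂ lists the resulting indices by class.
    π : Sequence
    π = ρ₂ ∘ₚ ρ

    position-π : ∀ q → position π (toℕ q) ≡ toℕ (ρ₂ ⟨$⟩ˡ q)
    position-π q = trans (ext-toℕ 0 (λ q → toℕ (π ⟨$⟩ˡ (ρ ⟨$⟩ʳ q))) q) (cong (λ z → toℕ (ρ₂ ⟨$⟩ˡ z)) (inverseˡ ρ))

    ordered : ∀ i j → i < n → j < n → position π i ≤ position π j → c i < c j ⊎ (c i ≡ c j × i ≤ j)
    ordered i j i<n j<n = ∀-toℕ (λ i → position π i ≤ position π j → c i < c j ⊎ (c i ≡ c j × i ≤ j))
      (λ x → ∀-toℕ (λ j → position π (toℕ x) ≤ position π j → c (toℕ x) < c j ⊎ (c (toℕ x) ≡ c j × toℕ x ≤ j))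
        (λ y le → ordered-Fin x y (subst₂ _≤_ (position-π x) (position-π y) le)) j j<n) i i<n
      where
      ordered-Fin : ∀ x y → toℕ (ρ₂ ⟨$⟩ˡ x) ≤ toℕ (ρ₂ ⟨$⟩ˡ y) →
                    c (toℕ x) < c (toℕ y) ⊎ (c (toℕ x) ≡ c (toℕ y) × toℕ x ≤ toℕ y)
      ordered-Fin x y le with c (toℕ x) <? c (toℕ y) | c (toℕ x) ≟ c (toℕ y) | toℕ x ≤? toℕ y
      ... | yes lt | _      | _       = inj₁ lt
      ... | no _   | yes eq | yes x≤y = inj₂ (eq , x≤y)
      ... | no _   | yes eq | no x≰y  = contradiction le (<⇒≱ (by-class y x (inj₂ (sym eq , ≰⇒> x≰y))))
      ... | no ≮   | no ≢   | _       = contradiction le (<⇒≱ (by-class y x (inj₁ (≤∧≢⇒< (≮⇒≥ ≮) (≢ ∘ sym)))))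

    module U = Upper k k≤m (G k β) c plan (position π) ordered

    R+β≤κ : R n + β ≤ κ
    R+β≤κ = ≤-trans (+-monoʳ-≤ (R n) (≤-trans (≤-reflexive β≡) (m⊓n≤m _ _))) (≤-reflexive (m+[n∸m]≡n R≤κ))

    feasible : Feasible π
    feasible = ⇒feasible I π λ i j i∈ j∈ → subst₂ ℤ._≤_
      (sym (cong₂ ℤ._+_ (C-sequence π i) (cong +_ (p-sequence j))))
      (sym (cong₂ ℤ._+_ K≡κ (C-sequence π j)))
      (+≤+ (≤-trans (U.period _ _ (Fin.toℕ<n _) (Fin.toℕ<n _) (∈⇒rental i i∈) (∈⇒rental j j∈))
                    (+-monoˡ-≤ _ R+β≤κ)))

    β-max : ∀ b → R n + b ≤ κ → b ≤ P′ → b ≤ β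
    β-max b R+b≤κ b≤P = ≤-trans
      (⊓-glb (≤-trans (≤-reflexive (sym (m+n∸m≡n (R n) b))) (∸-monoˡ-≤ (R n) R+b≤κ)) b≤P) (≤-reflexive (sym β≡))

    module _ (σ : Sequence) (f : Feasible σ) where
      private
        open Period (period-of σ)
        open module Lo = Lower (position σ) (position-injective σ)

        within-κ : C′ (position σ) last + p′ first ≤ κ + C′ (position σ) first
        within-κ = ℤ.drop‿+≤+ (subst (λ z → + (C′ (position σ) last + p′ first) ℤ.≤ z ℤ.+ + C′ (position σ) first) K≡κ
          (feasible′ σ f last first last<n first<n r-last r-first))

      h≤Lmax : h ℤ.≤ Lmax σ
      h≤Lmax = conclude (Lo.good-cut sorted attained (Lmax σ) (onTime′ σ) κ β-max first last first<n r-first first≤ ≤last within-κ)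
        where
        conclude : (∃ λ k → k ≤ n × (∀ i → k ≤ i → i < n → r′ i ≡ false → tail i ℤ.≤ Lmax σ) × cut k ℤ.≤ Lmax σ) →
                   h ℤ.≤ Lmax σ
        conclude (k′ , k′≤n , tails , cut≤Λ) = Best.least best (Lmax σ) k′ k′≤n tails cut≤Λ

      π-onTime : ∀ i → i < n → + C′ (position π) i ℤ.≤ Lmax σ ℤ.+ d′ i
      π-onTime = U.Late.onTime (Lmax σ) (ℤ.≤-trans cut≤ h≤Lmax) (λ i k≤i i<n ri → ℤ.≤-trans (tail≤ i k≤i i<n ri) h≤Lmax)
        (Lo.edd≤ sorted attained (Lmax σ) (onTime′ σ))

      minimal : Lmax π ℤ.≤ Lmax σ
      minimal = onTime⇒Lmax≤ I π λ j → subst₂ (λ x y → x ℤ.≤ Lmax σ ℤ.+ y) (sym (C-sequence π j)) (sym (d-sequence j))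
        (π-onTime (toℕ (ρ ⟨$⟩ˡ j)) (Fin.toℕ<n (ρ ⟨$⟩ˡ j)))

    optimal : Optimal π
    optimal = feasible , minimal

-- The complete program

-- If the r-jobs alone exceed the budget, `main` is skipped and array 5 keeps its initial 0, the
-- answer for infeasible instances. The 3 stored before the second sort is the number of classes.
main program : Prog
main    = setup ⨾ forLoop 14 0 keyBody ⨾ sort ⨾ dp ⨾ back ⨾ (16 := lit (+ 3)) ⨾ sort ⨾ (5 := lit 1ℤ)
program = prep ⨾ (if var 8 ≼ var 1 th main el skip)

cells-toℕ : ∀ {n} (f : Fin n → ℤ) j → cells f (+ toℕ j) ≡ f j
cells-toℕ f zero    = refl
cells-toℕ f (suc j) = cells-toℕ (f ∘ suc) j

module Correctness (I : Instance) where
  open Instance I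

  pᴶ : ℕ → ℕ
  pᴶ = ext 0 p
  dᴶ : ℕ → ℤ
  dᴶ = ext 0ℤ d
  rᴶ : ℕ → Bool
  rᴶ = ext false λ j → does (j ∈? Jʳ)

  1≤n : 1 ≤ n
  1≤n = ≤-trans (s≤s z≤n) (Fin.toℕ<n (proj₁ Jʳ≠∅))

  input-p : ∀ j → j < n → input I 2 (+ j) ≡ + pᴶ j
  input-p = ∀-toℕ _ λ j → trans (cells-toℕ (λ j → + p j) j) (cong +_ (sym (ext-toℕ 0 p j)))

  input-d : ∀ j → j < n → input I 3 (+ j) ≡ dᴶ j
  input-d = ∀-toℕ _ λ j → trans (cells-toℕ d j) (sym (ext-toℕ 0ℤ d j))

  input-r : ∀ j → j < n → input I 4 (+ j) ≡ (if rᴶ j then 1ℤ else 0ℤ)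
  input-r = ∀-toℕ _ λ j → trans (cells-toℕ _ j)
    (cong (λ b → if b then 1ℤ else 0ℤ) (sym (ext-toℕ false (λ j → does (j ∈? Jʳ)) j)))

  RJ : ℕ
  RJ = ∑ n λ j → ι (rᴶ j) * pᴶ j

  P≡ : P ≡ ∑ n pᴶ
  P≡ = Σℕ-∑ pᴶ (ext-toℕ 0 p)

  RJ≡ : Σℕ (λ j → ι (does (j ∈? Jʳ)) * p j) ≡ RJ
  RJ≡ = Σℕ-∑ _ λ j → cong₂ (λ b x → ι b * x) (ext-toℕ false (λ j → does (j ∈? Jʳ)) j) (ext-toℕ 0 p j)

  module Prep = Preparation n pᴶ dᴶ rᴶ 1≤n

  Prepared : Store → Set
  Prepared s = s 7 0ℤ ≡ + P × s 8 0ℤ ≡ + RJ × (∀ j → j < n → s 9 0ℤ ℤ.≤ dᴶ j) × (∃ λ j → j < n × dᴶ j ≡ s 9 0ℤ)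

  prep-run : Run prep (input I) Prepared (cost (9 := 3 [ lit 0ℤ ]) + n * (23 + cost prepBody))
  prep-run = run-map (λ s ((hP , hR) , min≤ , att) → trans hP (cong +_ (sym P≡)) , hR , min≤ , att)
    (Prep.prep-correct (input I) refl input-p input-d input-r refl refl)

  infeasible : ¬ + RJ ℤ.≤ Kʳ → ∀ σ → ¬ Feasible σ
  infeasible R≰K σ f = R≰K (subst (λ z → + z ℤ.≤ Kʳ)
    (trans (sym (Relabel.R-relabel I Perm.id 0ℤ 0)) RJ≡) (Optimality.R≤K I Perm.id 0ℤ 0 σ f))

  mainBound : ℕ → ℕ
  mainBound β = cost setup + (n * (23 + cost keyBody) + (3 + suc P * (23 + n * (23 + cost sortBody)) +
    (suc β * (23 + 5) + (cost dpInit + n * (23 + (cost prepare + (suc β * (23 + cost cellBody) + cost record-cut)))) +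
     (cost backInit + n * (23 + cost backBody) + (3 + (3 + 3 * (23 + n * (23 + cost sortBody)) + 3))))))

  module Feasible-case (s₁ : Store) (u₁ : Unchanged prep (input I) s₁) (prepared : Prepared s₁) (R≤K : + RJ ℤ.≤ Kʳ) where

    dmin : ℤ
    dmin = s₁ 9 0ℤ
    κ : ℕ
    κ = ℤ.∣ Kʳ ∣
    +κ : + κ ≡ Kʳ
    +κ = ℤ.0≤i⇒+∣i∣≡i (ℤ.≤-trans (+≤+ z≤n) R≤K)
    RJ≤κ : RJ ≤ κ
    RJ≤κ = ℤ.drop‿+≤+ (subst (+ RJ ℤ.≤_) (sym +κ) R≤K)
    min≤ : ∀ j → j < n → dmin ℤ.≤ dᴶ j
    min≤ = proj₁ (proj₂ (proj₂ prepared))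
    β : ℕ
    β = (κ ∸ RJ) ⊓ P

    open Prep using (Setup; Keyed; setup-correct; keys-correct)

    keyᴶ : ℕ → ℕ
    keyᴶ = Prep.key dmin P min≤

    Ready : Store → Set
    Ready s = (∀ j → s 0 j ≡ input I 0 j) × (∀ j → s 2 j ≡ input I 2 j) × (∀ j → s 3 j ≡ input I 3 j) ×
              (∀ j → s 4 j ≡ input I 4 j) × s 8 0ℤ ≡ + RJ × s 17 0ℤ ≡ + suc β × s 18 0ℤ ≡ + β ×
              s 19 0ℤ ≡ 0ℤ ℤ.- dmin ℤ.- + P

    module Planning (ρ : Permutation′ n)
      (by-key : ∀ (i j : Fin n) → Rank.Before n keyᴶ (keyᴶ (toℕ j)) (toℕ j) (toℕ i) → toℕ (ρ ⟨$⟩ˡ i) < toℕ (ρ ⟨$⟩ˡ j))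
      (s₄ : Store) (ready : Ready s₄) (order : ∀ k → s₄ 6 (+ toℕ k) ≡ + toℕ (ρ ⟨$⟩ʳ k)) where

      open Relabel I ρ
      open Renting n p′ d′ r′ dmin β using (R; N; cut; G; Best; Plan; floor) renaming (P to P′)
      open Table n p′ d′ r′ dmin β using (W; isRental; Filled; module Filling)

      private
        h0 = proj₁ ready
        h2 = proj₁ (proj₂ ready)
        h3 = proj₁ (proj₂ (proj₂ ready))
        h4 = proj₁ (proj₂ (proj₂ (proj₂ ready)))
        h8 = proj₁ (proj₂ (proj₂ (proj₂ (proj₂ ready))))
        h17 = proj₁ (proj₂ (proj₂ (proj₂ (proj₂ (proj₂ ready)))))
        h18 = proj₁ (proj₂ (proj₂ (proj₂ (proj₂ (proj₂ (proj₂ ready))))))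
        h19 = proj₂ (proj₂ (proj₂ (proj₂ (proj₂ (proj₂ (proj₂ ready))))))

      R≡ : R n ≡ RJ
      R≡ = trans (sym (R-relabel dmin β)) RJ≡

      P≡P′ : P ≡ P′
      P≡P′ = P-relabel dmin β

      order-p : ∀ q → q < n → s₄ 2 (s₄ 6 (+ q)) ≡ + p′ q
      order-p = ∀-toℕ (λ q → s₄ 2 (s₄ 6 (+ q)) ≡ + p′ q) λ q → trans (cong (s₄ 2) (order q)) (trans (h2 _)
        (trans (cells-toℕ (λ j → + p j) (ρ ⟨$⟩ʳ q)) (cong +_ (sym (ext-toℕ 0 (λ q → p (ρ ⟨$⟩ʳ q)) q)))))

      order-d : ∀ q → q < n → s₄ 3 (s₄ 6 (+ q)) ≡ d′ q
      order-d = ∀-toℕ (λ q → s₄ 3 (s₄ 6 (+ q)) ≡ d′ q) λ q → trans (cong (s₄ 3) (order q)) (trans (h3 _)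
        (trans (cells-toℕ d (ρ ⟨$⟩ʳ q)) (sym (ext-toℕ 0ℤ (λ q → d (ρ ⟨$⟩ʳ q)) q))))

      order-r : ∀ q → q < n → s₄ 4 (s₄ 6 (+ q)) ≡ isRental q
      order-r = ∀-toℕ (λ q → s₄ 4 (s₄ 6 (+ q)) ≡ isRental q) λ q → trans (cong (s₄ 4) (order q)) (trans (h4 _)
        (trans (cells-toℕ (λ j → if does (j ∈? Jʳ) then 1ℤ else 0ℤ) (ρ ⟨$⟩ʳ q))
               (cong (λ b → if b then 1ℤ else 0ℤ) (sym (ext-toℕ false (λ q → does (ρ ⟨$⟩ʳ q ∈? Jʳ)) q)))))

      dᴶ≡ : ∀ j → dᴶ (toℕ j) ≡ d j
      dᴶ≡ = ext-toℕ 0ℤ d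

      d′≡ : ∀ q → d′ (toℕ q) ≡ d (ρ ⟨$⟩ʳ q)
      d′≡ = ext-toℕ 0ℤ (λ q → d (ρ ⟨$⟩ʳ q))

      sorted : ∀ i j → i ≤ j → j < n → d′ i ℤ.≤ d′ j ⊎ dmin ℤ.+ + P′ ℤ.≤ d′ j
      sorted i j i≤j j<n = ∀-toℕ (λ i → i ≤ j → d′ i ℤ.≤ d′ j ⊎ dmin ℤ.+ + P′ ℤ.≤ d′ j)
        (λ x → ∀-toℕ (λ j → toℕ x ≤ j → d′ (toℕ x) ℤ.≤ d′ j ⊎ dmin ℤ.+ + P′ ℤ.≤ d′ j)
          (λ y x≤y → convert x y (Prep.key-sorted dmin P min≤ _ _ (Fin.toℕ<n (ρ ⟨$⟩ʳ x)) (Fin.toℕ<n (ρ ⟨$⟩ʳ y))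
            (≮⇒≥ λ lt → <⇒≱ (subst₂ (λ u v → toℕ u < toℕ v) (inverseˡ ρ) (inverseˡ ρ)
              (by-key (ρ ⟨$⟩ʳ y) (ρ ⟨$⟩ʳ x) (inj₁ lt))) x≤y)))
          j j<n)
        i (≤-<-trans i≤j j<n) i≤j
        where
        convert : ∀ x y → dᴶ (toℕ (ρ ⟨$⟩ʳ x)) ℤ.≤ dᴶ (toℕ (ρ ⟨$⟩ʳ y)) ⊎ dmin ℤ.+ + P ℤ.≤ dᴶ (toℕ (ρ ⟨$⟩ʳ y)) →
                  d′ (toℕ x) ℤ.≤ d′ (toℕ y) ⊎ dmin ℤ.+ + P′ ℤ.≤ d′ (toℕ y)
        convert x y = Sum.map
          (subst₂ ℤ._≤_ (trans (dᴶ≡ (ρ ⟨$⟩ʳ x)) (sym (d′≡ x))) (trans (dᴶ≡ (ρ ⟨$⟩ʳ y)) (sym (d′≡ y))))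
          (subst₂ (λ u v → dmin ℤ.+ + u ℤ.≤ v) P≡P′ (trans (dᴶ≡ (ρ ⟨$⟩ʳ y)) (sym (d′≡ y))))

      attained : ∃ λ q → q < n × d′ q ≡ dmin
      attained = ∀-toℕ (λ j → dᴶ j ≡ dmin → ∃ λ q → q < n × d′ q ≡ dmin)
        (λ j eq → toℕ (ρ ⟨$⟩ˡ j) , Fin.toℕ<n _ , trans (d′≡ (ρ ⟨$⟩ˡ j)) (trans (cong d (inverseʳ ρ)) (trans (sym (dᴶ≡ j)) eq)))
        (proj₁ att) (proj₁ (proj₂ att)) (proj₂ (proj₂ att))
        where att = proj₂ (proj₂ (proj₂ prepared))

      module DP = Filling 1≤n s₄ (h0 0ℤ) order-p order-d order-r (trans h8 (cong +_ (sym R≡))) h17 h18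
        (trans h19 (cong (λ z → 0ℤ ℤ.- dmin ℤ.- + z) P≡P′))

      module Finish (s₅ : Store) (u₅ : Unchanged dp s₄ s₅) (inv : DP.Inv n s₅) where

        k : ℕ
        k = proj₁ (proj₁ (proj₂ (proj₂ (proj₂ (proj₂ inv)))))

        module BT = Backtrack n p′ d′ r′ dmin β 1≤n

        chosen : s₅ 25 0ℤ ≡ + k × Best n (s₅ 24 0ℤ) k
        chosen = proj₂ (proj₁ (proj₂ (proj₂ (proj₂ (proj₂ inv)))))

        Planned : Store → Set
        Planned s = Σ[ c ∈ (ℕ → ℕ) ] (∀ j → j < n → s 10 (+ j) ≡ + c j) × Plan k (G k β) c n β

        back-run : Run back s₅ Planned (cost backInit + n * (23 + cost backBody))
        back-run = BT.back-correct s₅ (trans (u₅ 0 refl _) (h0 0ℤ))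
          (λ q q<n → trans (u₅ 2 refl _) (trans (cong (s₄ 2) (u₅ 6 refl _)) (order-p q q<n)))
          (λ q q<n → trans (u₅ 4 refl _) (trans (cong (s₄ 4) (u₅ 6 refl _)) (order-r q q<n)))
          (trans (u₅ 17 refl _) h17) (trans (u₅ 18 refl _) h18)
          (proj₁ inv) (proj₁ (proj₂ (proj₂ (proj₂ inv)))) k (Best.k≤m (proj₂ chosen)) (proj₁ chosen)

        module Output (s₆ : Store) (u₆ : Unchanged (back ⨾ (16 := lit (+ 3))) s₅ s₆) (h16 : s₆ 16 0ℤ ≡ + 3) (planned : Planned s₆) where
          c    = proj₁ planned
          plan = proj₂ (proj₂ planned)

          c≤2 : ∀ j → j < n → c j ≤ 2
          c≤2 j j<n with Renting.kind n p′ d′ r′ dmin β plan j j<n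
          ... | Renting.rental _ eq   = ≤-trans (≤-reflexive eq) (s≤s z≤n)
          ... | Renting.after _ _ eq  = ≤-reflexive eq
          ... | Renting.before _ _ eq = ≤-trans (≤-reflexive eq) z≤n
          ... | Renting.within _ _ eq = ≤-trans (≤-reflexive eq) (s≤s z≤n)

          module S = Sorting n c 2 1≤n c≤2 s₆ (trans (u₆ 0 refl _) (trans (u₅ 0 refl _) (h0 0ℤ))) h16 (proj₁ (proj₂ planned))

          solved : ∀ s → S.Sorted s → Solves I (s [ 5 , 0ℤ ↦ 1ℤ ])
          solved s (ρ₂ , listed , by-class) = inj₁ (refl , ρ₂ ∘ₚ ρ ,
            Optimality.optimal I ρ dmin β sorted attained κ (sym +κ) (≤-trans (≤-reflexive R≡) RJ≤κ)
              (cong₂ (λ x y → (κ ∸ x) ⊓ y) (sym R≡) P≡P′) (s₅ 24 0ℤ) k (proj₂ chosen) c plan ρ₂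
              (λ i j b → by-class i j b) ,
            -- Array 11 holds the due date order here, so sorting its entries by class composes ρ₂
            -- with ρ.
            λ q → trans (listed q) (trans (u₆ 11 refl _) (trans
              (proj₂ (proj₂ (proj₂ (proj₂ (proj₂ inv)))) _ (Fin.toℕ<n (ρ₂ ⟨$⟩ʳ q))) (order (ρ₂ ⟨$⟩ʳ q)))))

          output-run : Run (sort ⨾ (5 := lit 1ℤ)) s₆ (Solves I) (3 + 3 * (23 + n * (23 + cost sortBody)) + 3)
          output-run = run-seq S.sort-correct λ s _ srt → straight (5 := lit 1ℤ) (solved s srt)

        finish-run : Run (back ⨾ (16 := lit (+ 3)) ⨾ sort ⨾ (5 := lit 1ℤ)) s₅ (Solves I)
          (cost backInit + n * (23 + cost backBody) + (3 + (3 + 3 * (23 + n * (23 + cost sortBody)) + 3)))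
        finish-run = run-seq back-run λ s u planned → run-seq
          (straight (16 := lit (+ 3)) {s = s} {Q = λ s′ → s′ 16 0ℤ ≡ + 3 × Planned s′} (refl , planned))
          λ s′ u′ (h16 , planned′) → Output.output-run s′ (unchanged-⨾ back (16 := lit (+ 3)) u u′) h16 planned′

      dp-run : Run (dp ⨾ back ⨾ (16 := lit (+ 3)) ⨾ sort ⨾ (5 := lit 1ℤ)) s₄ (Solves I)
        (W * (23 + 5) + (cost dpInit + n * (23 + (cost prepare + (W * (23 + cost cellBody) + cost record-cut)))) +
         (cost backInit + n * (23 + cost backBody) + (3 + (3 + 3 * (23 + n * (23 + cost sortBody)) + 3))))
      dp-run = run-seq DP.dp-correct Finish.finish-run

    main-run : Run main s₁ (Solves I) (mainBound β)
    main-run = run-seq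
      (setup-correct dmin P min≤ RJ κ RJ≤κ s₁ (u₁ 0 refl _) (trans (u₁ 1 refl _) (sym +κ))
        (λ j j<n → trans (u₁ 3 refl _) (input-d j j<n)) (proj₁ prepared) (proj₁ (proj₂ prepared)) refl)
      λ s₂ u₂ (h18 , h16 , h17 , h19) → run-seq
        (keys-correct dmin P min≤ RJ κ RJ≤κ s₁ (u₁ 0 refl _) (trans (u₁ 1 refl _) (sym +κ))
          (λ j j<n → trans (u₁ 3 refl _) (input-d j j<n)) (proj₁ prepared) (proj₁ (proj₂ prepared)) refl s₂ u₂)
      λ s₃ u₃ keyed → run-seq
        (Sorting.sort-correct n keyᴶ P 1≤n (Prep.key≤P dmin P min≤) s₃
          (trans (u₃ 0 refl _) (trans (u₂ 0 refl _) (u₁ 0 refl _))) (trans (u₃ 16 refl _) h16) (λ j j<n → proj₂ (keyed j j<n)))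
      λ s₄ u₄ (ρ , listed , by-key) → Planning.dp-run ρ by-key s₄
        ( (λ j → trans (u₄ 0 refl j) (trans (u₃ 0 refl j) (trans (u₂ 0 refl j) (u₁ 0 refl j))))
        , (λ j → trans (u₄ 2 refl j) (trans (u₃ 2 refl j) (trans (u₂ 2 refl j) (u₁ 2 refl j))))
        , (λ j → trans (u₄ 3 refl j) (trans (u₃ 3 refl j) (trans (u₂ 3 refl j) (u₁ 3 refl j))))
        , (λ j → trans (u₄ 4 refl j) (trans (u₃ 4 refl j) (trans (u₂ 4 refl j) (u₁ 4 refl j))))
        , trans (u₄ 8 refl _) (trans (u₃ 8 refl _) (trans (u₂ 8 refl _) (proj₁ (proj₂ prepared))))
        , trans (u₄ 17 refl _) (trans (u₃ 17 refl _) h17)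
        , trans (u₄ 18 refl _) (trans (u₃ 18 refl _) h18)
        , trans (u₄ 19 refl _) (trans (u₃ 19 refl _) h19) )
        (λ q → trans (listed q) (proj₁ (keyed _ (Fin.toℕ<n (ρ ⟨$⟩ʳ q)))))

  program-run : Run program (input I) (Solves I)
    (cost (9 := 3 [ lit 0ℤ ]) + n * (23 + cost prepBody) + (costᵀ (var 8 ≼ var 1) + mainBound P))
  program-run = run-seq prep-run λ s₁ u₁ prepared → run-if
    -- Since β ≤ P, replacing β by P removes the budget from the time bound.
    (λ R≤K → run-≤ (mainBound-mono (m⊓n≤n (ℤ.∣ Kʳ ∣ ∸ RJ) P)) (Feasible-case.main-run s₁ u₁ prepared
      (subst₂ ℤ._≤_ (proj₁ (proj₂ prepared)) (u₁ 1 refl _) R≤K)))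
    (λ R≰K → run-≤ 1≤mainBound (straight skip (inj₂ (u₁ 5 refl _ ,
      infeasible λ R≤K → R≰K (subst₂ ℤ._≤_ (sym (proj₁ (proj₂ prepared))) (sym (u₁ 1 refl _)) R≤K)))))
    where
    1≤mainBound : 1 ≤ mainBound P
    1≤mainBound = ≤-trans (≤ᵇ⇒≤ 1 (cost setup) _) (m≤m+n (cost setup) _)
    mainBound-mono : ∀ {β} → β ≤ P → mainBound β ≤ mainBound P
    mainBound-mono β≤P = +-monoʳ-≤ (cost setup) (+-monoʳ-≤ (n * (23 + cost keyBody))
      (+-monoʳ-≤ (3 + suc P * (23 + n * (23 + cost sortBody))) (+-monoˡ-≤ _ (+-mono-≤ (*-monoˡ-≤ (23 + 5) (s≤s β≤P))
        (+-monoʳ-≤ (cost dpInit) (*-monoʳ-≤ n (+-monoʳ-≤ 23 (+-monoʳ-≤ (cost prepare)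
          (+-monoˡ-≤ (cost record-cut) (*-monoˡ-≤ (23 + cost cellBody) (s≤s β≤P)))))))))))

-- The constant factor

module Bounds (n P : ℕ) (1≤n : 1 ≤ n) where

  M : ℕ
  M = n * suc P

  n≤M : n ≤ M
  n≤M = m≤m*n n (suc P)

  1+P≤M : suc P ≤ M
  1+P≤M = m≤n*m (suc P) n {{>-nonZero 1≤n}}

  -- Bounds by multiples of M compose along the shape of an expression; as a record, the relation
  -- exposes x and c to unification.
  record _≲_ (x c : ℕ) : Set where
    constructor by
    field ≤c*M : x ≤ c * M
  open _≲_

  const : ∀ c → c ≲ c
  const c = by (m≤m*n c M {{>-nonZero (≤-trans 1≤n n≤M)}})

  infixr 6 _⊞_
  _⊞_ : ∀ {x y c c′} → x ≲ c → y ≲ c′ → (x + y) ≲ (c + c′)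
  _⊞_ {c = c} {c′} (by x≤) (by y≤) = by (≤-trans (+-mono-≤ x≤ y≤) (≤-reflexive (sym (*-distribʳ-+ M c c′))))

  scale : ∀ {x} c → x ≤ M → (x * c) ≲ c
  scale {x} c x≤ = by (≤-trans (≤-reflexive (*-comm x c)) (*-monoʳ-≤ c x≤))

  reshape : ∀ {x y c} → x ≡ y → y ≲ c → x ≲ c
  reshape refl y≲ = y≲

  nest : ∀ {x y} a b → x ≤ M → x * y ≤ M → (x * (a + y * b)) ≲ (a + b)
  nest {x} {y} a b x≤ xy≤ = reshape (rearrange x y a b) (scale a x≤ ⊞ scale b xy≤)
    where
    rearrange : ∀ x y a b → x * (a + y * b) ≡ x * a + x * y * b
    rearrange = ℕ-solve-∀

  row : ∀ {W} a b e f → W ≤ suc P → (n * (a + (b + (W * e + f)))) ≲ (a + b + f + e)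
  row {W} a b e f W≤ = reshape (cong (λ z → n * z) (rearrange W a b e f)) (nest (a + b + f) e n≤M (*-monoʳ-≤ n W≤))
    where
    rearrange : ∀ W a b e f → a + (b + (W * e + f)) ≡ a + b + f + W * e
    rearrange = ℕ-solve-∀

  three : ∀ a b → (3 * (a + n * b)) ≲ (3 * a + 3 * b)
  three a b = reshape (rearrange n a b) (const (3 * a) ⊞ scale (3 * b) n≤M)
    where
    rearrange : ∀ n a b → 3 * (a + n * b) ≡ 3 * a + n * (3 * b)
    rearrange = ℕ-solve-∀

  -- Mirrors the bound of `program-run` summand by summand, with its numeric constants replaced by
  -- variables.
  total : ∀ {W} → W ≤ suc P → ∀ i₀ i₁ i₂ c₀ k c₁ s c₂ c₃ e cp cc cr c₄ b c₅ c₆ c₇ →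
    (i₀ + n * i₁ + (i₂ + (c₀ + (n * k + (c₁ + suc P * (c₂ + n * s) + (W * c₃ + (e + n * (c₄ + (cp + (W * cc + cr)))) +
      (c₅ + n * b + (c₆ + (c₆ + 3 * (c₂ + n * s) + c₇))))))))) ≲
    (i₀ + i₁ + (i₂ + (c₀ + (k + (c₁ + (c₂ + s) + (c₃ + (e + (c₄ + cp + cr + cc)) +
      (c₅ + b + (c₆ + (c₆ + (3 * c₂ + 3 * s) + c₇)))))))))
  total W≤ i₀ i₁ i₂ c₀ k c₁ s c₂ c₃ e cp cc cr c₄ b c₅ c₆ c₇ =
    (const i₀ ⊞ scale i₁ n≤M) ⊞ const i₂ ⊞ const c₀ ⊞ scale k n≤M ⊞
    (const c₁ ⊞ nest c₂ s 1+P≤M (≤-reflexive (*-comm (suc P) n))) ⊞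
    (scale c₃ (≤-trans W≤ 1+P≤M) ⊞ (const e ⊞ row c₄ cp cc cr W≤)) ⊞
    (const c₅ ⊞ scale b n≤M) ⊞ const c₆ ⊞ ((const c₆ ⊞ three c₂ s) ⊞ const c₇)

  -- Passing from P + 1 to the maximum of P and 1 at most doubles the bound, which accounts for the
  -- factor 2 in the final constant. For P = 0 the maximum leaves the n steps needed to read the
  -- input.
  M≤ : M ≤ 2 * (n * (P ⊔ 1))
  M≤ = ≤-trans (*-monoʳ-≤ n (suc≤ P)) (≤-reflexive (rearrange n (P ⊔ 1)))
    where
    suc≤ : ∀ P → suc P ≤ 2 * (P ⊔ 1)
    suc≤ P = ≤-trans (+-mono-≤ (m≤n⊔m P 1) (m≤m⊔n P 1))
      (≤-reflexive (cong (λ z → P ⊔ 1 + z) (sym (+-identityʳ (P ⊔ 1)))))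
    rearrange : ∀ n x → n * (2 * x) ≡ 2 * (n * x)
    rearrange = ℕ-solve-∀

  ≲⇒≤ : ∀ {x c} → x ≲ c → x ≤ (c * 2) * (n * (P ⊔ 1))
  ≲⇒≤ {c = c} (by x≤) = ≤-trans x≤ (≤-trans (*-monoʳ-≤ c M≤) (≤-reflexive (sym (*-assoc c 2 _))))

constant : ℕ
constant = cost (9 := 3 [ lit 0ℤ ]) + (23 + cost prepBody) + (costᵀ (var 8 ≼ var 1) + (cost setup + ((23 + cost keyBody) +
  (3 + (23 + (23 + cost sortBody)) + ((23 + 5) + (cost dpInit + (23 + cost prepare + cost record-cut + (23 + cost cellBody))) +
    (cost backInit + (23 + cost backBody) + (3 + (3 + (3 * 23 + 3 * (23 + cost sortBody)) + 3))))))))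

open Instance using (n; P)

theorem4 :
  Σ[ prog ∈ Prog ] Σ[ c ∈ ℕ ]
    ((I : Instance) →
      Σ[ t ∈ ℕ ] Σ[ s ∈ Store ]
        (⟨ prog , input I ⟩⇓[ t ] s) × Solves I s × t ≤ c * (n I * (P I ⊔ 1)))
theorem4 = program , constant * 2 , λ I →
  let open Run (Correctness.program-run I)
      open Bounds (n I) (P I) (Correctness.1≤n I)
  in time , final , exec , post , ≤-trans time≤ (≲⇒≤ {c = constant} (total ≤-refl
       (cost (9 := 3 [ lit 0ℤ ])) (23 + cost prepBody) (costᵀ (var 8 ≼ var 1)) (cost setup) (23 + cost keyBody)
       3 (23 + cost sortBody) 23 (23 + 5) (cost dpInit) (cost prepare) (23 + cost cellBody) (cost record-cut) 23
       (23 + cost backBody) (cost backInit) 3 3))
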